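{- Let $P$ be a $4$-polytope with a simplex facet $S$ in bounded position, with the vertices of $S$ labelled $v_0,v_1,v_2,v_3$ in any order. Then $f(\mathcal I^1(P;S))=f(P)+(5,20,20,5)$ and $f(\mathcal I^2(P;S))=f(P)+(4,16,16,4)$, where $f=(f_0,f_1,f_2,f_3)$ is the $f$-vector ($f_i$ = number of $i$-faces).
   Context: Conventions: for a $4$-polytope $Q\subset\mathbb R^4$ and a facet $F$, $H_F$ is the affine hull of $F$, oriented so that $Q$ lies on its closed positive side; $H_F^+$, $H_F^-$ are the open positive and negative sides. Facets are adjacent if they share a ridge ($2$-face). For a facet $T$ of $Q$ and disjoint sets $\mathcal F,\mathcal N$ of facets adjacent to $T$, $V_T(\mathcal F,\mathcal N;Q)$ is the set of points lying in $H_F^-$ for $F\in\mathcal N\cup\{T\}$, in $H_F$ for $F\in\mathcal F$, and in $H_F^+$ for all other facets $F$ of $Q$. A simplex facet is a facet that is a $3$-simplex; a simplex facet $S$ is in bounded position if the affine hulls of the four facets adjacent to $S$ meet in a point of $H_S^-$. A facet adjacent to a simplex facet $T$ is specified below by the vertex set of the triangle it shares with $T$. Construction $\mathcal I^1$: let $P^{(0)}=P$ and for $i=1,\dots,5$ let $P^{(i)}=\operatorname{conv}(P^{(i-1)}\cup\{v_{3+i}\})$ with $v_{3+i}\in V_{S_i}(\mathcal F_i,\emptyset;P^{(i-1)})$, where: $i=1$: $S_1=S$, $\mathcal F_1$ = facet across $\{v_0,v_1,v_2\}$; $i=2$: $S_2=\operatorname{conv}\{v_0,v_1,v_3,v_4\}$,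 $\mathcal F_2$ = facets across $\{v_1,v_3,v_4\}$ and $\{v_0,v_1,v_3\}$; $i=3$: $S_3=\operatorname{conv}\{v_0,v_2,v_3,v_4\}$, $\mathcal F_3$ = facets across $\{v_0,v_3,v_4\}$ and $\{v_0,v_2,v_3\}$; $i=4$: $S_4=\operatorname{conv}\{v_2,v_3,v_4,v_6\}$, $\mathcal F_4$ = facets across $\{v_2,v_3,v_4\}$ and $\{v_2,v_3,v_6\}$; $i=5$: $S_5=\operatorname{conv}\{v_0,v_2,v_4,v_6\}$, $\mathcal F_5$ = facets across $\{v_0,v_4,v_6\}$, $\{v_2,v_4,v_6\}$, $\{v_0,v_2,v_4\}$. Set $\mathcal I^1(P;S)=P^{(5)}$. Construction $\mathcal I^2$: let $Q^{(0)}=P$ and for $i=1,\dots,4$ let $Q^{(i)}=\operatorname{conv}(Q^{(i-1)}\cup\{v_{3+i}\})$ with $v_{3+i}\in V_{S_i}(\mathcal F_i,\mathcal N_i;Q^{(i-1)})$, where: $i=1$: $S_1=S$, $\mathcal F_1$ = facet across $\{v_0,v_1,v_3\}$, $\mathcal N_1=\emptyset$; $i=2$: $S_2=\operatorname{conv}\{v_1,v_2,v_3,v_4\}$, $\mathcal F_2$ = facets across $\{v_1,v_2,v_4\}$ and $\{v_1,v_2,v_3\}$, $\mathcal N_2=\emptyset$; $i=3$: $S_3=\operatorname{conv}\{v_0,v_2,v_3,v_4\}$, $\mathcal F_3$ = facets across $\{v_0,v_2,v_4\}$ and $\{v_0,v_2,v_3\}$, $\mathcal N_3$ = facet across $\{v_2,v_3,v_4\}$;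 $i=4$: $S_4=\operatorname{conv}\{v_3,v_4,v_5,v_6\}$, $\mathcal F_4$ = facets across $\{v_3,v_4,v_6\}$, $\{v_3,v_4,v_5\}$, $\{v_3,v_5,v_6\}$, $\mathcal N_4=\emptyset$. Set $\mathcal I^2(P;S)=Q^{(4)}$. (In both constructions each $S_i$ is a simplex facet of the previous polytope, the regions are nonempty, and the combinatorial type of the result depends only on $P$, $S$ and the labelling.) -}

module Defs where

open import Algebra.Bundles using (CommutativeRing)
import Algebra.Properties.Semiring.Sum as SemiringSum
open import Data.Fin.Base using (Fin; toℕ)
open import Data.List.Base using (List; []; _∷_; lookup)
import Data.List.Membership.Setoid as ListMembership
open import Data.List.Relation.Unary.Any using (Any)
open import Data.Nat.Base using (ℕ; suc)
open import Data.Product.Base using (Σ; ∃-syntax; _×_; proj₁)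
open import Data.Vec.Base as Vec using (Vec)
open import Data.Vec.Functional using (Vector)
import Data.Vec.Functional.Relation.Binary.Equality.Setoid as VectorEquality
open import Function.Bundles using (Bijection; _⇔_)
open import Level using (_⊔_) renaming (suc to lsuc)
open import Relation.Binary.Bundles using (Setoid)
open import Relation.Binary.Core using (Rel)
import Relation.Binary.Construct.On as On
import Relation.Binary.Construct.StrictToNonStrict as StrictToNonStrict
import Relation.Binary.PropositionalEquality as ≡
open import Relation.Binary.Structures using (IsStrictTotalOrder)
open import Relation.Nullary.Negation.Core using (¬_)
open import Relation.Unary using (Pred; _∈_; _∉_; _⊆_; _≐_; _∩_; _∪_)
open import Relation.Unary.Relation.Binary.Equality using (≐-setoid)

-- The intended instance is ℝ; completeness of the order plays no role.

record OrderedField c ℓ₁ ℓ₂ : Set (lsuc (c ⊔ ℓ₁ ⊔ ℓ₂)) where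
  field
    commutativeRing : CommutativeRing c ℓ₁

  open CommutativeRing commutativeRing public

  infix 4 _<_
  field
    _<_                : Rel Carrier ℓ₂
    isStrictTotalOrder : IsStrictTotalOrder _≈_ _<_
    +-monoˡ-<          : ∀ z {x y} → x < y → z + x < z + y
    *-pos              : ∀ {x y} → 0# < x → 0# < y → 0# < x * y
    0#≉1#              : ¬ 0# ≈ 1#
    inverse            : ∀ x → ¬ x ≈ 0# → ∃[ y ] x * y ≈ 1#

  open StrictToNonStrict _≈_ _<_ public using (_≤_)

module Polytopes {c ℓ₁ ℓ₂} (K : OrderedField c ℓ₁ ℓ₂) where

  open OrderedField K
  open SemiringSum semiring using (sum)

  ℓ = c ⊔ ℓ₁ ⊔ ℓ₂

  Point : Set c
  Point = Vector Carrier 4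

  pointSetoid : Setoid c ℓ₁
  pointSetoid = VectorEquality.≋-setoid setoid 4

  open Setoid pointSetoid using () renaming (_≈_ to _≋_)
  open ListMembership pointSetoid using () renaming (_∈_ to _∈ₗ_)

  Subset : Set (lsuc ℓ)
  Subset = Pred Point ℓ

  combination : ∀ {n} → Vector Carrier n → Vector Point n → Point
  combination w p j = sum (λ i → w i * p i j)

  aff : ∀ {a} → Pred Point a → Pred Point (c ⊔ ℓ₁ ⊔ a)
  aff X x = ∃[ n ] Σ (Vector Carrier n) λ w → Σ (Vector Point n) λ p →
    (∀ i → p i ∈ X) × sum w ≈ 1# × combination w p ≋ x

  conv : ∀ {a} → Pred Point a → Pred Point (ℓ ⊔ a)
  conv X x = ∃[ n ] Σ (Vector Carrier n) λ w → Σ (Vector Point n) λ p →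
    (∀ i → p i ∈ X) × (∀ i → 0# ≤ w i) × sum w ≈ 1# × combination w p ≋ x

  hull : List Point → Subset
  hull xs = conv (_∈ₗ xs)

  AffinelyIndependent : ∀ {n} → Vector Point n → Set (c ⊔ ℓ₁)
  AffinelyIndependent p = ∀ w → sum w ≈ 0# → combination w p ≋ (λ _ → 0#) →
    ∀ i → w i ≈ 0#

  HasDim : Subset → ℕ → Set ℓ
  HasDim X d = Σ (Vector Point (suc d)) λ p →
    (∀ i → p i ∈ X) × AffinelyIndependent p × X ⊆ aff (λ x → ∃[ i ] x ≋ p i)

  record AffineFunctional : Set c where
    constructor affine
    field
      normal : Point
      offset : Carrier

  infix 8 _⟨_⟩
  _⟨_⟩ : AffineFunctional → Point → Carrier
  affine a b ⟨ x ⟩ = sum (λ j → a j * x j) + b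

  NonnegativeOn : Subset → AffineFunctional → Set ℓ
  NonnegativeOn Q h = ∀ x → x ∈ Q → 0# ≤ h ⟨ x ⟩

  IsPolytope : ℕ → Subset → Set ℓ
  IsPolytope d Q = (∃[ xs ] Q ≐ hull xs) × HasDim Q d

  IsFace : Subset → Subset → Set ℓ
  IsFace Q F = ∃[ h ] NonnegativeOn Q h × F ≐ (λ x → x ∈ Q × h ⟨ x ⟩ ≈ 0#)

  IsFaceOfDim : ℕ → Subset → Subset → Set ℓ
  IsFaceOfDim d Q F = IsFace Q F × HasDim F d

  IsFacet : Subset → Subset → Set ℓ
  IsFacet = IsFaceOfDim 3

  IsRidge : Subset → Subset → Set ℓ
  IsRidge = IsFaceOfDim 2

  Faces : ℕ → Subset → Setoid (lsuc ℓ) ℓ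
  Faces d Q = On.setoid (≐-setoid Point ℓ) (proj₁ {B = IsFaceOfDim d Q})

  HasFVector : Subset → Vec ℕ 4 → Set (lsuc ℓ)
  HasFVector Q f = ∀ (i : Fin 4) →
    Bijection (≡.setoid (Fin (Vec.lookup f i))) (Faces (toℕ i) Q)

  IsSimplexWithVertices : List Point → Subset → Set ℓ
  IsSimplexWithVertices xs X = AffinelyIndependent (lookup xs) × X ≐ hull xs

  -- h cuts out the hyperplane H_F = aff F, oriented so that Q lies on the
  -- closed positive side.  For a facet F of a full-dimensional Q such an h
  -- exists and is unique up to a positive factor.
  Orients : Subset → Subset → AffineFunctional → Set ℓ
  Orients Q F h = (∀ x → x ∈ aff F ⇔ h ⟨ x ⟩ ≈ 0#) × NonnegativeOn Q h

  H⁺ H⁻ : Subset → Subset → Subset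
  H⁺ Q F x = ∃[ h ] Orients Q F h × 0# < h ⟨ x ⟩
  H⁻ Q F x = ∃[ h ] Orients Q F h × h ⟨ x ⟩ < 0#

  -- A facet is not adjacent to itself, since F ∩ F has dimension 3.
  Adjacent : Subset → Subset → Subset → Set ℓ
  Adjacent Q F G = IsRidge Q (F ∩ G)

  BoundedPosition : Subset → Subset → Set (lsuc ℓ)
  BoundedPosition Q S =
    ∃[ x ] x ∈ H⁻ Q S × (∀ F → IsFacet Q F → Adjacent Q F S → x ∈ aff F)

  Family : Set (lsuc ℓ)
  Family = Pred Subset ℓ

  -- Each inner list is the vertex set of a triangle of T.
  across : Subset → Subset → List (List Point) → Family
  across Q T triangles F = IsFacet Q F × Adjacent Q F T ×
    Any (λ triangle → F ∩ T ≐ hull triangle) triangles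

  V : (T : Subset) (𝓕 𝓝 : Family) (Q : Subset) → Pred Point (lsuc ℓ)
  V T 𝓕 𝓝 Q x = ∀ F → IsFacet Q F →
      (F ≐ T → x ∈ H⁻ Q F)
    × (F ∈ 𝓝 → x ∈ H⁻ Q F)
    × (F ∈ 𝓕 → x ∈ aff F)
    × (¬ F ≐ T → F ∉ 𝓝 → F ∉ 𝓕 → x ∈ H⁺ Q F)

  Region : (Q T : Subset) (𝓕 𝓝 : List (List Point)) → Pred Point (lsuc ℓ)
  Region Q T 𝓕 𝓝 = V T (across Q T 𝓕) (across Q T 𝓝) Q

  infixl 6 _⊞_
  _⊞_ : Subset → Point → Subset
  Q ⊞ v = conv (Q ∪ (_≋ v))

  -- An element of 𝓘¹ P S v₀ v₁ v₂ v₃ (or of 𝓘² P S v₀ v₁ v₂ v₃) is one run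
  -- of the construction: a choice of a point in each successive region.

  record 𝓘¹ (P S : Subset) (v₀ v₁ v₂ v₃ : Point) : Set (lsuc ℓ) where
    field
      v₄  : Point
      v₄∈ : v₄ ∈ Region P S
        ((v₀ ∷ v₁ ∷ v₂ ∷ []) ∷ [])
        []

    P₁ = P ⊞ v₄
    S₂ = hull (v₀ ∷ v₁ ∷ v₃ ∷ v₄ ∷ [])
    field
      v₅  : Point
      v₅∈ : v₅ ∈ Region P₁ S₂
        ((v₁ ∷ v₃ ∷ v₄ ∷ []) ∷ (v₀ ∷ v₁ ∷ v₃ ∷ []) ∷ [])
        []

    P₂ = P₁ ⊞ v₅
    S₃ = hull (v₀ ∷ v₂ ∷ v₃ ∷ v₄ ∷ [])
    field
      v₆  : Point
      v₆∈ : v₆ ∈ Region P₂ S₃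
        ((v₀ ∷ v₃ ∷ v₄ ∷ []) ∷ (v₀ ∷ v₂ ∷ v₃ ∷ []) ∷ [])
        []

    P₃ = P₂ ⊞ v₆
    S₄ = hull (v₂ ∷ v₃ ∷ v₄ ∷ v₆ ∷ [])
    field
      v₇  : Point
      v₇∈ : v₇ ∈ Region P₃ S₄
        ((v₂ ∷ v₃ ∷ v₄ ∷ []) ∷ (v₂ ∷ v₃ ∷ v₆ ∷ []) ∷ [])
        []

    P₄ = P₃ ⊞ v₇
    S₅ = hull (v₀ ∷ v₂ ∷ v₄ ∷ v₆ ∷ [])
    field
      v₈  : Point
      v₈∈ : v₈ ∈ Region P₄ S₅
        ((v₀ ∷ v₄ ∷ v₆ ∷ []) ∷ (v₂ ∷ v₄ ∷ v₆ ∷ []) ∷ (v₀ ∷ v₂ ∷ v₄ ∷ []) ∷ [])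
        []

    result : Subset
    result = P₄ ⊞ v₈

  record 𝓘² (P S : Subset) (v₀ v₁ v₂ v₃ : Point) : Set (lsuc ℓ) where
    field
      v₄  : Point
      v₄∈ : v₄ ∈ Region P S
        ((v₀ ∷ v₁ ∷ v₃ ∷ []) ∷ [])
        []

    Q₁ = P ⊞ v₄
    S₂ = hull (v₁ ∷ v₂ ∷ v₃ ∷ v₄ ∷ [])
    field
      v₅  : Point
      v₅∈ : v₅ ∈ Region Q₁ S₂
        ((v₁ ∷ v₂ ∷ v₄ ∷ []) ∷ (v₁ ∷ v₂ ∷ v₃ ∷ []) ∷ [])
        []

    Q₂ = Q₁ ⊞ v₅
    S₃ = hull (v₀ ∷ v₂ ∷ v₃ ∷ v₄ ∷ [])
    field
      v₆  : Point
      v₆∈ : v₆ ∈ Region Q₂ S₃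
        ((v₀ ∷ v₂ ∷ v₄ ∷ []) ∷ (v₀ ∷ v₂ ∷ v₃ ∷ []) ∷ [])
        ((v₂ ∷ v₃ ∷ v₄ ∷ []) ∷ [])

    Q₃ = Q₂ ⊞ v₆
    S₄ = hull (v₃ ∷ v₄ ∷ v₅ ∷ v₆ ∷ [])
    field
      v₇  : Point
      v₇∈ : v₇ ∈ Region Q₃ S₄
        ((v₃ ∷ v₄ ∷ v₆ ∷ []) ∷ (v₃ ∷ v₄ ∷ v₅ ∷ []) ∷ (v₃ ∷ v₅ ∷ v₆ ∷ []) ∷ [])
        []

    result : Subset
    result = Q₃ ⊞ v₇

{-# OPTIONS --safe #-}
module Submission where

-- Write C(Q) for the cone of affine functionals that are nonnegative on Q.  For a 4-polytope
-- it is generated by finitely many functionals (double description), and the generators can be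
-- chosen to cut out facets.  A face F of Q is "positive" (resp. "negative") with respect to a
-- point v if some member of C(Q) vanishing on F is positive (resp. negative) at v.  A face of
-- conv(Q ∪ v) is cut out by a functional that is positive or zero at v, and so is either a
-- positive face F of Q, or conv(F ∪ v) where F is neither positive nor negative (then v ∈ aff F
-- and the dimension does not change) or F is both (then the dimension goes up by one; F = ∅
-- gives v itself).  The faces of Q that are negative and not positive disappear.
--
-- If v is chosen in one of the regions of the constructions, the negative faces are the faces of
-- the simplex facet (in the third step of 𝓘², of two adjacent simplex facets), and which of
-- them are positive follows from the signs at v of a few facet functionals.  All facets of
-- the intermediate polytopes that matter are obtained from those of P around S by repeatedly
-- taking the combination of a functional negative at v and one positive at v that vanishes at v.

open import Defs
open import Algebra.Bundles using (RawRing)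
import Algebra.Properties.Ring as RingProperties
import Algebra.Properties.Semiring.Mult as Mult
import Algebra.Properties.Semiring.Sum as SemiringSum
import Algebra.Solver.Ring as RingSolver
import Algebra.Solver.Ring.AlmostCommutativeRing as ACR
open import Data.Bool.Base using (Bool; true; false; if_then_else_)
import Data.Bool.Properties as Bool
open import Data.Empty using (⊥-elim)
open import Data.Fin.Base as Fin using (Fin; zero; suc; toℕ; punchIn; punchOut; splitAt; _↑ˡ_; _↑ʳ_)
open import Data.Fin.Patterns using (0F; 1F; 2F; 3F; 4F)
import Data.Fin.Properties as Fin
open import Data.List.Base as List using (List; []; _∷_)
open import Data.List.Membership.Propositional using (find; lose) renaming (_∈_ to _∈ˡ_)
open import Data.List.Membership.Propositional.Properties using (∈-filter⁺; ∈-filter⁻; ∈-map⁺; ∈-map⁻; ∈-++⁺ˡ; ∈-++⁺ʳ; ∈-lookup; ∈-tabulate⁺; ∈-cartesianProductWith⁺)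
import Data.List.Membership.Setoid.Properties as SetoidMembership
open import Data.List.Relation.Unary.All as All using (All; []; _∷_)
open import Data.List.Relation.Unary.AllPairs using ([]; _∷_)
open import Data.List.Relation.Unary.Any as Any using (Any; here; there)
import Data.List.Relation.Unary.Any.Properties as Any
open import Data.List.Relation.Unary.Unique.Propositional using (Unique)
import Data.List.Relation.Unary.Unique.Propositional.Properties as Unique
open import Data.Maybe.Base using (Maybe; just; nothing)
open import Data.Nat.Base as ℕ using (ℕ; zero; suc)
import Data.Nat.Properties as ℕ
open import Data.Product.Base using (_×_; _,_; proj₁; proj₂; ∃-syntax; Σ)
open import Data.Sum.Base using (_⊎_; inj₁; inj₂)
open import Data.Unit.Polymorphic.Base using (⊤; tt)
open import Data.Vec.Base as Vec using (Vec; []; _∷_; lookup; zipWith)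
open import Data.Vec.Functional as Vector using (Vector; tail; removeAt; insertAt) renaming ([] to []ᵛ; _∷_ to infixr 5 _∷ᵛ_; _++_ to infixr 5 _++ᵛ_)
import Data.Vec.Functional.Properties as Vector
import Data.Vec.Properties as Vec
open import Function.Base using (_∘_)
open import Function.Bundles using (Bijection; Equivalence)
open import Level using (_⊔_)
open import Relation.Binary.Bundles using (Setoid)
open import Relation.Binary.Definitions using (tri<; tri≈; tri>)
import Relation.Binary.PropositionalEquality as ≡
open import Relation.Binary.Structures using (IsStrictTotalOrder)
open import Relation.Nullary using (¬_; Dec; yes; no; does)
open import Relation.Nullary.Decidable using (_×-dec_; _→-dec_; _⊎-dec_; ¬?; True; toWitness; from-yes; dec-true)
open import Relation.Unary using (Pred; _∈_; _⊆_; _≐_; _∪_; _∩_)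
open import Relation.Unary.Properties using (≐-refl; ≐-sym; ≐-trans)
open ≡ using (_≡_; _≢_)

-- The polytope `P` is arbitrary, so nothing is known about its faces except near `S`, and only the
-- change of the f-vector can be computed. Each lost face therefore hands its place in the given
-- enumeration to a new face, and the surplus receives fresh indices. The surplus depends on the
-- four or five vertices of the visible simplices alone, so it is a count of elements of
-- `Vec Bool n`, carried out by evaluation.
--
-- The obstacle that shapes the rest is that membership in a subset is not decidable and no
-- classical principle is assumed. Every case distinction is made on the sign of a functional at a
-- point. Being positive or negative with respect to `v` quantifies over all functionals; it becomes
-- decidable only because a witness can be sought in a finite list of facet functionals and its
-- vanishing on a face tested at finitely many corners. Likewise no compactness is available over a
-- general ordered field: supporting functionals are obtained by adding a sufficiently large
-- multiple of a known one, the multiple being found from the corners.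

_∋_ : ∀ {n} → Vec Bool n → Fin n → Set
J ∋ i = lookup J i ≡ true

_∋?_ : ∀ {n} (J : Vec Bool n) i → Dec (J ∋ i)
J ∋? i = lookup J i Bool.≟ true

_⊑_ : ∀ {n} → Vec Bool n → Vec Bool n → Set
J ⊑ L = ∀ i → J ∋ i → L ∋ i

_⊑?_ : ∀ {n} (J L : Vec Bool n) → Dec (J ⊑ L)
[] ⊑? [] = yes λ ()
(false ∷ J) ⊑? (b ∷ L) with J ⊑? L
... | yes p = yes λ { zero () ; (suc i) → p i }
... | no ¬p = no λ p → ¬p (p ∘ suc)
(true ∷ J) ⊑? (false ∷ L) = no λ p → case (p zero ≡.refl)
  where
  case : ¬ false ≡ true
  case ()
(true ∷ J) ⊑? (true ∷ L) with J ⊑? L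
... | yes p = yes λ { zero _ → ≡.refl ; (suc i) → p i }
... | no ¬p = no λ p → ¬p (p ∘ suc)

⊑-antisym : ∀ {n} {J L : Vec Bool n} → J ⊑ L → L ⊑ J → J ≡ L
⊑-antisym {J = []} {[]} _ _ = ≡.refl
⊑-antisym {J = b ∷ J} {b′ ∷ L} p q = ≡.cong₂ _∷_ (same b b′ (p zero) (q zero)) (⊑-antisym (p ∘ suc) (q ∘ suc))
  where
  same : ∀ b b′ → (b ≡ true → b′ ≡ true) → (b′ ≡ true → b ≡ true) → b ≡ b′
  same true  b′    f g = ≡.sym (f ≡.refl)
  same false true  f g = g ≡.refl
  same false false f g = ≡.refl

card : ∀ {n} → Vec Bool n → ℕ
card []          = 0
card (true ∷ J)  = suc (card J)
card (false ∷ J) = card J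

element : ∀ {n} (J : Vec Bool n) → Fin (card J) → Fin n
element (true ∷ J)  zero    = zero
element (true ∷ J)  (suc k) = suc (element J k)
element (false ∷ J) k       = suc (element J k)

element∈ : ∀ {n} (J : Vec Bool n) k → J ∋ element J k
element∈ (true ∷ J)  zero    = ≡.refl
element∈ (true ∷ J)  (suc k) = element∈ J k
element∈ (false ∷ J) k       = element∈ J k

element-injective : ∀ {n} (J : Vec Bool n) {k l} → element J k ≡ element J l → k ≡ l
element-injective (true ∷ J)  {zero}  {zero}  _ = ≡.refl
element-injective (true ∷ J)  {suc k} {suc l} e = ≡.cong suc (element-injective J (Fin.suc-injective e))
element-injective (false ∷ J) e = element-injective J (Fin.suc-injective e)

element-surjective : ∀ {n} (J : Vec Bool n) i → J ∋ i → ∃[ k ] element J k ≡ i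
element-surjective (true ∷ J)  zero    _ = zero , ≡.refl
element-surjective (true ∷ J)  (suc i) p = let k , e = element-surjective J i p in suc k , ≡.cong suc e
element-surjective (false ∷ J) (suc i) p = let k , e = element-surjective J i p in k , ≡.cong suc e

subsets : ∀ n → List (Vec Bool n)
subsets zero    = [] ∷ []
subsets (suc n) = List.map (true ∷_) (subsets n) List.++ List.map (false ∷_) (subsets n)

∈-subsets : ∀ {n} (J : Vec Bool n) → J ∈ˡ subsets n
∈-subsets []          = here ≡.refl
∈-subsets (true ∷ J)  = ∈-++⁺ˡ (∈-map⁺ (true ∷_) (∈-subsets J))
∈-subsets {suc n} (false ∷ J) = ∈-++⁺ʳ (List.map (true ∷_) (subsets n)) (∈-map⁺ (false ∷_) (∈-subsets J))

subsets-unique : ∀ n → Unique (subsets n)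
subsets-unique zero    = [] ∷ []
subsets-unique (suc n) = Unique.++⁺
  (Unique.map⁺ Vec.∷-injectiveʳ (subsets-unique n)) (Unique.map⁺ Vec.∷-injectiveʳ (subsets-unique n))
  λ (t∈ , f∈) → let _ , _ , e = ∈-map⁻ (true ∷_) t∈ ; _ , _ , e′ = ∈-map⁻ (false ∷_) f∈
                in true≢false (Vec.∷-injectiveˡ (≡.trans (≡.sym e) e′))
  where
  true≢false : ¬ true ≡ false
  true≢false ()

unique-lookup : ∀ {a} {A : Set a} {xs : List A} → Unique xs → ∀ {i j} → List.lookup xs i ≡ List.lookup xs j → i ≡ j
unique-lookup {xs = x ∷ xs} _ {zero} {zero} _ = ≡.refl
unique-lookup {xs = x ∷ xs} (x∉ ∷ _) {zero} {suc j} e = ⊥-elim (All.lookup x∉ (∈-lookup {xs = xs} j) e)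
unique-lookup {xs = x ∷ xs} (x∉ ∷ _) {suc i} {zero} e = ⊥-elim (All.lookup x∉ (∈-lookup {xs = xs} i) (≡.sym e))
unique-lookup {xs = x ∷ xs} (_ ∷ u) {suc i} {suc j} e = ≡.cong suc (unique-lookup u e)

-- Signs and arithmetic in an ordered field.

module OrderedFieldProperties {c ℓ₁ ℓ₂} (K : OrderedField c ℓ₁ ℓ₂) where

  open OrderedField K hiding (zero) public
  open IsStrictTotalOrder isStrictTotalOrder public using (compare; <-resp-≈)
    renaming (trans to <-trans; irrefl to <-irrefl)
  open RingProperties ring public using (-‿distribˡ-*; -‿distribʳ-*; -‿involutive; -0#≈0#)

  -- The ring solver needs a coefficient ring with decidable equality; K itself does not
  -- compute, so coefficients are formal differences of natural numbers.

  module Solver where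
    open Mult semiring using (×-homo-+; ×1-homo-*; ×-congˡ) renaming (_×_ to _·_)
    open RingProperties ring using (-‿+-comm)
    open import Relation.Binary.Reasoning.Setoid setoid

    Diff : RawRing _ _
    Diff = record
      { Carrier = ℕ × ℕ
      ; _≈_ = _≡_
      ; _+_ = λ (a , b) (a′ , b′) → a ℕ.+ a′ , b ℕ.+ b′
      ; _*_ = λ (a , b) (a′ , b′) → a ℕ.* a′ ℕ.+ b ℕ.* b′ , a ℕ.* b′ ℕ.+ b ℕ.* a′
      ; -_  = λ (a , b) → b , a
      ; 0#  = 0 , 0
      ; 1#  = 1 , 0
      }

    ⟦_⟧ : ℕ × ℕ → Carrier
    ⟦ a , b ⟧ = a · 1# + - (b · 1#)

    almost : ACR.AlmostCommutativeRing _ _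
    almost = ACR.fromCommutativeRing commutativeRing

    open import Algebra.Solver.Ring.NaturalCoefficients.Default commutativeSemiring as S
      using (_:+_; _:*_; _:=_)

    shuffle : ∀ a b c d → (a + b) + (c + d) ≈ (a + c) + (b + d)
    shuffle = S.solve 4 (λ a b c d → (a :+ b) :+ (c :+ d) := (a :+ c) :+ (b :+ d)) refl

    foil : ∀ a b c d → (a * c + b * d) + (a * d + b * c) ≈ (a + b) * (c + d)
    foil = S.solve 4 (λ a b c d → (a :* c :+ b :* d) :+ (a :* d :+ b :* c) := (a :+ b) :* (c :+ d)) refl

    -*- : ∀ x y → - x * - y ≈ x * y
    -*- x y = begin
      - x * - y      ≈⟨ sym (-‿distribˡ-* x (- y)) ⟩
      - (x * - y)    ≈⟨ -‿cong (sym (-‿distribʳ-* x y)) ⟩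
      - - (x * y)    ≈⟨ -‿involutive _ ⟩
      x * y          ∎

    morphism : Diff ACR.-Raw-AlmostCommutative⟶ almost
    morphism = record
      { ⟦_⟧ = ⟦_⟧
      ; +-homo = λ (a , b) (a′ , b′) → begin
          ⟦ a ℕ.+ a′ , b ℕ.+ b′ ⟧
            ≈⟨ +-cong (×-homo-+ 1# a a′) (trans (-‿cong (×-homo-+ 1# b b′)) (sym (-‿+-comm _ _))) ⟩
          (a · 1# + a′ · 1#) + (- (b · 1#) + - (b′ · 1#))
            ≈⟨ shuffle _ _ _ _ ⟩
          ⟦ a , b ⟧ + ⟦ a′ , b′ ⟧ ∎
      ; *-homo = λ (a , b) (a′ , b′) → begin
          ⟦ a ℕ.* a′ ℕ.+ b ℕ.* b′ , a ℕ.* b′ ℕ.+ b ℕ.* a′ ⟧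
            ≈⟨ +-cong
                (trans (×-homo-+ 1# (a ℕ.* a′) (b ℕ.* b′))
                  (+-cong (×1-homo-* a a′) (trans (×1-homo-* b b′) (sym (-*- _ _)))))
                (trans (-‿cong (×-homo-+ 1# (a ℕ.* b′) (b ℕ.* a′)))
                  (trans (sym (-‿+-comm _ _))
                    (+-cong (trans (-‿cong (×1-homo-* a b′)) (-‿distribʳ-* _ _))
                            (trans (-‿cong (×1-homo-* b a′)) (-‿distribˡ-* _ _))))) ⟩
          ((a · 1#) * (a′ · 1#) + - (b · 1#) * - (b′ · 1#))
            + ((a · 1#) * - (b′ · 1#) + - (b · 1#) * (a′ · 1#))
            ≈⟨ foil _ _ _ _ ⟩
          ⟦ a , b ⟧ * ⟦ a′ , b′ ⟧ ∎
      ; -‿homo = λ (a , b) → begin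
          b · 1# + - (a · 1#)        ≈⟨ +-comm _ _ ⟩
          - (a · 1#) + b · 1#        ≈⟨ +-congˡ (sym (-‿involutive _)) ⟩
          - (a · 1#) + - - (b · 1#)  ≈⟨ -‿+-comm _ _ ⟩
          - ⟦ a , b ⟧                ∎
      ; 0-homo = trans (+-identityˡ _) -0#≈0#
      ; 1-homo = trans (+-cong (+-identityʳ _) -0#≈0#) (+-identityʳ _)
      }

    -- Pairs are compared as integers, by a + b′ ≡ a′ + b, which is coarser than equality of pairs.
    -- Without this the coefficient (1 , 1) of a cancelled term would not be recognised as zero.
    equal? : ∀ x y → Maybe (⟦ x ⟧ ≈ ⟦ y ⟧)
    equal? (a , b) (a′ , b′) with a ℕ.+ b′ ℕ.≟ a′ ℕ.+ b
    ... | no _  = nothing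
    ... | yes e = just (begin
      A + - B                 ≈⟨ +-congʳ (sym (+-identityʳ _)) ⟩
      (A + 0#) + - B          ≈⟨ +-congʳ (+-congˡ (sym (-‿inverseʳ B′))) ⟩
      (A + (B′ + - B′)) + - B ≈⟨ +-congʳ (sym (+-assoc _ _ _)) ⟩
      ((A + B′) + - B′) + - B ≈⟨ +-congʳ (+-congʳ (trans (sym (×-homo-+ 1# a b′)) (trans (×-congˡ e) (×-homo-+ 1# a′ b)))) ⟩
      ((A′ + B) + - B′) + - B ≈⟨ +-congʳ (+-assoc _ _ _) ⟩
      (A′ + (B + - B′)) + - B ≈⟨ +-congʳ (+-congˡ (+-comm _ _)) ⟩
      (A′ + (- B′ + B)) + - B ≈⟨ +-congʳ (sym (+-assoc _ _ _)) ⟩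
      ((A′ + - B′) + B) + - B ≈⟨ +-assoc _ _ _ ⟩
      (A′ + - B′) + (B + - B) ≈⟨ +-congˡ (-‿inverseʳ B) ⟩
      (A′ + - B′) + 0#        ≈⟨ +-identityʳ _ ⟩
      A′ + - B′               ∎)
      where
      A = a · 1#
      A′ = a′ · 1#
      B = b · 1#
      B′ = b′ · 1#

  open RingSolver Solver.Diff Solver.almost Solver.morphism Solver.equal? public
    using (solve; _:+_; _:*_; :-_; _:=_)

  data Sign (x : Carrier) : Set (ℓ₁ Level.⊔ ℓ₂) where
    neg  : x < 0# → Sign x
    null : x ≈ 0# → Sign x
    pos  : 0# < x → Sign x

  sign : ∀ x → Sign x
  sign x with compare x 0#
  ... | tri< x<0 _ _ = neg x<0
  ... | tri≈ _ x≈0 _ = null x≈0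
  ... | tri> _ _ 0<x = pos 0<x

  _≈0? : ∀ x → Dec (x ≈ 0#)
  x ≈0? = IsStrictTotalOrder._≟_ isStrictTotalOrder x 0#

  0<? : ∀ x → Dec (0# < x)
  0<? x = IsStrictTotalOrder._<?_ isStrictTotalOrder 0# x

  <0? : ∀ x → Dec (x < 0#)
  <0? x = IsStrictTotalOrder._<?_ isStrictTotalOrder x 0#

  0≤? : ∀ x → Dec (0# ≤ x)
  0≤? x with sign x
  ... | pos p  = yes (inj₁ p)
  ... | null z = yes (inj₂ (sym z))
  ... | neg n  = no λ { (inj₁ p) → <-irrefl refl (<-trans n p) ; (inj₂ z) → <-irrefl (sym z) n }

  pos-resp : ∀ {x y} → x ≈ y → 0# < x → 0# < y
  pos-resp = proj₁ <-resp-≈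

  neg-resp : ∀ {x y} → x ≈ y → x < 0# → y < 0#
  neg-resp = proj₂ <-resp-≈

  nonneg-resp : ∀ {x y} → x ≈ y → 0# ≤ x → 0# ≤ y
  nonneg-resp e (inj₁ p) = inj₁ (pos-resp e p)
  nonneg-resp e (inj₂ z) = inj₂ (trans z e)

  pos⇒≉0 : ∀ {x} → 0# < x → x ≉ 0#
  pos⇒≉0 p z = <-irrefl (sym z) p

  neg⇒≉0 : ∀ {x} → x < 0# → x ≉ 0#
  neg⇒≉0 n z = <-irrefl z n

  pos⇒≮0 : ∀ {x} → 0# < x → ¬ x < 0#
  pos⇒≮0 p n = <-irrefl refl (<-trans p n)

  nonneg⇒≮0 : ∀ {x} → 0# ≤ x → ¬ x < 0#
  nonneg⇒≮0 (inj₁ p) n = pos⇒≮0 p n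
  nonneg⇒≮0 (inj₂ z) n = neg⇒≉0 n (sym z)

  ≮0⇒nonneg : ∀ {x} → ¬ x < 0# → 0# ≤ x
  ≮0⇒nonneg {x} ¬n with sign x
  ... | neg n  = ⊥-elim (¬n n)
  ... | null z = inj₂ (sym z)
  ... | pos p  = inj₁ p

  nonneg-split : ∀ {x} → 0# ≤ x → x ≈ 0# ⊎ 0# < x
  nonneg-split (inj₁ p) = inj₂ p
  nonneg-split (inj₂ z) = inj₁ (sym z)

  nonneg∧≯0⇒0 : ∀ {x} → 0# ≤ x → ¬ 0# < x → x ≈ 0#
  nonneg∧≯0⇒0 (inj₁ p) ¬p = ⊥-elim (¬p p)
  nonneg∧≯0⇒0 (inj₂ z) _  = sym z

  ≮0∧≯0⇒0 : ∀ {x} → ¬ x < 0# → ¬ 0# < x → x ≈ 0#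
  ≮0∧≯0⇒0 ¬n = nonneg∧≯0⇒0 (≮0⇒nonneg ¬n)

  nonneg∧≉0⇒pos : ∀ {x} → 0# ≤ x → x ≉ 0# → 0# < x
  nonneg∧≉0⇒pos (inj₁ p) _  = p
  nonneg∧≉0⇒pos (inj₂ z) ¬z = ⊥-elim (¬z (sym z))

  neg⇒-pos : ∀ {x} → x < 0# → 0# < - x
  neg⇒-pos {x} n = proj₁ <-resp-≈ (+-identityʳ _)
    (proj₂ <-resp-≈ (-‿inverseˡ x) (+-monoˡ-< (- x) n))

  pos⇒-neg : ∀ {x} → 0# < x → - x < 0#
  pos⇒-neg {x} p = proj₁ <-resp-≈ (-‿inverseˡ x)
    (proj₂ <-resp-≈ (+-identityʳ _) (+-monoˡ-< (- x) p))

  -pos⇒neg : ∀ {x} → 0# < - x → x < 0#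
  -pos⇒neg p = neg-resp (-‿involutive _) (pos⇒-neg p)

  pos+nonneg : ∀ {x y} → 0# < x → 0# ≤ y → 0# < x + y
  pos+nonneg {x} {y} p (inj₁ q) = <-trans p (proj₂ <-resp-≈ (+-identityʳ x) (+-monoˡ-< x q))
  pos+nonneg {x} {y} p (inj₂ z) = pos-resp (trans (sym (+-identityʳ x)) (+-congˡ z)) p

  nonneg+pos : ∀ {x y} → 0# ≤ x → 0# < y → 0# < x + y
  nonneg+pos n p = pos-resp (+-comm _ _) (pos+nonneg p n)

  nonneg+nonneg : ∀ {x y} → 0# ≤ x → 0# ≤ y → 0# ≤ x + y
  nonneg+nonneg (inj₁ p) n = inj₁ (pos+nonneg p n)
  nonneg+nonneg (inj₂ z) n = nonneg-resp (trans (sym (+-identityˡ _)) (+-congʳ z)) n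

  nonneg*nonneg : ∀ {x y} → 0# ≤ x → 0# ≤ y → 0# ≤ x * y
  nonneg*nonneg (inj₁ p) (inj₁ q) = inj₁ (*-pos p q)
  nonneg*nonneg (inj₁ p) (inj₂ z) = inj₂ (sym (trans (*-congˡ (sym z)) (zeroʳ _)))
  nonneg*nonneg (inj₂ z) _        = inj₂ (sym (trans (*-congʳ (sym z)) (zeroˡ _)))

  nonneg+nonneg≈0 : ∀ {x y} → 0# ≤ x → 0# ≤ y → x + y ≈ 0# → x ≈ 0# × y ≈ 0#
  nonneg+nonneg≈0 n m e =
      nonneg∧≯0⇒0 n (λ p → pos⇒≉0 (pos+nonneg p m) e)
    , nonneg∧≯0⇒0 m (λ p → pos⇒≉0 (nonneg+pos n p) e)

  0<1 : 0# < 1#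
  0<1 with sign 1#
  ... | pos p  = p
  ... | null z = ⊥-elim (0#≉1# (sym z))
  ... | neg n  = pos-resp (trans (Solver.-*- 1# 1#) (*-identityʳ 1#)) (*-pos (neg⇒-pos n) (neg⇒-pos n))

  pos*neg : ∀ {x y} → 0# < x → y < 0# → x * y < 0#
  pos*neg p n = -pos⇒neg (pos-resp (sym (-‿distribʳ-* _ _)) (*-pos p (neg⇒-pos n)))

  *-zeroʳ : ∀ x {y} → y ≈ 0# → x * y ≈ 0#
  *-zeroʳ x z = trans (*-congˡ z) (zeroʳ x)

  *-zeroˡ : ∀ {x} y → x ≈ 0# → x * y ≈ 0#
  *-zeroˡ y z = trans (*-congʳ z) (zeroˡ y)

  ≉0∧*≈0⇒≈0 : ∀ {x y} → x ≉ 0# → x * y ≈ 0# → y ≈ 0#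
  ≉0∧*≈0⇒≈0 {x} {y} ¬z e with inverse x ¬z
  ... | i , x*i≈1 = trans (sym (*-identityˡ y)) (trans (*-congʳ (trans (sym x*i≈1) (*-comm x i)))
    (trans (*-assoc i x y) (*-zeroʳ i e)))

  inverse-pos : ∀ {x} → 0# < x → ∃[ y ] 0# < y × x * y ≈ 1#
  inverse-pos {x} p with inverse x (pos⇒≉0 p)
  ... | y , e with sign y
  ... | pos q  = y , q , e
  ... | null z = ⊥-elim (0#≉1# (trans (sym (*-zeroʳ x z)) e))
  ... | neg n  = ⊥-elim (pos⇒≮0 0<1 (neg-resp e (pos*neg p n)))

  pos*-reflects-nonneg : ∀ {x y} → 0# < x → 0# ≤ x * y → 0# ≤ y
  pos*-reflects-nonneg p h = ≮0⇒nonneg λ n → nonneg⇒≮0 h (pos*neg p n)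

  pos*-reflects-pos : ∀ {x y} → 0# < x → 0# < x * y → 0# < y
  pos*-reflects-pos {x} p h = nonneg∧≉0⇒pos (pos*-reflects-nonneg p (inj₁ h))
    λ z → pos⇒≉0 h (*-zeroʳ x z)

  +-zero : ∀ {x y} → x ≈ 0# → y ≈ 0# → x + y ≈ 0#
  +-zero a b = trans (+-cong a b) (+-identityʳ 0#)

-- Linear algebra with affine functionals on four-dimensional space.

module AffineFunctionals {c ℓ₁ ℓ₂} (K : OrderedField c ℓ₁ ℓ₂) where

  open OrderedFieldProperties K
  open Polytopes K public
  open import Relation.Binary.Reasoning.Setoid setoid
  open SemiringSum semiring public using (sum; sum-cong-≋; ∑-distrib-+; ∑-comm; *-distribˡ-sum; *-distribʳ-sum; sum-remove)
  open Setoid pointSetoid public using () renaming (_≈_ to _≋_; refl to ≋-refl; sym to ≋-sym; trans to ≋-trans)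

  sum-zero : ∀ {n} (t : Vector Carrier n) → (∀ i → t i ≈ 0#) → sum t ≈ 0#
  sum-zero {zero}  t z = refl
  sum-zero {suc n} t z = +-zero (z zero) (sum-zero (tail t) (z ∘ suc))

  sum-single : ∀ {n} (t : Vector Carrier n) i → (∀ j → j ≢ i → t j ≈ 0#) → sum t ≈ t i
  sum-single {suc n} t i z = begin
    sum t                       ≈⟨ sum-remove {i = i} t ⟩
    t i + sum (removeAt t i)    ≈⟨ +-congˡ (sum-zero (removeAt t i) λ k → z _ (Fin.punchInᵢ≢i i k)) ⟩
    t i + 0#                    ≈⟨ +-identityʳ _ ⟩
    t i                         ∎

  sum-nonneg : ∀ {n} (t : Vector Carrier n) → (∀ i → 0# ≤ t i) → 0# ≤ sum t
  sum-nonneg {zero}  t h = inj₂ refl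
  sum-nonneg {suc n} t h = nonneg+nonneg (h zero) (sum-nonneg (tail t) (h ∘ suc))

  dot : ∀ {m} → Vector Carrier m → Vector Carrier m → Carrier
  dot w x = sum λ j → w j * x j

  dot-comm : ∀ {m} (w x : Vector Carrier m) → dot w x ≈ dot x w
  dot-comm w x = sum-cong-≋ λ j → *-comm (w j) (x j)

  dot-linearˡ : ∀ {m} (a b : Vector Carrier m) s x → dot (λ j → a j + s * b j) x ≈ dot a x + s * dot b x
  dot-linearˡ a b s x = begin
    sum (λ j → (a j + s * b j) * x j)
      ≈⟨ sum-cong-≋ (λ j → trans (distribʳ (x j) (a j) (s * b j)) (+-congˡ (*-assoc s (b j) (x j)))) ⟩
    sum (λ j → a j * x j + s * (b j * x j))
      ≈⟨ ∑-distrib-+ (λ j → a j * x j) (λ j → s * (b j * x j)) ⟩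
    dot a x + sum (λ j → s * (b j * x j))
      ≈⟨ +-congˡ (sym (*-distribˡ-sum s (λ j → b j * x j))) ⟩
    dot a x + s * dot b x ∎

  dot-linearʳ : ∀ {m} (a b : Vector Carrier m) s w → dot w (λ j → a j + s * b j) ≈ dot w a + s * dot w b
  dot-linearʳ a b s w = begin
    dot w (λ j → a j + s * b j)  ≈⟨ dot-comm w _ ⟩
    dot (λ j → a j + s * b j) w  ≈⟨ dot-linearˡ a b s w ⟩
    dot a w + s * dot b w        ≈⟨ +-cong (dot-comm a w) (*-congˡ (dot-comm b w)) ⟩
    dot w a + s * dot w b        ∎

  dot-sum : ∀ {m n} w (c : Vector Carrier n) (p : Vector (Vector Carrier m) n) →
    dot w (λ j → sum λ i → c i * p i j) ≈ sum (λ i → c i * dot w (p i))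
  dot-sum w c p = begin
    sum (λ j → w j * sum (λ i → c i * p i j))
      ≈⟨ sum-cong-≋ (λ j → *-distribˡ-sum (w j) (λ i → c i * p i j)) ⟩
    sum (λ j → sum λ i → w j * (c i * p i j))
      ≈⟨ ∑-comm (λ j i → w j * (c i * p i j)) ⟩
    sum (λ i → sum λ j → w j * (c i * p i j))
      ≈⟨ sum-cong-≋ (λ i → sum-cong-≋ λ j → solve 3 (λ w c p → w :* (c :* p) := c :* (w :* p)) refl (w j) (c i) (p i j)) ⟩
    sum (λ i → sum λ j → c i * (w j * p i j))
      ≈⟨ sum-cong-≋ (λ i → sym (*-distribˡ-sum (c i) (λ j → w j * p i j))) ⟩
    sum (λ i → c i * dot w (p i)) ∎

  unit : ∀ {m} → Fin m → Vector Carrier m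
  unit zero    = 1# ∷ᵛ λ _ → 0#
  unit (suc j) = 0# ∷ᵛ unit j

  dot-unit : ∀ {m} (x : Vector Carrier m) j → dot x (unit j) ≈ x j
  dot-unit x zero    = trans (+-cong (*-identityʳ _) (sum-zero (λ k → x (suc k) * 0#) λ k → zeroʳ (x (suc k)))) (+-identityʳ _)
  dot-unit x (suc j) = trans (+-cong (zeroʳ _) (dot-unit (tail x) j)) (+-identityˡ _)

  -- The Fredholm alternative, by elimination of the first vector. Either `p zero` lies in the span
  -- of the others and imposes no new condition, or some `w₀` kills the others but not `p zero`, and
  -- then `p zero` can be projected away. Here, as everywhere later, the alternative comes from
  -- deciding equality with zero in the field.
  span-or-separate : ∀ {m n} (p : Vector (Vector Carrier m) n) (y : Vector Carrier m) →
    (Σ (Vector Carrier n) λ c → ∀ j → sum (λ i → c i * p i j) ≈ y j) ⊎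
    (Σ (Vector Carrier m) λ w → (∀ i → dot w (p i) ≈ 0#) × dot w y ≉ 0#)
  span-or-separate {m} {zero} p y with Fin.all? (λ j → y j ≈0?)
  ... | yes z = inj₁ ((λ ()) , λ j → sym (z j))
  ... | no ¬z with Fin.¬∀⟶∃¬ m _ (λ j → y j ≈0?) ¬z
  ...   | j , yj = inj₂ (unit j , (λ ()) , λ z → yj (trans (sym (dot-unit y j)) (trans (dot-comm y _) z)))
  span-or-separate {m} {suc n} p y with span-or-separate (tail p) (p zero)
  ... | inj₁ (c₀ , e₀) with span-or-separate (tail p) y
  ...   | inj₁ (c , e) = inj₁ ((0# ∷ᵛ c) , λ j → trans (+-cong (zeroˡ _) (e j)) (+-identityˡ _))
  ...   | inj₂ (w , z , nz) = inj₂ (w , (λ { zero → p₀ ; (suc i) → z i }) , nz)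
    where
    p₀ : dot w (p zero) ≈ 0#
    p₀ = begin
      dot w (p zero)                                      ≈⟨ sum-cong-≋ (λ j → *-congˡ (sym (e₀ j))) ⟩
      dot w (λ j → sum λ i → c₀ i * p (suc i) j)          ≈⟨ dot-sum w c₀ (tail p) ⟩
      sum (λ i → c₀ i * dot w (p (suc i)))                ≈⟨ sum-zero (λ i → c₀ i * dot w (p (suc i))) (λ i → *-zeroʳ (c₀ i) (z i)) ⟩
      0#                                                  ∎
  span-or-separate {m} {suc n} p y | inj₂ (w₀ , z₀ , nz₀) with inverse _ nz₀
  -- The vector passed on is the projection of `y` along `p zero` into the kernel of `w₀`.
  ... | r , e₀ with span-or-separate (tail p) (λ j → y j + - (dot w₀ y * r) * p zero j)
  ...   | inj₁ (c , e) = inj₁ ((dot w₀ y * r) ∷ᵛ c , λ j → trans (+-congˡ (e j))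
            (solve 3 (λ k p y → k :* p :+ (y :+ :- k :* p) := y) refl (dot w₀ y * r) (p zero j) (y j)))
  ...   | inj₂ (w₁ , z₁ , nz₁) = inj₂ (w , z , λ e → nz₁ (trans at-y e))
    where
    s = dot w₁ (p zero) * r
    -- The transposed projection applied to `w₁`: it kills `p zero`, and its value at `y` is that of
    -- `w₁` at the projected `y`.
    w = λ j → w₁ j + - s * w₀ j
    z : ∀ i → dot w (p i) ≈ 0#
    z (suc i) = trans (dot-linearˡ w₁ w₀ (- s) _) (+-zero (z₁ i) (*-zeroʳ _ (z₀ i)))
    z zero = begin
      dot w (p zero)                                ≈⟨ dot-linearˡ w₁ w₀ (- s) _ ⟩
      dot w₁ (p zero) + - s * dot w₀ (p zero)
        ≈⟨ solve 3 (λ a r b → a :+ :- (a :* r) :* b := a :+ :- (a :* (b :* r))) refl (dot w₁ (p zero)) r (dot w₀ (p zero)) ⟩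
      dot w₁ (p zero) + - (dot w₁ (p zero) * (dot w₀ (p zero) * r))
        ≈⟨ +-congˡ (-‿cong (trans (*-congˡ e₀) (*-identityʳ _))) ⟩
      dot w₁ (p zero) + - dot w₁ (p zero)           ≈⟨ -‿inverseʳ _ ⟩
      0#                                            ∎
    at-y : dot w₁ (λ j → y j + - (dot w₀ y * r) * p zero j) ≈ dot w y
    at-y = begin
      dot w₁ (λ j → y j + - (dot w₀ y * r) * p zero j)  ≈⟨ dot-linearʳ y (p zero) _ w₁ ⟩
      dot w₁ y + - (dot w₀ y * r) * dot w₁ (p zero)
        ≈⟨ solve 4 (λ a b r c → a :+ :- (b :* r) :* c := a :+ :- (c :* r) :* b) refl (dot w₁ y) (dot w₀ y) r (dot w₁ (p zero)) ⟩
      dot w₁ y + - s * dot w₀ y                         ≈⟨ sym (dot-linearˡ w₁ w₀ (- s) y) ⟩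
      dot w y                                           ∎

  -- Gaussian elimination by columns. A column of zeros can be ignored; otherwise a row with nonzero
  -- first entry clears that column and uses up one row together with one column.
  left-kernel : ∀ m {n} → m ℕ.< n → (A : Fin n → Fin m → Carrier) →
    Σ (Vector Carrier n) λ c → (∃[ i ] c i ≉ 0#) × (∀ j → sum (λ i → c i * A i j) ≈ 0#)
  left-kernel zero {suc n} _ A = (λ _ → 1#) , (zero , λ e → 0#≉1# (sym e)) , λ ()
  left-kernel (suc m) {suc n} (ℕ.s≤s m<n) A with Fin.any? (λ i → ¬? (A i zero ≈0?))
  ... | no none with left-kernel m (ℕ.m<n⇒m<1+n m<n) (λ i j → A i (suc j))
  ...   | c , nz , e = c , nz , λ { zero → sum-zero (λ i → c i * A i zero) λ i → *-zeroʳ (c i) (col i) ; (suc j) → e j }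
    where
    col : ∀ i → A i zero ≈ 0#
    col i with A i zero ≈0?
    ... | yes z = z
    ... | no ¬z = ⊥-elim (none (i , ¬z))
  left-kernel (suc m) {suc n} (ℕ.s≤s m<n) A | yes (i₀ , nz₀) with inverse _ nz₀
  ... | r , e₀ = d , (punchIn i₀ (proj₁ nz′) , λ z → proj₂ nz′ (trans (reflexive (≡.sym (d-rest _))) z)) , all-columns
    where
    row : Fin n → Fin (suc n)
    row = punchIn i₀
    a : Fin n → Carrier
    a k = A (row k) zero * r
    reduced : Fin n → Fin (suc m) → Carrier
    reduced k j = A (row k) j + - (a k * A i₀ j)
    IH = left-kernel m m<n (λ k j → reduced k (suc j))
    c′ = proj₁ IH
    nz′ = proj₁ (proj₂ IH)
    -- The weight of the pivot row compensates the multiples of it that were subtracted from the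
    -- other rows.
    d = insertAt c′ i₀ (- sum (λ k → c′ k * a k))
    d-rest : ∀ k → d (row k) ≡ c′ k
    d-rest = Vector.insertAt-punchIn c′ i₀ _
    reduced-zero : ∀ j → sum (λ k → c′ k * reduced k j) ≈ 0#
    reduced-zero zero = sum-zero (λ k → c′ k * reduced k zero) λ k → *-zeroʳ (c′ k) (begin
      A (row k) zero + - (A (row k) zero * r * A i₀ zero)
        ≈⟨ +-congˡ (-‿cong (trans (*-assoc _ _ _) (trans (*-congˡ (trans (*-comm r _) e₀)) (*-identityʳ _)))) ⟩
      A (row k) zero + - A (row k) zero  ≈⟨ -‿inverseʳ _ ⟩
      0# ∎)
    reduced-zero (suc j) = proj₂ (proj₂ IH) j
    all-columns : ∀ j → sum (λ i → d i * A i j) ≈ 0#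
    all-columns j = begin
      sum (λ i → d i * A i j)
        ≈⟨ sum-remove {i = i₀} (λ i → d i * A i j) ⟩
      d i₀ * A i₀ j + sum (λ k → d (row k) * A (row k) j)
        ≈⟨ +-cong (*-congʳ (reflexive (Vector.insertAt-lookup c′ i₀ _)))
                  (sum-cong-≋ λ k → *-congʳ (reflexive (d-rest k))) ⟩
      - sum (λ k → c′ k * a k) * A i₀ j + sum (λ k → c′ k * A (row k) j)
        ≈⟨ +-congʳ (trans (solve 2 (λ s x → :- s :* x := s :* :- x) refl (sum λ k → c′ k * a k) (A i₀ j)) (*-distribʳ-sum (- A i₀ j) (λ k → c′ k * a k))) ⟩
      sum (λ k → c′ k * a k * - A i₀ j) + sum (λ k → c′ k * A (row k) j)
        ≈⟨ sym (∑-distrib-+ (λ k → c′ k * a k * - A i₀ j) (λ k → c′ k * A (row k) j)) ⟩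
      sum (λ k → c′ k * a k * - A i₀ j + c′ k * A (row k) j)
        ≈⟨ sum-cong-≋ (λ k → solve 4 (λ d a x y → d :* a :* (:- x) :+ d :* y := d :* (y :+ :- (a :* x))) refl (c′ k) (a k) (A i₀ j) (A (row k) j)) ⟩
      sum (λ k → c′ k * reduced k j)
        ≈⟨ reduced-zero j ⟩
      0# ∎

  infixl 6 _⊕_
  infixr 7 _⊙_
  infix 8 _⟪_⟫

  -- Evaluation at a point of K⁴ unfolds to an explicit sum of four terms; sealing it keeps
  -- functionals and points inferable from their values.
  opaque

    _⟪_⟫ : AffineFunctional → Point → Carrier
    f ⟪ x ⟫ = f ⟨ x ⟩

    ⟪⟫≈⟨⟩ : ∀ f x → f ⟪ x ⟫ ≈ f ⟨ x ⟩
    ⟪⟫≈⟨⟩ f x = refl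

    _⊕_ : AffineFunctional → AffineFunctional → AffineFunctional
    affine a b ⊕ affine a′ b′ = affine (λ j → a j + a′ j) (b + b′)

    _⊙_ : Carrier → AffineFunctional → AffineFunctional
    s ⊙ affine a b = affine (λ j → s * a j) (s * b)

    constant : Carrier → AffineFunctional
    constant b = affine (λ _ → 0#) b

    coordinate : Fin 4 → AffineFunctional
    coordinate j = affine (unit j) 0#

    homogenised : Vector Carrier 5 → AffineFunctional
    homogenised w = affine (tail w) (w zero)

    ⊕-eval : ∀ f g x → (f ⊕ g) ⟪ x ⟫ ≈ f ⟪ x ⟫ + g ⟪ x ⟫
    ⊕-eval (affine a b) (affine a′ b′) x = begin
      dot (λ j → a j + a′ j) x + (b + b′)
        ≈⟨ +-congʳ (trans (sum-cong-≋ {x = λ j → (a j + a′ j) * x j} {y = λ j → a j * x j + a′ j * x j}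
             λ j → distribʳ (x j) (a j) (a′ j)) (∑-distrib-+ (λ j → a j * x j) (λ j → a′ j * x j))) ⟩
      (dot a x + dot a′ x) + (b + b′)
        ≈⟨ Solver.shuffle (dot a x) (dot a′ x) b b′ ⟩
      (dot a x + b) + (dot a′ x + b′) ∎

    ⊙-eval : ∀ s f x → (s ⊙ f) ⟪ x ⟫ ≈ s * f ⟪ x ⟫
    ⊙-eval s (affine a b) x = begin
      dot (λ j → s * a j) x + s * b
        ≈⟨ +-congʳ (trans (sum-cong-≋ {x = λ j → s * a j * x j} {y = λ j → s * (a j * x j)}
             λ j → *-assoc s (a j) (x j)) (sym (*-distribˡ-sum s (λ j → a j * x j)))) ⟩
      s * dot a x + s * b  ≈⟨ sym (distribˡ s (dot a x) b) ⟩
      s * (dot a x + b) ∎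

    constant-eval : ∀ b x → constant b ⟪ x ⟫ ≈ b
    constant-eval b x = trans (+-congʳ (sum-zero (λ j → 0# * x j) λ j → zeroˡ (x j))) (+-identityˡ b)

    coordinate-eval : ∀ j x → coordinate j ⟪ x ⟫ ≈ x j
    coordinate-eval j x = trans (+-identityʳ (dot (unit j) x)) (trans (dot-comm (unit j) x) (dot-unit x j))

    homogenised-eval : ∀ w x → homogenised w ⟪ x ⟫ ≈ dot w (1# ∷ᵛ x)
    homogenised-eval w x = trans (+-comm (dot (tail w) x) (w zero)) (+-congʳ (sym (*-identityʳ (w zero))))

    eval-cong : ∀ f {x y} → x ≋ y → f ⟪ x ⟫ ≈ f ⟪ y ⟫
    eval-cong (affine a b) {x} {y} e = +-congʳ (sum-cong-≋ {x = λ j → a j * x j} {y = λ j → a j * y j} λ j → *-congˡ (e j))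

    eval-coordinates : ∀ f x → f ⟪ x ⟫ ≈
      sum (λ j → AffineFunctional.normal f j * x j) + AffineFunctional.offset f
    eval-coordinates f x = refl

    eval-combination : ∀ {n} f (w : Vector Carrier n) p →
      sum (λ i → w i * f ⟪ p i ⟫) ≈
      dot (AffineFunctional.normal f) (combination w p) + sum w * AffineFunctional.offset f
    eval-combination (affine a b) w p = begin
      sum (λ i → w i * (dot a (p i) + b))
        ≈⟨ sum-cong-≋ (λ i → distribˡ (w i) (dot a (p i)) b) ⟩
      sum (λ i → w i * dot a (p i) + w i * b)
        ≈⟨ ∑-distrib-+ (λ i → w i * dot a (p i)) (λ i → w i * b) ⟩
      sum (λ i → w i * dot a (p i)) + sum (λ i → w i * b)
        ≈⟨ +-cong (sym (dot-sum a w p)) (sym (*-distribʳ-sum b w)) ⟩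
      dot a (combination w p) + sum w * b ∎

    eval-affine-combination : ∀ {n} f (w : Vector Carrier n) p {x} → sum w ≈ 1# → combination w p ≋ x →
      f ⟪ x ⟫ ≈ sum (λ i → w i * f ⟪ p i ⟫)
    eval-affine-combination f@(affine a b) w p {x} e₁ e = begin
      dot a x + b
        ≈⟨ +-cong (sum-cong-≋ {x = λ j → a j * x j} {y = λ j → a j * combination w p j} λ j → *-congˡ (sym (e j)))
                  (sym (trans (*-congʳ e₁) (*-identityˡ b))) ⟩
      dot a (combination w p) + sum w * b
        ≈⟨ sym (eval-combination f w p) ⟩
      sum (λ i → w i * f ⟪ p i ⟫) ∎

    eval-null-combination : ∀ {n} f (w : Vector Carrier n) p → sum w ≈ 0# → combination w p ≋ (λ _ → 0#) →
      sum (λ i → w i * f ⟪ p i ⟫) ≈ 0#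
    eval-null-combination f@(affine a b) w p e₀ e =
      trans (eval-combination f w p)
        (+-zero (sum-zero (λ j → a j * combination w p j) λ j → *-zeroʳ (a j) (e j)) (*-zeroˡ b e₀))

  ⊙⊕-eval : ∀ s f g x → (s ⊙ f ⊕ g) ⟪ x ⟫ ≈ s * f ⟪ x ⟫ + g ⟪ x ⟫
  ⊙⊕-eval s f g x = trans (⊕-eval (s ⊙ f) g x) (+-congʳ (⊙-eval s f x))

  linear-combination : ∀ {n} → Vector Carrier n → Vector AffineFunctional n → AffineFunctional
  linear-combination {zero}  s f = constant 0#
  linear-combination {suc n} s f = s zero ⊙ f zero ⊕ linear-combination (tail s) (tail f)

  linear-combination-eval : ∀ {n} s (f : Vector AffineFunctional n) x →
    linear-combination s f ⟪ x ⟫ ≈ sum (λ i → s i * f i ⟪ x ⟫)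
  linear-combination-eval {zero}  s f x = constant-eval 0# x
  linear-combination-eval {suc n} s f x =
    trans (⊙⊕-eval (s zero) (f zero) _ x) (+-congˡ (linear-combination-eval (tail s) (tail f) x))

  Range : ∀ {n} → Vector Point n → Pred Point ℓ₁
  Range p x = ∃[ i ] x ≋ p i

  ∈-Range : ∀ {n} (p : Vector Point n) i → p i ∈ Range p
  ∈-Range p i = i , ≋-refl

  vanish-aff : ∀ {a} {X : Pred Point a} f → (∀ x → x ∈ X → f ⟪ x ⟫ ≈ 0#) → ∀ x → x ∈ aff X → f ⟪ x ⟫ ≈ 0#
  vanish-aff f z x (n , w , p , p∈ , e₁ , e) =
    trans (eval-affine-combination f w p e₁ e) (sum-zero (λ i → w i * f ⟪ p i ⟫) λ i → *-zeroʳ (w i) (z (p i) (p∈ i)))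

  -- The affine hull described by the equations valid on it, which `flat⇒aff` and `aff⇒flat`
  -- identify with `aff`. In this form it fits arguments in which functionals are combined and
  -- weights of points never appear.
  Flat : ∀ {n} → Vector Point n → Pred Point (c Level.⊔ ℓ₁)
  Flat p x = ∀ f → (∀ i → f ⟪ p i ⟫ ≈ 0#) → f ⟪ x ⟫ ≈ 0#

  aff-or-separate : ∀ {n} (p : Vector Point n) x →
    (Σ (Vector Carrier n) λ w → sum w ≈ 1# × combination w p ≋ x) ⊎ (∃[ f ] (∀ i → f ⟪ p i ⟫ ≈ 0#) × f ⟪ x ⟫ ≉ 0#)
  aff-or-separate p x with span-or-separate (λ i → 1# ∷ᵛ p i) (1# ∷ᵛ x)
  ... | inj₁ (w , e) = inj₁ (w , trans (sum-cong-≋ λ i → sym (*-identityʳ (w i))) (e zero) , λ j → e (suc j))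
  ... | inj₂ (w , z , nz) = inj₂
    ( homogenised w
    , (λ i → trans (homogenised-eval w (p i)) (z i))
    , λ e → nz (trans (sym (homogenised-eval w x)) e) )

  flat-or-separate : ∀ {n} (p : Vector Point n) x →
    Flat p x ⊎ (∃[ f ] (∀ i → f ⟪ p i ⟫ ≈ 0#) × f ⟪ x ⟫ ≉ 0#)
  flat-or-separate p x with aff-or-separate p x
  ... | inj₂ s = inj₂ s
  ... | inj₁ (w , e₁ , e) = inj₁ λ f z → trans (eval-affine-combination f w p e₁ e) (sum-zero (λ i → w i * f ⟪ p i ⟫) λ i → *-zeroʳ (w i) (z i))

  flat⇒aff : ∀ {n} (p : Vector Point n) {x} → Flat p x → x ∈ aff (Range p)
  flat⇒aff p {x} fl with aff-or-separate p x
  ... | inj₁ (w , e₁ , e) = _ , w , p , ∈-Range p , e₁ , e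
  ... | inj₂ (f , z , nz) = ⊥-elim (nz (fl f z))

  vanish-Range : ∀ {n} {p : Vector Point n} f → (∀ i → f ⟪ p i ⟫ ≈ 0#) → ∀ x → x ∈ Range p → f ⟪ x ⟫ ≈ 0#
  vanish-Range f z x (i , e) = trans (eval-cong f e) (z i)

  aff⇒flat : ∀ {n} (p : Vector Point n) {x} → x ∈ aff (Range p) → Flat p x
  aff⇒flat p x∈ f z = vanish-aff f (vanish-Range f z) _ x∈

  -- Affine independence in dual form: a family of functionals biorthogonal to the points.
  Independent : ∀ {n} → Vector Point n → Set (c Level.⊔ ℓ₁)
  Independent p = ∀ i → ∃[ φ ] φ ⟪ p i ⟫ ≈ 1# × (∀ j → j ≢ i → φ ⟪ p j ⟫ ≈ 0#)

  normalise : ∀ f x → f ⟪ x ⟫ ≉ 0# → ∃[ s ] (s ⊙ f) ⟪ x ⟫ ≈ 1#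
  normalise f x nz with inverse _ nz
  ... | r , e = r , trans (⊙-eval r f x) (trans (*-comm _ _) e)

  independent⇒affinelyIndependent : ∀ {n} {p : Vector Point n} → Independent p → AffinelyIndependent p
  independent⇒affinelyIndependent {p = p} ind w e₀ e i with ind i
  ... | φ , one , rest = begin
    w i                          ≈⟨ sym (trans (*-congˡ one) (*-identityʳ _)) ⟩
    w i * φ ⟪ p i ⟫              ≈⟨ sym (sum-single (λ j → w j * φ ⟪ p j ⟫) i λ j ne → *-zeroʳ (w j) (rest j ne)) ⟩
    sum (λ j → w j * φ ⟪ p j ⟫)  ≈⟨ eval-null-combination φ w p e₀ e ⟩
    0#                           ∎

  -- A functional that separates `p i` from the other points is the dual one, up to scale. If there
  -- is none, `p i` is an affine combination of the others, and giving it the weight -1 produces a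
  -- forbidden dependence.
  affinelyIndependent⇒independent : ∀ {n} {p : Vector Point n} → AffinelyIndependent p → Independent p
  affinelyIndependent⇒independent {suc n} {p} ind i with aff-or-separate (removeAt p i) (p i)
  ... | inj₂ (f , z , nz) with normalise f (p i) nz
  ...   | s , one = s ⊙ f , one , λ j ne → trans (⊙-eval s f (p j))
            (*-zeroʳ s (trans (reflexive (≡.cong (λ k → f ⟪ p k ⟫) (≡.sym (Fin.punchIn-punchOut (ne ∘ ≡.sym))))) (z _)))
  affinelyIndependent⇒independent {suc n} {p} ind i | inj₁ (w , e₁ , e) =
    ⊥-elim (0#≉1# (sym (begin
      1#         ≈⟨ sym (-‿involutive 1#) ⟩
      - - 1#     ≈⟨ -‿cong (trans (reflexive (≡.sym at-i)) (ind w⁺ total (λ j → combined j) i)) ⟩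
      - 0#       ≈⟨ -0#≈0# ⟩
      0#         ∎)))
    where
    w⁺ = insertAt w i (- 1#)
    at-i = Vector.insertAt-lookup w i (- 1#)
    elsewhere = Vector.insertAt-punchIn w i (- 1#)
    total : sum w⁺ ≈ 0#
    total = begin
      sum w⁺                         ≈⟨ sum-remove {i = i} w⁺ ⟩
      w⁺ i + sum (removeAt w⁺ i)     ≈⟨ +-cong (reflexive at-i) (trans (sum-cong-≋ λ k → reflexive (elsewhere k)) e₁) ⟩
      - 1# + 1#                      ≈⟨ -‿inverseˡ 1# ⟩
      0#                             ∎
    combined : ∀ j → combination w⁺ p j ≈ 0#
    combined j = begin
      sum (λ k → w⁺ k * p k j)
        ≈⟨ sum-remove {i = i} (λ k → w⁺ k * p k j) ⟩
      w⁺ i * p i j + sum (λ k → w⁺ (punchIn i k) * p (punchIn i k) j)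
        ≈⟨ +-cong (*-congʳ (reflexive at-i)) (trans (sum-cong-≋ λ k → *-congʳ (reflexive (elsewhere k))) (e j)) ⟩
      - 1# * p i j + p i j
        ≈⟨ +-congʳ (trans (sym (-‿distribˡ-* 1# _)) (-‿cong (*-identityˡ _))) ⟩
      - p i j + p i j
        ≈⟨ -‿inverseˡ _ ⟩
      0# ∎

  -- A Gram-Schmidt correction: `f`, scaled to be 1 at `x`, is dual to `x`, and subtracting φ(x)
  -- times it from each old dual functional φ makes that one vanish at `x` without changing it on
  -- `p`.
  independent-∷ : ∀ {n} {p : Vector Point n} {x} f → Independent p → (∀ i → f ⟪ p i ⟫ ≈ 0#) → f ⟪ x ⟫ ≉ 0# →
    Independent (x ∷ᵛ p)
  independent-∷ {p = p} {x} f ind z nz with normalise f x nz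
  ... | s , one = λ
    { zero → s ⊙ f , one , λ { zero ne → ⊥-elim (ne ≡.refl) ; (suc j) _ → vanish j }
    ; (suc i) → let φ , oneᵢ , rest = ind i in
        (- (φ ⟪ x ⟫)) ⊙ s ⊙ f ⊕ φ
      , trans (at φ (p i)) (trans (+-cong (*-zeroʳ _ (vanish i)) oneᵢ) (+-identityˡ 1#))
      , λ { zero _ → trans (at φ x) (trans (+-congʳ (trans (*-congˡ one) (*-identityʳ _))) (-‿inverseˡ _))
          ; (suc j) ne → trans (at φ (p j)) (+-zero (*-zeroʳ _ (vanish j)) (rest j (ne ∘ ≡.cong suc))) } }
    where
    vanish : ∀ j → (s ⊙ f) ⟪ p j ⟫ ≈ 0#
    vanish j = trans (⊙-eval s f (p j)) (*-zeroʳ s (z j))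
    at : ∀ φ y → ((- (φ ⟪ x ⟫)) ⊙ s ⊙ f ⊕ φ) ⟪ y ⟫ ≈ - (φ ⟪ x ⟫) * (s ⊙ f) ⟪ y ⟫ + φ ⟪ y ⟫
    at φ y = ⊙⊕-eval (- (φ ⟪ x ⟫)) (s ⊙ f) φ y

  independent-∘ : ∀ {m n} {p : Vector Point n} (ι : Fin m → Fin n) → (∀ {i j} → ι i ≡ ι j → i ≡ j) →
    Independent p → Independent (p ∘ ι)
  independent-∘ ι inj ind i with ind (ι i)
  ... | φ , one , rest = φ , one , λ j ne → rest (ι j) (ne ∘ inj)

  independent-resp : ∀ {n} {p q : Vector Point n} → (∀ i → p i ≡ q i) → Independent p → Independent q
  independent-resp e ind i = let φ , one , rest = ind i in
      φ , trans (reflexive (≡.cong (φ ⟪_⟫) (≡.sym (e i)))) one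
    , λ j ne → trans (reflexive (≡.cong (φ ⟪_⟫) (≡.sym (e j)))) (rest j ne)

  -- The Steinitz bound. If n > m, a nontrivial combination of the n dual functionals vanishes on
  -- all of `q`, hence at every `p i` by flatness; but its value at `p i` is its coefficient `s i`.
  independent-≤ : ∀ {m n} {p : Vector Point n} {q : Vector Point m} → Independent p → (∀ i → Flat q (p i)) → n ℕ.≤ m
  independent-≤ {m} {n} {p} {q} ind fl with n ℕ.≤? m
  ... | yes n≤m = n≤m
  ... | no n≰m with left-kernel m (ℕ.≰⇒> n≰m) (λ i j → proj₁ (ind i) ⟪ q j ⟫)
  ...   | s , (i , nz) , e = ⊥-elim (nz (begin
    s i                                         ≈⟨ sym (trans (*-congˡ (proj₁ (proj₂ (ind i)))) (*-identityʳ _)) ⟩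
    s i * φ i ⟪ p i ⟫                           ≈⟨ sym (sum-single (λ k → s k * φ k ⟪ p i ⟫) i λ j ne → *-zeroʳ (s j) (proj₂ (proj₂ (ind j)) i (ne ∘ ≡.sym))) ⟩
    sum (λ k → s k * φ k ⟪ p i ⟫)               ≈⟨ sym (linear-combination-eval s φ (p i)) ⟩
    linear-combination s φ ⟪ p i ⟫
      ≈⟨ fl i _ (λ j → trans (linear-combination-eval s φ (q j)) (e j)) ⟩
    0#                                          ∎))
    where φ = λ i → proj₁ (ind i)

  standard : Vector Point 5
  standard = (λ _ → 0#) ∷ᵛ unit

  standard-flat : ∀ x → Flat standard x
  standard-flat x f z = trans (eval-coordinates f x) (+-zero (sum-zero (λ j → a j * x j) λ j → *-zeroˡ (x j) (a≈0 j)) b≈0)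
    where
    open AffineFunctional f renaming (normal to a; offset to b)
    b≈0 : b ≈ 0#
    b≈0 = trans (sym (trans (+-congʳ (sum-zero (λ j → a j * 0#) λ j → zeroʳ (a j))) (+-identityˡ b)))
      (trans (sym (eval-coordinates f (standard zero))) (z zero))
    a≈0 : ∀ j → a j ≈ 0#
    a≈0 j = trans (sym (trans (+-cong (dot-unit a j) b≈0) (+-identityʳ (a j))))
      (trans (sym (eval-coordinates f (unit j))) (z (suc j)))

  -- A point outside the flat would be a sixth independent point, while the five points of
  -- `standard` already span everything.
  independent₅-flat : ∀ {p : Vector Point 5} → Independent p → ∀ x → Flat p x
  independent₅-flat {p} ind x with flat-or-separate p x
  ... | inj₁ fl = fl
  ... | inj₂ (f , z , nz) = ⊥-elim (ℕ.<⇒≱ ℕ.≤-refl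
    (independent-≤ {q = standard} (independent-∷ f ind z nz) λ i → standard-flat _))

  independent₅-ext : ∀ {p : Vector Point 5} → Independent p → ∀ {f g} → (∀ i → f ⟪ p i ⟫ ≈ g ⟪ p i ⟫) →
    ∀ x → f ⟪ x ⟫ ≈ g ⟪ x ⟫
  independent₅-ext {p} ind {f} {g} agree x = begin
    f ⟪ x ⟫                              ≈⟨ sym (+-identityʳ _) ⟩
    f ⟪ x ⟫ + 0#                         ≈⟨ +-congˡ (sym (-‿inverseˡ _)) ⟩
    f ⟪ x ⟫ + (- (g ⟪ x ⟫) + g ⟪ x ⟫)    ≈⟨ sym (+-assoc _ _ _) ⟩
    (f ⟪ x ⟫ + - (g ⟪ x ⟫)) + g ⟪ x ⟫    ≈⟨ +-congʳ (trans (sym (difference x)) vanishing) ⟩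
    0# + g ⟪ x ⟫                         ≈⟨ +-identityˡ _ ⟩
    g ⟪ x ⟫                              ∎
    where
    difference : ∀ y → ((- 1#) ⊙ g ⊕ f) ⟪ y ⟫ ≈ f ⟪ y ⟫ + - (g ⟪ y ⟫)
    difference y = trans (⊙⊕-eval (- 1#) g f y) (trans (+-comm _ _)
      (+-congˡ (trans (sym (-‿distribˡ-* 1# _)) (-‿cong (*-identityˡ _)))))
    vanishing : ((- 1#) ⊙ g ⊕ f) ⟪ x ⟫ ≈ 0#
    vanishing = independent₅-flat ind x _ λ i →
      trans (difference (p i)) (trans (+-congʳ (agree i)) (-‿inverseʳ _))

-- Convex hulls over finite weight vectors.

module ConvexHulls {c ℓ₁ ℓ₂} (K : OrderedField c ℓ₁ ℓ₂) where

  open OrderedFieldProperties K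
  open AffineFunctionals K
  open import Relation.Binary.Reasoning.Setoid setoid

  sum-++ : ∀ {m n} (s : Vector Carrier m) (t : Vector Carrier n) → sum (s ++ᵛ t) ≈ sum s + sum t
  sum-++ {zero}  s t = sym (+-identityˡ (sum t))
  sum-++ {suc m} {n} s t = begin
    s zero + sum (tail (s ++ᵛ t))        ≈⟨ +-congˡ (sum-cong-≋ shift) ⟩
    s zero + sum (tail s ++ᵛ t)          ≈⟨ +-congˡ (sum-++ (tail s) t) ⟩
    s zero + (sum (tail s) + sum t)     ≈⟨ sym (+-assoc _ _ _) ⟩
    (s zero + sum (tail s)) + sum t     ∎
    where
    shift : ∀ i → (s ++ᵛ t) (suc i) ≈ (tail s ++ᵛ t) i
    shift i with Fin.splitAt m i
    ... | inj₁ _ = refl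
    ... | inj₂ _ = refl

  blend : Carrier → Point → Carrier → Point → Point
  blend a x b y j = a * x j + b * y j

  blend-combination : ∀ a x b y → combination (a ∷ᵛ b ∷ᵛ []ᵛ) (x ∷ᵛ y ∷ᵛ []ᵛ) ≋ blend a x b y
  blend-combination a x b y j = +-congˡ (+-identityʳ _)

  blend-eval : ∀ f {a b} x y → a + b ≈ 1# → f ⟪ blend a x b y ⟫ ≈ a * f ⟪ x ⟫ + b * f ⟪ y ⟫
  blend-eval f {a} {b} x y e = begin
    f ⟪ blend a x b y ⟫
      ≈⟨ eval-affine-combination f (a ∷ᵛ b ∷ᵛ []ᵛ) (x ∷ᵛ y ∷ᵛ []ᵛ) (trans (+-congˡ (+-identityʳ b)) e) (blend-combination a x b y) ⟩
    a * f ⟪ x ⟫ + (b * f ⟪ y ⟫ + 0#)  ≈⟨ +-congˡ (+-identityʳ _) ⟩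
    a * f ⟪ x ⟫ + b * f ⟪ y ⟫         ∎

  module _ {a} (X : Pred Point a) where

    conv-mono : ∀ {b} {Y : Pred Point b} → (∀ x → x ∈ X → x ∈ Y) → ∀ x → x ∈ conv X → x ∈ conv Y
    conv-mono i x (n , w , p , p∈ , rest) = n , w , p , (λ k → i _ (p∈ k)) , rest

    ∈-conv : ∀ x → x ∈ X → x ∈ conv X
    ∈-conv x x∈ = 1 , (λ _ → 1#) , (λ _ → x) , (λ _ → x∈) , (λ _ → inj₁ 0<1) , +-identityʳ 1#
      , λ j → trans (+-identityʳ _) (*-identityˡ _)

    conv-resp : ∀ {x y} → x ≋ y → x ∈ conv X → y ∈ conv X
    conv-resp e (n , w , p , p∈ , w≥0 , s , e′) = n , w , p , p∈ , w≥0 , s , λ j → trans (e′ j) (e j)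

    nonneg-conv : ∀ f → (∀ x → x ∈ X → 0# ≤ f ⟪ x ⟫) → ∀ x → x ∈ conv X → 0# ≤ f ⟪ x ⟫
    nonneg-conv f h x (n , w , p , p∈ , w≥0 , s , e) = nonneg-resp (sym (eval-affine-combination f w p s e))
      (sum-nonneg (λ i → w i * f ⟪ p i ⟫) λ i → nonneg*nonneg (w≥0 i) (h _ (p∈ i)))

    vanish-conv : ∀ f → (∀ x → x ∈ X → f ⟪ x ⟫ ≈ 0#) → ∀ x → x ∈ conv X → f ⟪ x ⟫ ≈ 0#
    vanish-conv f h x (n , w , p , p∈ , w≥0 , s , e) = trans (eval-affine-combination f w p s e)
      (sum-zero (λ i → w i * f ⟪ p i ⟫) λ i → *-zeroʳ (w i) (h _ (p∈ i)))

    conv-blend : ∀ {x y s t} → x ∈ conv X → y ∈ conv X → 0# < s → 0# < t → s + t ≈ 1# → blend s x t y ∈ conv X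
    conv-blend {x} {y} {s} {t} (m , w , p , p∈ , w≥0 , Σw , ew) (n , u , q , q∈ , u≥0 , Σu , eu) s>0 t>0 s+t =
      m ℕ.+ n , weights , p ++ᵛ q , point∈ , weight≥0 , total , combined
      where
      weights = (λ i → s * w i) ++ᵛ (λ i → t * u i)
      point∈ : ∀ i → (p ++ᵛ q) i ∈ X
      point∈ i with Fin.splitAt m i
      ... | inj₁ k = p∈ k
      ... | inj₂ k = q∈ k
      weight≥0 : ∀ i → 0# ≤ weights i
      weight≥0 i with Fin.splitAt m i
      ... | inj₁ k = nonneg*nonneg (inj₁ s>0) (w≥0 k)
      ... | inj₂ k = nonneg*nonneg (inj₁ t>0) (u≥0 k)
      total : sum weights ≈ 1#
      total = begin
        sum weights                                 ≈⟨ sum-++ (λ i → s * w i) (λ i → t * u i) ⟩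
        sum (λ i → s * w i) + sum (λ i → t * u i)   ≈⟨ +-cong (sym (*-distribˡ-sum s w)) (sym (*-distribˡ-sum t u)) ⟩
        s * sum w + t * sum u                       ≈⟨ +-cong (trans (*-congˡ Σw) (*-identityʳ s)) (trans (*-congˡ Σu) (*-identityʳ t)) ⟩
        s + t                                       ≈⟨ s+t ⟩
        1#                                          ∎
      combined : combination weights (p ++ᵛ q) ≋ blend s x t y
      combined j = begin
        sum (λ i → weights i * (p ++ᵛ q) i j)
          ≈⟨ sum-cong-≋ termwise ⟩
        sum ((λ i → s * (w i * p i j)) ++ᵛ (λ i → t * (u i * q i j)))
          ≈⟨ sum-++ (λ i → s * (w i * p i j)) (λ i → t * (u i * q i j)) ⟩
        sum (λ i → s * (w i * p i j)) + sum (λ i → t * (u i * q i j))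
          ≈⟨ +-cong (sym (*-distribˡ-sum s (λ i → w i * p i j))) (sym (*-distribˡ-sum t (λ i → u i * q i j))) ⟩
        s * combination w p j + t * combination u q j
          ≈⟨ +-cong (*-congˡ (ew j)) (*-congˡ (eu j)) ⟩
        s * x j + t * y j ∎
        where
        termwise : ∀ i → weights i * (p ++ᵛ q) i j ≈ ((λ i → s * (w i * p i j)) ++ᵛ (λ i → t * (u i * q i j))) i
        termwise i with Fin.splitAt m i
        ... | inj₁ k = *-assoc s (w k) (p k j)
        ... | inj₂ k = *-assoc t (u k) (q k j)

    module _ {d} (D : Pred Point d)
      (resp : ∀ {x y} → x ≋ y → x ∈ D → y ∈ D)
      (closed : ∀ {x y s t} → x ∈ D → y ∈ D → 0# < s → 0# < t → s + t ≈ 1# → blend s x t y ∈ D)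
      (base : ∀ x → x ∈ X → x ∈ D)
      where

      private
        -- The weights of a tail need not sum to 1. They can be normalised to give a point of `D`
        -- unless they all vanish, which is the first alternative.
        Partial : ∀ {n} → Vector Carrier n → Vector Point n → Set _
        Partial w p = (∀ i → w i ≈ 0#) ⊎
          (0# < sum w × ∃[ y ] y ∈ D × (∀ j → combination w p j ≈ sum w * y j))

        partial : ∀ {n} (w : Vector Carrier n) p → (∀ i → p i ∈ X) → (∀ i → 0# ≤ w i) → Partial w p
        partial {zero} w p _ _ = inj₁ λ ()
        partial {suc n} w p p∈ w≥0
          with nonneg-split (w≥0 zero) | partial (tail w) (tail p) (p∈ ∘ suc) (w≥0 ∘ suc)
        ... | inj₁ z | inj₁ zs = inj₁ λ { zero → z ; (suc i) → zs i }
        ... | inj₁ z | inj₂ (S>0 , y , y∈ , e) = inj₂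
          ( pos-resp (sym drop) S>0 , y , y∈
          , λ j → trans (+-cong (*-zeroˡ _ z) (e j)) (trans (+-identityˡ _) (*-congʳ (sym drop))) )
          where
          drop : sum w ≈ sum (tail w)
          drop = trans (+-congʳ z) (+-identityˡ _)
        ... | inj₂ w₀>0 | inj₁ zs = inj₂
          ( pos-resp (sym drop) w₀>0 , p zero , base _ (p∈ zero)
          , λ j → trans (+-congˡ (sum-zero (λ i → w (suc i) * p (suc i) j) λ i → *-zeroˡ (p (suc i) j) (zs i)))
                    (trans (+-identityʳ _) (*-congʳ (sym drop))) )
          where
          drop : sum w ≈ w zero
          drop = trans (+-congˡ (sum-zero (tail w) zs)) (+-identityʳ _)
        ... | inj₂ w₀>0 | inj₂ (S>0 , y , y∈ , e) with inverse-pos (pos+nonneg w₀>0 (inj₁ S>0))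
        ...   | r , r>0 , er = inj₂
          ( pos+nonneg w₀>0 (inj₁ S>0)
          , blend (w zero * r) (p zero) (sum (tail w) * r) y
          , closed (base _ (p∈ zero)) y∈ (*-pos w₀>0 r>0) (*-pos S>0 r>0) (trans (sym (distribʳ _ _ _)) er)
          , λ j → begin
              w zero * p zero j + combination (tail w) (tail p) j
                ≈⟨ +-congˡ (e j) ⟩
              w zero * p zero j + sum (tail w) * y j
                ≈⟨ sym (*-identityˡ _) ⟩
              1# * (w zero * p zero j + sum (tail w) * y j)
                ≈⟨ *-congʳ (sym er) ⟩
              sum w * r * (w zero * p zero j + sum (tail w) * y j)
                ≈⟨ solve 6 (λ S r a x b y → S :* r :* (a :* x :+ b :* y) := S :* (a :* r :* x :+ b :* r :* y)) refl
                     (sum w) r (w zero) (p zero j) (sum (tail w)) (y j) ⟩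
              sum w * blend (w zero * r) (p zero) (sum (tail w) * r) y j ∎ )

      -- The induction principle for `conv`: a property that respects equality of points and passes
      -- to blends of two points with positive weights has to be checked on `X` only. Both
      -- `conv-bind` and `conv-zeros` rest on it.
      conv-least : ∀ x → x ∈ conv X → x ∈ D
      conv-least x (n , w , p , p∈ , w≥0 , s , e) with partial w p p∈ w≥0
      ... | inj₁ zs = ⊥-elim (0#≉1# (trans (sym (sum-zero w zs)) s))
      ... | inj₂ (_ , y , y∈ , e′) = resp (λ j → begin
        y j              ≈⟨ sym (trans (*-congʳ s) (*-identityˡ _)) ⟩
        sum w * y j      ≈⟨ sym (e′ j) ⟩
        combination w p j ≈⟨ e j ⟩
        x j              ∎) y∈

  conv-bind : ∀ {a b} (X : Pred Point a) (Y : Pred Point b) → (∀ x → x ∈ X → x ∈ conv Y) → ∀ x → x ∈ conv X → x ∈ conv Y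
  conv-bind X Y i = conv-least X (conv Y) (conv-resp Y) (conv-blend Y) i

  private
    blend-zeros : ∀ {s t x y} → 0# < s → 0# < t → 0# ≤ x → 0# ≤ y → s * x + t * y ≈ 0# → x ≈ 0# × y ≈ 0#
    blend-zeros s>0 t>0 x≥0 y≥0 e
      with nonneg+nonneg≈0 (nonneg*nonneg (inj₁ s>0) x≥0) (nonneg*nonneg (inj₁ t>0) y≥0) e
    ... | sx , ty = ≉0∧*≈0⇒≈0 (pos⇒≉0 s>0) sx , ≉0∧*≈0⇒≈0 (pos⇒≉0 t>0) ty

  -- A blend with positive weights of two nonnegative values is zero only if both are. Nonnegativity
  -- is built into the inductive predicate `D`, because the implication alone would not pass to
  -- blends.
  conv-zeros : ∀ {a} (X : Pred Point a) f → (∀ x → x ∈ X → 0# ≤ f ⟪ x ⟫) →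
    ∀ x → x ∈ conv X → f ⟪ x ⟫ ≈ 0# → x ∈ conv (λ y → y ∈ X × f ⟪ y ⟫ ≈ 0#)
  conv-zeros X f f≥0 x x∈ = proj₂ (conv-least X D resp closed base x x∈)
    where
    Z : Pred Point _
    Z y = y ∈ X × f ⟪ y ⟫ ≈ 0#
    D : Pred Point _
    D y = 0# ≤ f ⟪ y ⟫ × (f ⟪ y ⟫ ≈ 0# → y ∈ conv Z)
    resp : ∀ {x y} → x ≋ y → x ∈ D → y ∈ D
    resp e (h , k) = nonneg-resp (eval-cong f e) h , λ z → conv-resp Z e (k (trans (eval-cong f e) z))
    closed : ∀ {x y s t} → x ∈ D → y ∈ D → 0# < s → 0# < t → s + t ≈ 1# → blend s x t y ∈ D
    closed {x} {y} (h , k) (h′ , k′) s>0 t>0 e =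
        nonneg-resp (sym (blend-eval f x y e))
          (nonneg+nonneg (nonneg*nonneg (inj₁ s>0) h) (nonneg*nonneg (inj₁ t>0) h′))
      , λ z → let zx , zy = blend-zeros s>0 t>0 h h′ (trans (sym (blend-eval f x y e)) z)
              in conv-blend Z (k zx) (k′ zy) s>0 t>0 e
    base : ∀ x → x ∈ X → x ∈ D
    base x x∈ = f≥0 x x∈ , λ z → ∈-conv Z x (x∈ , z)

-- Finitely generated cones of functionals and the double description method.

module DualCones {c ℓ₁ ℓ₂} (K : OrderedField c ℓ₁ ℓ₂) where

  open OrderedFieldProperties K
  open AffineFunctionals K
  open ConvexHulls K
  open import Relation.Binary.Reasoning.Setoid setoid

  infix 4 _≗_
  _≗_ : AffineFunctional → AffineFunctional → Set (c ⊔ ℓ₁)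
  f ≗ g = ∀ x → f ⟪ x ⟫ ≈ g ⟪ x ⟫

  Zero : AffineFunctional → Set (c ⊔ ℓ₁)
  Zero f = ∀ x → f ⟪ x ⟫ ≈ 0#

  -- Coefficients are strictly positive, so every generator in a derivation really contributes;
  -- `cone-vanish` depends on this. Equations are between values, since functionals with the same
  -- values need not be propositionally equal.
  data Cone {a} (H : Pred AffineFunctional a) (g : AffineFunctional) : Set (a ⊔ ℓ) where
    vertex : Zero g → Cone H g
    add    : ∀ {s h g′} → 0# < s → H h → Cone H g′ → (∀ x → g ⟪ x ⟫ ≈ s * h ⟪ x ⟫ + g′ ⟪ x ⟫) → Cone H g

  module _ {a} {H : Pred AffineFunctional a} where

    cone-resp : ∀ {f g} → f ≗ g → Cone H f → Cone H g
    cone-resp e (vertex z)      = vertex λ x → trans (sym (e x)) (z x)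
    cone-resp e (add s>0 h k e′) = add s>0 h k λ x → trans (sym (e x)) (e′ x)

    cone-+ : ∀ {f g h} → Cone H f → Cone H g → (∀ x → h ⟪ x ⟫ ≈ f ⟪ x ⟫ + g ⟪ x ⟫) → Cone H h
    cone-+ (vertex z) k e = cone-resp (λ x → sym (trans (e x) (trans (+-congʳ (z x)) (+-identityˡ _)))) k
    cone-+ {f} {g} (add {g′ = f′} s>0 h∈ k e′) k′ e =
      add s>0 h∈ (cone-+ k k′ (⊕-eval f′ g)) λ x → begin
        _                        ≈⟨ trans (e x) (+-congʳ (e′ x)) ⟩
        _                        ≈⟨ +-assoc _ _ _ ⟩
        _                        ≈⟨ +-congˡ (sym (⊕-eval f′ g x)) ⟩
        _                        ∎

    cone-scale : ∀ {f g} s → 0# < s → Cone H f → (∀ x → g ⟪ x ⟫ ≈ s * f ⟪ x ⟫) → Cone H g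
    cone-scale s s>0 (vertex z) e = vertex λ x → trans (e x) (*-zeroʳ s (z x))
    cone-scale s s>0 (add {t} {h} {f′} t>0 h∈ k e′) e =
      add (*-pos s>0 t>0) h∈ (cone-scale s s>0 k (⊙-eval s f′)) λ x →
        trans (e x) (trans (*-congˡ (e′ x)) (trans (distribˡ _ _ _)
          (+-cong (sym (*-assoc _ _ _)) (sym (⊙-eval s f′ x)))))

    cone-∈ : ∀ {f g} s → 0# < s → H f → (∀ x → g ⟪ x ⟫ ≈ s * f ⟪ x ⟫) → Cone H g
    cone-∈ s s>0 f∈ e = add {g′ = constant 0#} s>0 f∈ (vertex (constant-eval 0#))
      λ x → trans (e x) (sym (trans (+-congˡ (constant-eval 0# x)) (+-identityʳ _)))

    cone-nonneg : ∀ {f x} → (∀ {h} → H h → 0# ≤ h ⟪ x ⟫) → Cone H f → 0# ≤ f ⟪ x ⟫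
    cone-nonneg n (vertex z)       = inj₂ (sym (z _))
    cone-nonneg n (add s>0 h∈ k e) =
      nonneg-resp (sym (e _)) (nonneg+nonneg (nonneg*nonneg (inj₁ s>0) (n h∈)) (cone-nonneg n k))

  cone-bind : ∀ {a b} {H : Pred AffineFunctional a} {H′ : Pred AffineFunctional b} →
    (∀ {h} → H h → Cone H′ h) → ∀ {f} → Cone H f → Cone H′ f
  cone-bind i (vertex z) = vertex z
  cone-bind i (add {s} {h} {g′} s>0 h∈ k e) =
    cone-+ (cone-scale s s>0 (i h∈) (⊙-eval s h)) (cone-bind i k) λ x → trans (e x) (+-congʳ (sym (⊙-eval s h x)))

  cone-mono : ∀ {a b} {H : Pred AffineFunctional a} {H′ : Pred AffineFunctional b} →
    (∀ {h} → H h → H′ h) → ∀ {f} → Cone H f → Cone H′ f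
  cone-mono i (vertex z)       = vertex z
  cone-mono i (add s>0 h∈ k e) = add s>0 (i h∈) (cone-mono i k) e

  -- The Fourier-Motzkin combination. If `t` is negative and `g` positive at `v`, both coefficients
  -- are positive, so the result is nonnegative wherever `t` and `g` are, and its hyperplane passes
  -- through `v` and the intersection of theirs.
  pivot : AffineFunctional → AffineFunctional → Point → AffineFunctional
  pivot t g v = (- (t ⟪ v ⟫)) ⊙ g ⊕ g ⟪ v ⟫ ⊙ t

  pivot-eval : ∀ t g v x → pivot t g v ⟪ x ⟫ ≈ - (t ⟪ v ⟫) * g ⟪ x ⟫ + g ⟪ v ⟫ * t ⟪ x ⟫
  pivot-eval t g v x = trans (⊙⊕-eval _ g _ x) (+-congˡ (⊙-eval _ t x))

  pivot-at : ∀ t g v → pivot t g v ⟪ v ⟫ ≈ 0#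
  pivot-at t g v = trans (pivot-eval t g v v)
    (trans (+-congʳ (trans (sym (-‿distribˡ-* _ _)) (-‿cong (*-comm _ _)))) (-‿inverseˡ _))

  -- One step of the double description method: the part of a finitely generated cone on
  -- which evaluation at v is nonnegative.
  module _ {a} {H H′ : Pred AffineFunctional a} (v : Point)
    (keep : ∀ {h} → H h → 0# ≤ h ⟪ v ⟫ → H′ h)
    (join : ∀ {k h} → H k → H h → k ⟪ v ⟫ < 0# → 0# < h ⟪ v ⟫ → H′ (pivot k h v))
    where

    private

      -- A normal form: a part in the new cone that is zero at `v`, and a remainder whose generators
      -- all have one strict sign at `v`, so that no cancellation at `v` is left.
      Split : (P N : Pred AffineFunctional (a ⊔ ℓ₂)) → AffineFunctional → Set _
      Split P N g = ∃[ z ] ∃[ r ] Cone H′ z × z ⟪ v ⟫ ≈ 0# × (Cone P r ⊎ Cone N r) × (∀ x → g ⟪ x ⟫ ≈ z ⟪ x ⟫ + r ⟪ x ⟫)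

      module _ (e : AffineFunctional → Carrier)
        (joined : ∀ {h k} → H h → H k → 0# < e h → e k < 0# →
          ∃[ p ] H′ p × p ⟪ v ⟫ ≈ 0# × (∀ x → p ⟪ x ⟫ ≈ - (e k) * h ⟪ x ⟫ + e h * k ⟪ x ⟫))
        where

        P N : Pred AffineFunctional (a ⊔ ℓ₂)
        P h = H h × 0# < e h
        N h = H h × e h < 0#

        -- The generator `h` is cancelled against the generators of `n` one by one. Each exchange
        -- moves a multiple of the joined functional into the first part and uses up either `h` or
        -- the current generator `k`. Here `e` is evaluation at `v` or its negative, so that one
        -- argument serves both directions.
        absorb : ∀ {s h n g} → 0# < s → P h → Cone N n → (∀ x → g ⟪ x ⟫ ≈ s * h ⟪ x ⟫ + n ⟪ x ⟫) → Split P N g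
        absorb {s} {h} {n} {g} s>0 h∈ (vertex z) eq =
          constant 0# , s ⊙ h , vertex (constant-eval 0#) , constant-eval 0# v , inj₁ (cone-∈ s s>0 h∈ (⊙-eval s h))
          , λ x → trans (eq x) (trans (+-cong (sym (⊙-eval s h x)) (trans (z x) (sym (constant-eval 0# x)))) (+-comm _ _))
        absorb {s} {h} {n} {g} s>0 h∈@(Hh , eh>0) (add {u} {k} {n′} u>0 k∈@(Hk , ek<0) rest eq′) eq
          with joined Hh Hk eh>0 ek<0
        ... | p , p∈ , pv , ep with inverse-pos eh>0
        -- This number is what remains of the coefficient of `h` when all of u k has been put into
        -- `joint`; its sign tells which of the two is exhausted first.
        ...   | i , i>0 , ei = by-sign (sign (s + u * e k * i))
          where
          joint : AffineFunctional
          joint = (u * i) ⊙ p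
          joint-cone : Cone H′ joint
          joint-cone = cone-∈ (u * i) (*-pos u>0 i>0) p∈ (⊙-eval (u * i) p)
          joint-v : joint ⟪ v ⟫ ≈ 0#
          joint-v = trans (⊙-eval (u * i) p v) (*-zeroʳ (u * i) pv)
          exchange : ∀ x → g ⟪ x ⟫ ≈ joint ⟪ x ⟫ + ((s + u * e k * i) * h ⟪ x ⟫ + n′ ⟪ x ⟫)
          exchange x = begin
            g ⟪ x ⟫
              ≈⟨ trans (eq x) (+-congˡ (eq′ x)) ⟩
            s * h ⟪ x ⟫ + (u * k ⟪ x ⟫ + n′ ⟪ x ⟫)
              ≈⟨ +-congˡ (+-congʳ (*-congˡ (trans (sym (*-identityˡ _)) (*-congʳ (sym ei))))) ⟩
            s * h ⟪ x ⟫ + (u * (e h * i * k ⟪ x ⟫) + n′ ⟪ x ⟫)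
              ≈⟨ solve 8 (λ s h u eh i k n ek → s :* h :+ (u :* (eh :* i :* k) :+ n)
                    := u :* i :* (:- ek :* h :+ eh :* k) :+ ((s :+ u :* ek :* i) :* h :+ n)) refl
                   s (h ⟪ x ⟫) u (e h) i (k ⟪ x ⟫) (n′ ⟪ x ⟫) (e k) ⟩
            u * i * (- (e k) * h ⟪ x ⟫ + e h * k ⟪ x ⟫) + ((s + u * e k * i) * h ⟪ x ⟫ + n′ ⟪ x ⟫)
              ≈⟨ +-congʳ (trans (*-congˡ (sym (ep x))) (sym (⊙-eval (u * i) p x))) ⟩
            joint ⟪ x ⟫ + ((s + u * e k * i) * h ⟪ x ⟫ + n′ ⟪ x ⟫) ∎
          by-sign : Sign (s + u * e k * i) → Split P N g
          by-sign (pos t>0) with absorb {g = (s + u * e k * i) ⊙ h ⊕ n′} t>0 h∈ rest (⊙⊕-eval _ h n′)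
          ... | z , r , z∈ , zv , r∈ , ez = joint ⊕ z , r , cone-+ joint-cone z∈ (⊕-eval joint z)
            , trans (⊕-eval joint z v) (+-zero joint-v zv) , r∈
            , λ x → trans (exchange x) (trans (+-congˡ (trans (sym (⊙⊕-eval _ h n′ x)) (ez x)))
                (trans (sym (+-assoc _ _ _)) (+-congʳ (sym (⊕-eval joint z x)))))
          by-sign (null t≈0) = joint , n′ , joint-cone , joint-v , inj₂ rest
            , λ x → trans (exchange x) (+-congˡ (trans (+-congʳ (*-zeroˡ _ t≈0)) (+-identityˡ _)))
          by-sign (neg t<0) with inverse-pos (neg⇒-pos ek<0)
          ... | i′ , i′>0 , ei′ = (s * i′) ⊙ p , m ⊙ k ⊕ n′ , cone-∈ (s * i′) (*-pos s>0 i′>0) p∈ (⊙-eval (s * i′) p)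
            , trans (⊙-eval (s * i′) p v) (*-zeroʳ (s * i′) pv)
            , inj₂ (add m>0 k∈ rest (⊙⊕-eval m k n′)) , exchange′
            where
            -- Now `h` is exhausted first and `m` is what remains of the coefficient of `k`. It is
            -- positive, being minus the negative number above times the positive `e h * i′`.
            m = u + - (s * e h * i′)
            m>0 : 0# < m
            m>0 = pos-resp (begin
              - (s + u * e k * i) * (e h * i′)
                ≈⟨ solve 6 (λ s u ek i eh i′ → :- (s :+ u :* ek :* i) :* (eh :* i′)
                      := u :* (:- ek :* i′) :* (eh :* i) :+ :- (s :* eh :* i′)) refl s u (e k) i (e h) i′ ⟩
              u * (- (e k) * i′) * (e h * i) + - (s * e h * i′)
                ≈⟨ +-congʳ (trans (*-cong (trans (*-congˡ ei′) (*-identityʳ u)) ei) (*-identityʳ u)) ⟩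
              m ∎) (*-pos (neg⇒-pos t<0) (*-pos eh>0 i′>0))
            exchange′ : ∀ x → g ⟪ x ⟫ ≈ ((s * i′) ⊙ p) ⟪ x ⟫ + (m ⊙ k ⊕ n′) ⟪ x ⟫
            exchange′ x = begin
              g ⟪ x ⟫
                ≈⟨ trans (eq x) (+-congˡ (eq′ x)) ⟩
              s * h ⟪ x ⟫ + (u * k ⟪ x ⟫ + n′ ⟪ x ⟫)
                ≈⟨ +-congʳ (*-congˡ (trans (sym (*-identityˡ _)) (*-congʳ (sym ei′)))) ⟩
              s * (- (e k) * i′ * h ⟪ x ⟫) + (u * k ⟪ x ⟫ + n′ ⟪ x ⟫)
                ≈⟨ solve 8 (λ s h u eh i k n ek → s :* (:- ek :* i :* h) :+ (u :* k :+ n)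
                      := s :* i :* (:- ek :* h :+ eh :* k) :+ ((u :+ :- (s :* eh :* i)) :* k :+ n)) refl
                     s (h ⟪ x ⟫) u (e h) i′ (k ⟪ x ⟫) (n′ ⟪ x ⟫) (e k) ⟩
              s * i′ * (- (e k) * h ⟪ x ⟫ + e h * k ⟪ x ⟫) + (m * k ⟪ x ⟫ + n′ ⟪ x ⟫)
                ≈⟨ +-cong (trans (*-congˡ (sym (ep x))) (sym (⊙-eval (s * i′) p x))) (sym (⊙⊕-eval m k n′ x)) ⟩
              ((s * i′) ⊙ p) ⟪ x ⟫ + (m ⊙ k ⊕ n′) ⟪ x ⟫ ∎

      Above Below : Pred AffineFunctional (a ⊔ ℓ₂)
      Above h = H h × 0# < h ⟪ v ⟫
      Below h = H h × h ⟪ v ⟫ < 0#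

      absorb⁺ : ∀ {s h n g} → 0# < s → Above h → Cone Below n → (∀ x → g ⟪ x ⟫ ≈ s * h ⟪ x ⟫ + n ⟪ x ⟫) → Split Above Below g
      absorb⁺ = absorb (_⟪ v ⟫) λ {h} {k} Hh Hk h>0 k<0 →
        pivot k h v , join Hk Hh k<0 h>0 , pivot-at k h v , pivot-eval k h v

      absorb⁻ : ∀ {s h n g} → 0# < s → Below h → Cone Above n → (∀ x → g ⟪ x ⟫ ≈ s * h ⟪ x ⟫ + n ⟪ x ⟫) → Split Above Below g
      absorb⁻ s>0 (Hh , h<0) n∈ eq
        with absorb (λ h → - (h ⟪ v ⟫))
               (λ {h} {k} Hh Hk h<0 k>0 → pivot h k v
                 , join Hh Hk (-pos⇒neg h<0) (pos-resp (-‿involutive _) (neg⇒-pos k>0)) , pivot-at h k v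
                 , λ x → trans (pivot-eval h k v x) (trans (+-comm _ _) (+-congʳ (*-congʳ (sym (-‿involutive _))))))
               s>0 (Hh , neg⇒-pos h<0) (cone-mono (λ (Hk , k>0) → Hk , pos⇒-neg k>0) n∈) eq
      ... | z , r , z∈ , zv , inj₁ r∈ , ez = z , r , z∈ , zv , inj₂ (cone-mono (λ (Hk , k) → Hk , -pos⇒neg k) r∈) , ez
      ... | z , r , z∈ , zv , inj₂ r∈ , ez = z , r , z∈ , zv
        , inj₁ (cone-mono (λ (Hk , k) → Hk , pos-resp (-‿involutive _) (neg⇒-pos k)) r∈) , ez

      regroupʳ : ∀ {s h g g′ z r} → (∀ x → g ⟪ x ⟫ ≈ s * h ⟪ x ⟫ + g′ ⟪ x ⟫) → (∀ x → g′ ⟪ x ⟫ ≈ z ⟪ x ⟫ + r ⟪ x ⟫) →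
        ∀ x → g ⟪ x ⟫ ≈ z ⟪ x ⟫ + (s ⊙ h ⊕ r) ⟪ x ⟫
      regroupʳ {s} {h} {r = r} e e′ x = trans (e x) (trans (+-congˡ (e′ x))
        (trans (solve 3 (λ a z r → a :+ (z :+ r) := z :+ (a :+ r)) refl _ _ _) (+-congˡ (sym (⊙⊕-eval s h r x)))))

      split : ∀ {g} → Cone H g → Split Above Below g
      split (vertex z) = constant 0# , constant 0# , vertex (constant-eval 0#) , constant-eval 0# v
        , inj₁ (vertex (constant-eval 0#))
        , λ x → trans (z x) (sym (+-zero (constant-eval 0# x) (constant-eval 0# x)))
      split (add {s} {h} s>0 h∈ g′∈ e) with split g′∈ | sign (h ⟪ v ⟫)
      ... | z , r , z∈ , zv , r∈ , ez | null hv =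
        s ⊙ h ⊕ z , r , add s>0 (keep h∈ (inj₂ (sym hv))) z∈ (⊙⊕-eval s h z)
        , trans (⊙⊕-eval s h z v) (+-zero (*-zeroʳ s hv) zv) , r∈
        , λ x → trans (e x) (trans (+-congˡ (ez x)) (trans (sym (+-assoc _ _ _)) (+-congʳ (sym (⊙⊕-eval s h z x)))))
      ... | z , r , z∈ , zv , inj₁ r∈ , ez | pos hv =
        z , s ⊙ h ⊕ r , z∈ , zv , inj₁ (add s>0 (h∈ , hv) r∈ (⊙⊕-eval s h r)) , regroupʳ e ez
      ... | z , r , z∈ , zv , inj₂ r∈ , ez | neg hv =
        z , s ⊙ h ⊕ r , z∈ , zv , inj₂ (add s>0 (h∈ , hv) r∈ (⊙⊕-eval s h r)) , regroupʳ e ez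
      ... | z , r , z∈ , zv , inj₂ r∈ , ez | pos hv = combine (absorb⁺ s>0 (h∈ , hv) r∈ (⊙⊕-eval s h r))
        where
        combine : Split Above Below (s ⊙ h ⊕ r) → _
        combine (z′ , r′ , z′∈ , z′v , r′∈ , ez′) = z ⊕ z′ , r′ , cone-+ z∈ z′∈ (⊕-eval z z′)
          , trans (⊕-eval z z′ v) (+-zero zv z′v) , r′∈
          , λ x → trans (regroupʳ e ez x) (trans (+-congˡ (ez′ x)) (trans (sym (+-assoc _ _ _)) (+-congʳ (sym (⊕-eval z z′ x)))))
      ... | z , r , z∈ , zv , inj₁ r∈ , ez | neg hv = combine (absorb⁻ s>0 (h∈ , hv) r∈ (⊙⊕-eval s h r))
        where
        combine : Split Above Below (s ⊙ h ⊕ r) → _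
        combine (z′ , r′ , z′∈ , z′v , r′∈ , ez′) = z ⊕ z′ , r′ , cone-+ z∈ z′∈ (⊕-eval z z′)
          , trans (⊕-eval z z′ v) (+-zero zv z′v) , r′∈
          , λ x → trans (regroupʳ e ez x) (trans (+-congˡ (ez′ x)) (trans (sym (+-assoc _ _ _)) (+-congʳ (sym (⊕-eval z z′ x)))))

    -- In the normal form a nonempty remainder of generators below zero would make `g` negative at
    -- `v`. So the remainder is zero or consists of generators that are kept.
    cone-halfspace : ∀ {g} → Cone H g → 0# ≤ g ⟪ v ⟫ → Cone H′ g
    cone-halfspace g∈ gv≥0 with split g∈
    ... | z , r , z∈ , zv , inj₁ r∈ , ez = cone-+ z∈ (cone-mono (λ (h∈ , hv) → keep h∈ (inj₁ hv)) r∈) ez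
    ... | z , r , z∈ , zv , inj₂ (vertex r≈0) , ez = cone-+ z∈ (vertex r≈0) ez
    ... | z , r , z∈ , zv , inj₂ (add s>0 (h∈ , hv<0) r′∈ er) , ez = ⊥-elim (nonneg⇒≮0 gv≥0
      (neg-resp (sym (trans (ez v) (trans (+-cong zv (er v)) (+-identityˡ _))))
        (-pos⇒neg (pos-resp (solve 2 (λ a b → :- a :+ :- b := :- (a :+ b)) refl _ _)
          (pos+nonneg (neg⇒-pos (pos*neg s>0 hv<0)) (≤0 r′∈))))))
      where
      ≤0 : ∀ {r} → Cone Below r → 0# ≤ - (r ⟪ v ⟫)
      ≤0 (vertex r≈0) = inj₂ (sym (trans (-‿cong (r≈0 v)) -0#≈0#))
      ≤0 (add s>0 (_ , h<0) r∈ e) = nonneg-resp (trans (solve 2 (λ a b → :- a :+ :- b := :- (a :+ b)) refl _ _) (-‿cong (sym (e v))))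
        (nonneg+nonneg (inj₁ (neg⇒-pos (pos*neg s>0 h<0))) (≤0 r∈))

  Generates : ∀ {n} → Vector Point n → List AffineFunctional → Set ℓ
  Generates q hs = (∀ {h} → h ∈ˡ hs → ∀ k → 0# ≤ h ⟪ q k ⟫) × (∀ g → (∀ k → 0# ≤ g ⟪ q k ⟫) → Cone (_∈ˡ hs) g)

  private
    axes : List AffineFunctional
    axes = List.tabulate coordinate List.++ List.tabulate (λ j → (- 1#) ⊙ coordinate j)

    everything : List AffineFunctional
    everything = constant 1# ∷ (- 1#) ⊙ constant 1# ∷ axes

    signed-multiple : ∀ {a} {H : Pred AffineFunctional a} {f} s → H f → H ((- 1#) ⊙ f) → Cone H (s ⊙ f)
    signed-multiple {f = f} s f∈ -f∈ with sign s
    ... | pos s>0 = cone-∈ s s>0 f∈ (⊙-eval s f)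
    ... | null z  = vertex λ x → trans (⊙-eval s f x) (*-zeroˡ _ z)
    ... | neg s<0 = cone-∈ (- s) (neg⇒-pos s<0) -f∈ λ x → trans (⊙-eval s f x) (begin
      s * f ⟪ x ⟫                    ≈⟨ *-congˡ (sym (*-identityˡ _)) ⟩
      s * (1# * f ⟪ x ⟫)             ≈⟨ solve 3 (λ s o f → s :* (o :* f) := :- s :* (:- o :* f)) refl s 1# (f ⟪ x ⟫) ⟩
      - s * (- 1# * f ⟪ x ⟫)         ≈⟨ *-congˡ (sym (⊙-eval (- 1#) f x)) ⟩
      - s * ((- 1#) ⊙ f) ⟪ x ⟫       ∎)

    cone-linear-combination : ∀ {a} {H : Pred AffineFunctional a} {n} (s : Vector Carrier n) f →
      (∀ i → Cone H (s i ⊙ f i)) → Cone H (linear-combination s f)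
    cone-linear-combination {n = zero}  s f h = vertex (constant-eval 0#)
    cone-linear-combination {n = suc n} s f h =
      cone-+ (h zero) (cone-linear-combination (tail s) (tail f) (h ∘ suc)) (⊕-eval _ _)

    everything-generates : ∀ g → Cone (_∈ˡ everything) g
    everything-generates g = cone-+
      (signed-multiple offset (here ≡.refl) (there (here ≡.refl)))
      (cone-linear-combination normal coordinate λ j → signed-multiple (normal j)
        (there (there (∈-++⁺ˡ (∈-tabulate⁺ {f = coordinate} j))))
        (there (there (∈-++⁺ʳ (List.tabulate coordinate) (∈-tabulate⁺ {f = λ j → (- 1#) ⊙ coordinate j} j)))))
      λ x → begin
        g ⟪ x ⟫                                       ≈⟨ eval-coordinates g x ⟩
        sum (λ j → normal j * x j) + offset           ≈⟨ +-comm _ _ ⟩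
        offset + sum (λ j → normal j * x j)
          ≈⟨ +-cong (sym (trans (⊙-eval offset (constant 1#) x) (trans (*-congˡ (constant-eval 1# x)) (*-identityʳ offset))))
                    (sym (trans (linear-combination-eval normal coordinate x)
                      (sum-cong-≋ {x = λ j → normal j * coordinate j ⟪ x ⟫} {y = λ j → normal j * x j}
                        λ j → *-congˡ (coordinate-eval j x)))) ⟩
        (offset ⊙ constant 1#) ⟪ x ⟫ + linear-combination normal coordinate ⟪ x ⟫ ∎
      where open AffineFunctional g

  nonneg-on? : ∀ {n} (q : Vector Point n) f → Dec (∀ k → 0# ≤ f ⟪ q k ⟫)
  nonneg-on? q f = Fin.all? λ k → 0≤? (f ⟪ q k ⟫)

  -- Induction on the points. With no points the condition is empty, and the constants and
  -- coordinates with both signs generate all functionals; each further point intersects the cone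
  -- with a halfspace.
  dual-cone-generated : ∀ {n} (q : Vector Point n) → ∃[ hs ] Generates q hs
  dual-cone-generated {zero}  q = everything , (λ _ ()) , λ g _ → everything-generates g
  dual-cone-generated {suc n} q with dual-cone-generated (tail q)
  ... | hs , sound , complete = hs′ , (λ h∈ → proj₂ (∈-filter⁻ good {xs = candidates} h∈)) , λ g g≥0 →
      cone-halfspace {H = _∈ˡ hs} {H′ = _∈ˡ hs′} (q zero)
        (λ h∈ h≥0 → ∈-filter⁺ good (∈-++⁺ˡ h∈) λ { zero → h≥0 ; (suc k) → sound h∈ k })
        (λ {k} {h} k∈ h∈ k<0 h>0 → ∈-filter⁺ good (∈-++⁺ʳ hs (∈-cartesianProductWith⁺ _ k∈ h∈))
          λ { zero → inj₂ (sym (pivot-at k h (q zero)))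
            ; (suc i) → nonneg-resp (sym (pivot-eval k h _ _))
                (nonneg+nonneg (nonneg*nonneg (inj₁ (neg⇒-pos k<0)) (sound h∈ i)) (nonneg*nonneg (inj₁ h>0) (sound k∈ i))) })
        (complete g (g≥0 ∘ suc)) (g≥0 zero)
    where
    good = nonneg-on? q
    -- All pairs are combined, whatever their signs at the new point; the filter `good` discards the
    -- combinations that are not nonnegative on the points.
    candidates = hs List.++ List.cartesianProductWith (λ k h → pivot k h (q zero)) hs hs
    hs′ = List.filter good candidates

-- Functionals that cut out facets generate the dual cone.

module FacetFunctionals {c ℓ₁ ℓ₂} (K : OrderedField c ℓ₁ ℓ₂) where

  open OrderedFieldProperties K
  open AffineFunctionals K
  open ConvexHulls K
  open DualCones K
  open import Relation.Binary.Reasoning.Setoid setoid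

  NonNeg : ∀ {a} → Pred Point a → AffineFunctional → Set (a ⊔ c ⊔ ℓ₁ ⊔ ℓ₂)
  NonNeg Q f = ∀ x → x ∈ Q → 0# ≤ f ⟪ x ⟫

  Vanishes : ∀ {a} → Pred Point a → AffineFunctional → Set (a ⊔ c ⊔ ℓ₁)
  Vanishes X f = ∀ x → x ∈ X → f ⟪ x ⟫ ≈ 0#

  Zeros : Subset → AffineFunctional → Subset
  Zeros Q g x = x ∈ Q × g ⟪ x ⟫ ≈ 0#

  ⊕-nonneg : ∀ {f g x} → 0# ≤ f ⟪ x ⟫ → 0# ≤ g ⟪ x ⟫ → 0# ≤ (f ⊕ g) ⟪ x ⟫
  ⊕-nonneg {f} {g} {x} p q = nonneg-resp (sym (⊕-eval f g x)) (nonneg+nonneg p q)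

  ⊕-zeros : ∀ {f g x} → 0# ≤ f ⟪ x ⟫ → 0# ≤ g ⟪ x ⟫ → (f ⊕ g) ⟪ x ⟫ ≈ 0# → f ⟪ x ⟫ ≈ 0# × g ⟪ x ⟫ ≈ 0#
  ⊕-zeros {f} {g} {x} p q e = nonneg+nonneg≈0 p q (trans (sym (⊕-eval f g x)) e)

  ⊖_ : AffineFunctional → AffineFunctional
  ⊖ f = (- 1#) ⊙ f

  ⊖-eval : ∀ f x → (⊖ f) ⟪ x ⟫ ≈ - (f ⟪ x ⟫)
  ⊖-eval f x = trans (⊙-eval (- 1#) f x) (trans (sym (-‿distribˡ-* 1# _)) (-‿cong (*-identityˡ _)))

  ⊖-zero : ∀ {f x} → f ⟪ x ⟫ ≈ 0# → (⊖ f) ⟪ x ⟫ ≈ 0#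
  ⊖-zero {f} {x} z = trans (⊖-eval f x) (trans (-‿cong z) -0#≈0#)

  -- Finitely many points require only finitely many lower bounds on the multiple of `t`, and
  -- increasing the multiple preserves the bounds already met because `t` is nonnegative.
  dominate : ∀ {n} (q : Vector Point n) t f → (∀ k → 0# ≤ t ⟪ q k ⟫) → (∀ k → t ⟪ q k ⟫ ≈ 0# → 0# ≤ f ⟪ q k ⟫) →
    ∃[ m ] 0# < m × (∀ k → 0# ≤ (m ⊙ t ⊕ f) ⟪ q k ⟫)
  dominate {zero} q t f _ _ = 1# , 0<1 , λ ()
  dominate {suc n} q t f t≥0 f≥0 with dominate (tail q) t f (t≥0 ∘ suc) (f≥0 ∘ suc) | 0≤? (f ⟪ q zero ⟫)
  ... | m , m>0 , h | yes f₀ = m , m>0 , λ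
    { zero → nonneg-resp (sym (⊙⊕-eval m t f _)) (nonneg+nonneg (nonneg*nonneg (inj₁ m>0) (t≥0 zero)) f₀) ; (suc k) → h k }
  ... | m , m>0 , h | no f₀≱0 with nonneg-split (t≥0 zero)
  ...   | inj₁ z = ⊥-elim (f₀≱0 (f≥0 zero z))
  ...   | inj₂ t₀>0 with inverse-pos t₀>0
  ...     | i , i>0 , ei = m + b , pos+nonneg m>0 (inj₁ b>0) , bound
    where
    f₀<0 : f ⟪ q zero ⟫ < 0#
    f₀<0 with sign (f ⟪ q zero ⟫)
    ... | neg n  = n
    ... | null z = ⊥-elim (f₀≱0 (inj₂ (sym z)))
    ... | pos p  = ⊥-elim (f₀≱0 (inj₁ p))
    -- Minus the quotient of the values of `f` and `t` at `q zero`: adding b t cancels `f` there and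
    -- leaves m t.
    b = - (f ⟪ q zero ⟫) * i
    b>0 : 0# < b
    b>0 = *-pos (neg⇒-pos f₀<0) i>0
    bound : ∀ k → 0# ≤ ((m + b) ⊙ t ⊕ f) ⟪ q k ⟫
    bound zero = nonneg-resp (sym (begin
      ((m + b) ⊙ t ⊕ f) ⟪ q zero ⟫        ≈⟨ ⊙⊕-eval (m + b) t f (q zero) ⟩
      (m + - f₀ * i) * t₀ + f₀
        ≈⟨ solve 4 (λ m f i t → (m :+ :- f :* i) :* t :+ f := m :* t :+ (f :+ :- (f :* (t :* i)))) refl m f₀ i t₀ ⟩
      m * t₀ + (f₀ + - (f₀ * (t₀ * i)))   ≈⟨ +-congˡ (+-congˡ (-‿cong (trans (*-congˡ ei) (*-identityʳ f₀)))) ⟩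
      m * t₀ + (f₀ + - f₀)                ≈⟨ trans (+-congˡ (-‿inverseʳ f₀)) (+-identityʳ _) ⟩
      m * t₀                              ∎)) (nonneg*nonneg (inj₁ m>0) (t≥0 zero))
      where
      f₀ = f ⟪ q zero ⟫
      t₀ = t ⟪ q zero ⟫
    bound (suc k) = nonneg-resp (sym (begin
      ((m + b) ⊙ t ⊕ f) ⟪ q (suc k) ⟫     ≈⟨ ⊙⊕-eval (m + b) t f (q (suc k)) ⟩
      (m + b) * tₖ + fₖ                   ≈⟨ solve 4 (λ m b t f → (m :+ b) :* t :+ f := (m :* t :+ f) :+ b :* t) refl m b tₖ fₖ ⟩
      (m * tₖ + fₖ) + b * tₖ              ≈⟨ +-congʳ (sym (⊙⊕-eval m t f (q (suc k)))) ⟩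
      (m ⊙ t ⊕ f) ⟪ q (suc k) ⟫ + b * tₖ  ∎)) (nonneg+nonneg (h k) (nonneg*nonneg (inj₁ b>0) (t≥0 (suc k))))
      where
      fₖ = f ⟪ q (suc k) ⟫
      tₖ = t ⟪ q (suc k) ⟫

  basis : ∀ {n z} (q : Vector Point n) {Z : Pred (Fin n) z} → (∀ k → Dec (Z k)) →
    ∃[ m ] Σ (Vector Point m) λ p → Independent p × (∀ i → ∃[ k ] Z k × p i ≡ q k) × (∀ k → Z k → Flat p (q k))
  basis {zero} q Z? = 0 , []ᵛ , (λ ()) , (λ ()) , λ ()
  basis {suc n} q {Z} Z? with basis (tail q) (Z? ∘ suc) | Z? zero
  ... | m , p , ind , p∈ , fl | no ¬z = m , p , ind , (λ i → let k , z , e = p∈ i in suc k , z , e)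
      , λ { zero z → ⊥-elim (¬z z) ; (suc k) z → fl k z }
  ... | m , p , ind , p∈ , fl | yes z₀ with flat-or-separate p (q zero)
  ...   | inj₁ fl₀ = m , p , ind , (λ i → let k , z , e = p∈ i in suc k , z , e)
      , λ { zero z → fl₀ ; (suc k) z → fl k z }
  ...   | inj₂ (f , v , nz) = suc m , q zero ∷ᵛ p , independent-∷ f ind v nz
      , (λ { zero → zero , z₀ , ≡.refl ; (suc i) → let k , z , e = p∈ i in suc k , z , e })
      , λ { zero z g h → h zero ; (suc k) z g h → fl k z g (h ∘ suc) }

  -- The dimension plus one, so that the empty set has a size too.
  HasSize : ∀ {a} → Pred Point a → ℕ → Set (a ⊔ c ⊔ ℓ₁)
  HasSize X n = Σ (Vector Point n) λ p → (∀ i → p i ∈ X) × Independent p × (∀ x → x ∈ X → Flat p x)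

  size-unique : ∀ {a} {X : Pred Point a} {m n} → HasSize X m → HasSize X n → m ≡ n
  size-unique (p , p∈ , ind , fl) (p′ , p′∈ , ind′ , fl′) = ℕ.≤-antisym
    (independent-≤ {q = p′} ind λ i → fl′ _ (p∈ i)) (independent-≤ {q = p} ind′ λ i → fl _ (p′∈ i))

  size-resp : ∀ {a b} {X : Pred Point a} {Y : Pred Point b} {n} →
    (∀ x → x ∈ X → x ∈ Y) → (∀ x → x ∈ Y → x ∈ X) → HasSize X n → HasSize Y n
  size-resp i j (p , p∈ , ind , fl) = p , (λ k → i _ (p∈ k)) , ind , λ x x∈ → fl x (j x x∈)

  size⇒dim : ∀ {X : Subset} {d} → HasSize X (suc d) → HasDim X d
  size⇒dim (p , p∈ , ind , fl) = p , p∈ , independent⇒affinelyIndependent ind , λ {x} x∈ → flat⇒aff p (fl x x∈)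

  dim⇒size : ∀ {X : Subset} {d} → HasDim X d → HasSize X (suc d)
  dim⇒size (p , p∈ , ind , sp) = p , p∈ , affinelyIndependent⇒independent ind , λ x x∈ → aff⇒flat p (sp x∈)

  -- The working notion of a 4-polytope. The corners are asked to lie in `Q` and to detect
  -- nonnegativity of functionals, not to have `Q` as their hull. In this form the data pass to
  -- `Q ⊞ v` by adding `v` to the corners.
  record Poly (Q : Subset) : Set ℓ where
    field
      convex     : ∀ x → x ∈ conv Q → x ∈ Q
      size       : ℕ
      corner     : Vector Point size
      corner∈    : ∀ k → corner k ∈ Q
      determined : ∀ f → (∀ k → 0# ≤ f ⟪ corner k ⟫) → NonNeg Q f
      frame      : Vector Point 5
      frame∈     : ∀ i → frame i ∈ Q
      frame-ind  : Independent frame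

    zero-everywhere : ∀ f → Vanishes Q f → Zero f
    zero-everywhere f z x = independent₅-flat frame-ind x f λ i → z _ (frame∈ i)

    module _ {g} (g≥0 : NonNeg Q g) where

      exceed : ∀ f → (∀ k → g ⟪ corner k ⟫ ≈ 0# → 0# ≤ f ⟪ corner k ⟫) → ∃[ m ] 0# < m × NonNeg Q (m ⊙ g ⊕ f)
      exceed f h with dominate corner g f (λ k → g≥0 _ (corner∈ k)) h
      ... | m , m>0 , e = m , m>0 , determined (m ⊙ g ⊕ f) e

      -- Stands in for the fact that a face is the hull of its corners: a large multiple of `g`
      -- makes `f` nonnegative on all of `Q` and changes nothing on the face, where `g` is zero.
      zeros-nonneg : ∀ f → (∀ k → g ⟪ corner k ⟫ ≈ 0# → 0# ≤ f ⟪ corner k ⟫) → NonNeg (Zeros Q g) f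
      zeros-nonneg f h x (x∈ , z) with exceed f h
      ... | m , m>0 , n = nonneg-resp (trans (⊙⊕-eval m g f x) (trans (+-congʳ (*-zeroʳ m z)) (+-identityˡ _))) (n x x∈)

      zeros-vanish : ∀ f → (∀ k → g ⟪ corner k ⟫ ≈ 0# → f ⟪ corner k ⟫ ≈ 0#) → Vanishes (Zeros Q g) f
      zeros-vanish f h x x∈ = nonneg∧≯0⇒0 (zeros-nonneg f (λ k z → inj₂ (sym (h k z))) x x∈)
        λ p → nonneg⇒≮0 (zeros-nonneg (⊖ f) (λ k z → inj₂ (sym (⊖-zero {f} (h k z)))) x x∈)
                (neg-resp (sym (⊖-eval f x)) (pos⇒-neg p))

      zeros-size : ∃[ n ] HasSize (Zeros Q g) n
      zeros-size with basis corner (λ k → (g ⟪ corner k ⟫) ≈0?)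
      ... | n , p , ind , p∈ , fl = n , p
        , (λ i → let k , z , e = p∈ i in ≡.subst (λ y → y ∈ Zeros Q g) (≡.sym e) (corner∈ k , z)) , ind
        , λ x x∈ f v → zeros-vanish f (λ k z → fl k z f v) x x∈

  record Facet (Q : Subset) (h : AffineFunctional) : Set ℓ where
    field
      nonneg      : NonNeg Q h
      zeros       : Vector Point 4
      zeros∈      : ∀ i → zeros i ∈ Q
      zeros-null  : ∀ i → h ⟪ zeros i ⟫ ≈ 0#
      zeros-ind   : Independent zeros
      witness     : Point
      witness∈    : witness ∈ Q
      witness-pos : 0# < h ⟪ witness ⟫

  -- Since `f` vanishes on `p` and not at `x`, these are five independent points, and `h` vanishes
  -- at all of them.
  independent-zeros : ∀ {p : Vector Point 4} {h f x} → Independent p → (∀ i → h ⟪ p i ⟫ ≈ 0#) → (∀ i → f ⟪ p i ⟫ ≈ 0#) →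
    h ⟪ x ⟫ ≈ 0# → f ⟪ x ⟫ ≉ 0# → Zero h
  independent-zeros {h = h} {f} ind hp fp hx fx y =
    independent₅-flat (independent-∷ f ind fp fx) y h λ { zero → hx ; (suc i) → hp i }

  all-or-some : ∀ {n a b} {A : Pred (Fin n) a} {B : Pred (Fin n) b} → (∀ i → A i ⊎ B i) → (∀ i → A i) ⊎ ∃[ i ] B i
  all-or-some {zero} h = inj₁ λ ()
  all-or-some {suc n} h with h zero | all-or-some (h ∘ suc)
  ... | inj₂ b | _ = inj₂ (zero , b)
  ... | inj₁ _ | inj₂ (i , b) = inj₂ (suc i , b)
  ... | inj₁ a | inj₁ as = inj₁ λ { zero → a ; (suc i) → as i }

  module _ {Q : Subset} (Qp : Poly Q) where
    open Poly Qp

    -- A direction in which the hyperplane of `h` can be tilted without leaving its face: `w`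
    -- vanishes at the corners of the face, and its values at `y₀` and `y₁` show that it is not a
    -- multiple of `h`.
    record Tilt (h : AffineFunctional) : Set ℓ where
      field
        w     : AffineFunctional
        w-van : ∀ k → h ⟪ corner k ⟫ ≈ 0# → w ⟪ corner k ⟫ ≈ 0#
        y₀ y₁ : Point
        y₀∈   : y₀ ∈ Q
        y₁∈   : y₁ ∈ Q
        h-y₀  : 0# < h ⟪ y₀ ⟫
        w-y₀  : w ⟪ y₀ ⟫ ≈ 0#
        w-y₁  : w ⟪ y₁ ⟫ ≉ 0#

    -- A corner `k₀` off the face together with a basis `p` of the face either spans the frame, and
    -- then `p` has four points by counting, or misses a frame point, and then the separating
    -- functional is the tilt.
    facet-or-tilt : ∀ h → NonNeg Q h → Facet Q h ⊎ Zero h ⊎ Tilt h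
    facet-or-tilt h h≥0 with Fin.any? (λ k → 0<? (h ⟪ corner k ⟫))
    ... | no none = inj₂ (inj₁ (zero-everywhere h λ x x∈ → zeros-vanish (λ y _ → inj₂ (sym (constant-eval 0# y))) h
            (λ k _ → nonneg∧≯0⇒0 (h≥0 _ (corner∈ k)) λ p → none (k , p)) x (x∈ , constant-eval 0# x)))
    ... | yes (k₀ , h₀) with basis corner (λ k → (h ⟪ corner k ⟫) ≈0?)
    ...   | n , p , ind , p∈ , fl with all-or-some (λ i → flat-or-separate (corner k₀ ∷ᵛ p) (frame i))
    ...     | inj₂ (i , w , v , nz) = inj₂ (inj₂ record
                { w = w ; w-van = λ k z → fl k z w (v ∘ suc) ; y₀ = corner k₀ ; y₁ = frame i ; y₀∈ = corner∈ k₀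
                ; y₁∈ = frame∈ i ; h-y₀ = h₀ ; w-y₀ = v zero ; w-y₁ = nz })
    ...     | inj₁ all with size≡5
      where
      p-null : ∀ i → h ⟪ p i ⟫ ≈ 0#
      p-null i = let k , z , e = p∈ i in trans (reflexive (≡.cong (h ⟪_⟫) e)) z
      size≡5 : suc n ≡ 5
      size≡5 = ℕ.≤-antisym
        (independent-≤ {q = standard} (independent-∷ {x = corner k₀} h ind p-null (pos⇒≉0 h₀)) λ i → standard-flat _)
        (independent-≤ {q = corner k₀ ∷ᵛ p} frame-ind all)
    ...       | ≡.refl = inj₁ record
                { nonneg = h≥0 ; zeros = p
                ; zeros∈ = λ i → let k , z , e = p∈ i in ≡.subst (λ y → y ∈ Q) (≡.sym e) (corner∈ k)
                ; zeros-null = λ i → let k , z , e = p∈ i in trans (reflexive (≡.cong (h ⟪_⟫) e)) z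
                ; zeros-ind = ind ; witness = corner k₀ ; witness∈ = corner∈ k₀ ; witness-pos = h₀ }

    isolate : ∀ {r} {R : Pred AffineFunctional r} {h g} → Cone (λ f → f ≡ h ⊎ R f) g →
      ∃[ a ] ∃[ r ] Cone R r × (∀ x → g ⟪ x ⟫ ≈ a * h ⟪ x ⟫ + r ⟪ x ⟫)
    isolate {g = g} (vertex z) = 0# , g , vertex z , λ x → sym (trans (+-congʳ (zeroˡ _)) (+-identityˡ _))
    isolate (add {s} {f} s>0 f∈ k e) with isolate k
    isolate {h = h} (add {s} {.h} s>0 (inj₁ ≡.refl) k e) | a , r , r∈ , er = s + a , r , r∈ , λ x → trans (e x)
      (trans (+-congˡ (er x)) (trans (sym (+-assoc _ _ _)) (+-congʳ (sym (distribʳ _ _ _)))))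
    isolate {h = h} (add {s} {f} s>0 (inj₂ f∈) k e) | a , r , r∈ , er = a , s ⊙ f ⊕ r , add s>0 f∈ r∈ (⊙⊕-eval s f r)
      , λ x → trans (e x) (trans (+-congˡ (er x)) (trans
          (solve 3 (λ x y z → x :+ (y :+ z) := y :+ (x :+ z)) refl _ _ _) (+-congˡ (sym (⊙⊕-eval s f r x)))))

    -- h is the midpoint of two supporting functionals m h ± w, up to scale; if h needed itself
    -- to generate them, then w would be a multiple of h.
    tilt-redundant : ∀ {r} {R : Pred AffineFunctional r} {h} → (∀ {f} → R f → NonNeg Q f) →
      (∀ g → NonNeg Q g → Cone (λ f → f ≡ h ⊎ R f) g) → NonNeg Q h → Tilt h → Cone R h
    tilt-redundant {R = R} {h} R≥0 complete h≥0 T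
      with exceed h≥0 (Tilt.w T) (λ k z → inj₂ (sym (Tilt.w-van T k z)))
         | exceed h≥0 (⊖ Tilt.w T) (λ k z → inj₂ (sym (⊖-zero {Tilt.w T} (Tilt.w-van T k z))))
    ... | m , _ , g≥0 | m′ , _ , g′≥0 with isolate (complete _ g≥0) | isolate (complete _ g′≥0)
    ... | a , r , r∈ , e | a′ , r′ , r′∈ , e′ = by-sign (sign d)
      where
      open Tilt T
      d = (m + m′) + - (a + a′)
      balance : ∀ x → d * h ⟪ x ⟫ ≈ r ⟪ x ⟫ + r′ ⟪ x ⟫
      balance x = begin
        d * H
          ≈⟨ solve 6 (λ m m′ a a′ H W → ((m :+ m′) :+ :- (a :+ a′)) :* H
                := ((m :* H :+ W) :+ :- (a :* H)) :+ ((m′ :* H :+ :- W) :+ :- (a′ :* H))) refl m m′ a a′ H (w ⟪ x ⟫) ⟩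
        ((m * H + w ⟪ x ⟫) + - (a * H)) + ((m′ * H + - (w ⟪ x ⟫)) + - (a′ * H))
          ≈⟨ +-cong (+-congʳ (trans (sym (⊙⊕-eval m h w x)) (e x)))
                    (+-congʳ (trans (+-congˡ (sym (⊖-eval w x))) (trans (sym (⊙⊕-eval m′ h (⊖ w) x)) (e′ x)))) ⟩
        ((a * H + r ⟪ x ⟫) + - (a * H)) + ((a′ * H + r′ ⟪ x ⟫) + - (a′ * H))
          ≈⟨ solve 4 (λ p r q s → ((p :+ r) :+ :- p) :+ ((q :+ s) :+ :- q) := r :+ s) refl (a * H) (r ⟪ x ⟫) (a′ * H) (r′ ⟪ x ⟫) ⟩
        r ⟪ x ⟫ + r′ ⟪ x ⟫ ∎
        where H = h ⟪ x ⟫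
      R-nonneg : ∀ {f x} → x ∈ Q → Cone R f → 0# ≤ f ⟪ x ⟫
      R-nonneg x∈ = cone-nonneg λ f∈ → R≥0 f∈ _ x∈
      by-sign : Sign d → Cone R h
      by-sign (pos d>0) with inverse-pos d>0
      ... | i , i>0 , ei = cone-scale i i>0 (cone-+ r∈ r′∈ (⊕-eval r r′)) λ x → sym (begin
        i * (r ⊕ r′) ⟪ x ⟫           ≈⟨ *-congˡ (trans (⊕-eval r r′ x) (sym (balance x))) ⟩
        i * (d * h ⟪ x ⟫)            ≈⟨ sym (*-assoc _ _ _) ⟩
        i * d * h ⟪ x ⟫              ≈⟨ *-congʳ (trans (*-comm i d) ei) ⟩
        1# * h ⟪ x ⟫                 ≈⟨ *-identityˡ _ ⟩
        h ⟪ x ⟫                      ∎)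
      by-sign (neg d<0) = ⊥-elim (nonneg⇒≮0 (nonneg+nonneg (R-nonneg y₀∈ r∈) (R-nonneg y₀∈ r′∈))
        (neg-resp (trans (*-comm _ _) (balance y₀)) (pos*neg h-y₀ d<0)))
      -- Here `r` vanishes on `Q`, so `w` equals (a - m) h there; the value at `y₀` gives a = m, and
      -- `w` would be zero at `y₁`.
      by-sign (null d≈0) = ⊥-elim (w-y₁ (begin
        w ⟪ y₁ ⟫
          ≈⟨ solve 4 (λ m a H W → W := ((m :* H :+ W) :+ :- (a :* H)) :+ :- ((m :+ :- a) :* H)) refl m a (h ⟪ y₁ ⟫) (w ⟪ y₁ ⟫) ⟩
        ((m * h ⟪ y₁ ⟫ + w ⟪ y₁ ⟫) + - (a * h ⟪ y₁ ⟫)) + - ((m + - a) * h ⟪ y₁ ⟫)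
          ≈⟨ +-zero (excess y₁ y₁∈) (trans (-‿cong (*-zeroˡ _ m≈a)) -0#≈0#) ⟩
        0# ∎))
        where
        r-zero : ∀ x → x ∈ Q → r ⟪ x ⟫ ≈ 0#
        r-zero x x∈ = proj₁ (nonneg+nonneg≈0 (R-nonneg x∈ r∈) (R-nonneg x∈ r′∈)
          (trans (sym (balance x)) (*-zeroˡ _ d≈0)))
        excess : ∀ x → x ∈ Q → (m * h ⟪ x ⟫ + w ⟪ x ⟫) + - (a * h ⟪ x ⟫) ≈ 0#
        excess x x∈ = begin
          (m * h ⟪ x ⟫ + w ⟪ x ⟫) + - (a * h ⟪ x ⟫)  ≈⟨ +-congʳ (trans (sym (⊙⊕-eval m h w x)) (e x)) ⟩
          (a * h ⟪ x ⟫ + r ⟪ x ⟫) + - (a * h ⟪ x ⟫)  ≈⟨ +-congʳ (trans (+-congˡ (r-zero x x∈)) (+-identityʳ _)) ⟩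
          a * h ⟪ x ⟫ + - (a * h ⟪ x ⟫)              ≈⟨ -‿inverseʳ _ ⟩
          0#                                         ∎
        m≈a : m + - a ≈ 0#
        m≈a = ≉0∧*≈0⇒≈0 (pos⇒≉0 h-y₀) (begin
          h ⟪ y₀ ⟫ * (m + - a)
            ≈⟨ solve 3 (λ H m a → H :* (m :+ :- a) := m :* H :+ :- (a :* H)) refl (h ⟪ y₀ ⟫) m a ⟩
          m * h ⟪ y₀ ⟫ + - (a * h ⟪ y₀ ⟫)
            ≈⟨ +-congʳ (sym (trans (+-congˡ w-y₀) (+-identityʳ _))) ⟩
          (m * h ⟪ y₀ ⟫ + w ⟪ y₀ ⟫) + - (a * h ⟪ y₀ ⟫)
            ≈⟨ excess y₀ y₀∈ ⟩
          0# ∎)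

    private
      Complete : Pred AffineFunctional c → Set (ℓ)
      Complete H = ∀ g → NonNeg Q g → Cone H g

      prune : ∀ done todo → (∀ {h} → h ∈ˡ done → Facet Q h) → (∀ {h} → h ∈ˡ todo → NonNeg Q h) →
        Complete (λ h → h ∈ˡ done ⊎ h ∈ˡ todo) → ∃[ hs ] (∀ {h} → h ∈ˡ hs → Facet Q h) × Complete (_∈ˡ hs)
      prune done [] facets _ complete =
        done , facets , λ g g≥0 → cone-mono (λ { (inj₁ h∈) → h∈ ; (inj₂ ()) }) (complete g g≥0)
      prune done (h ∷ todo) facets todo≥0 complete with facet-or-tilt h (todo≥0 (here ≡.refl))
      ... | inj₁ F = prune (h ∷ done) todo (λ { (here ≡.refl) → F ; (there h∈) → facets h∈ }) (todo≥0 ∘ there)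
        λ g g≥0 → cone-mono (λ { (inj₁ h∈) → inj₁ (there h∈) ; (inj₂ (here e)) → inj₁ (here e) ; (inj₂ (there h∈)) → inj₂ h∈ })
          (complete g g≥0)
      ... | inj₂ other = prune done todo facets (todo≥0 ∘ there) λ g g≥0 →
        cone-bind (λ { (inj₁ h∈) → member (inj₁ h∈) ; (inj₂ (here ≡.refl)) → redundant other ; (inj₂ (there h∈)) → member (inj₂ h∈) })
          (complete g g≥0)
        where
        member : ∀ {f} → f ∈ˡ done ⊎ f ∈ˡ todo → Cone (λ f → f ∈ˡ done ⊎ f ∈ˡ todo) f
        member f∈ = cone-∈ 1# 0<1 f∈ λ x → sym (*-identityˡ _)
        redundant : Zero h ⊎ Tilt h → Cone (λ f → f ∈ˡ done ⊎ f ∈ˡ todo) h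
        redundant (inj₁ z) = vertex z
        redundant (inj₂ T) = tilt-redundant
          (λ { (inj₁ f∈) → Facet.nonneg (facets f∈) ; (inj₂ f∈) → todo≥0 (there f∈) })
          (λ g g≥0 → cone-mono
            (λ { (inj₁ f∈) → inj₂ (inj₁ f∈) ; (inj₂ (here e)) → inj₁ e ; (inj₂ (there f∈)) → inj₂ (inj₂ f∈) }) (complete g g≥0))
          (todo≥0 (here ≡.refl)) T

    opaque

      facet-generators : ∃[ hs ] (∀ {h} → h ∈ˡ hs → Facet Q h) × (∀ g → NonNeg Q g → Cone (_∈ˡ hs) g)
      facet-generators with dual-cone-generated corner
      ... | hs , sound , complete = prune [] hs (λ ()) (λ {h} h∈ → determined h (sound h∈))
        λ g g≥0 → cone-mono inj₂ (complete g λ k → g≥0 _ (corner∈ k))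

-- Faces of the hull of a polytope and one further point.

module AddingAPoint {c ℓ₁ ℓ₂} (K : OrderedField c ℓ₁ ℓ₂) where

  open OrderedFieldProperties K
  open AffineFunctionals K
  open ConvexHulls K
  open DualCones K
  open FacetFunctionals K
  open import Relation.Binary.Reasoning.Setoid setoid

  module _ {a} {H : Pred AffineFunctional a} where

    -- A sum of nonnegative terms vanishes only termwise. Together with `cone-positive` and
    -- `cone-negative` this turns an arbitrary functional witnessing `Pos` or `Neg` into a facet
    -- functional from the finite list of generators.
    cone-vanish : ∀ {b} {X : Pred Point b} {g} → (∀ {h} → H h → NonNeg X h) → Cone H g → Vanishes X g →
      Cone (λ h → H h × Vanishes X h) g
    cone-vanish H≥0 (vertex z) _ = vertex z
    cone-vanish {X = X} {g} H≥0 (add {s} {h} {g′} s>0 h∈ g′∈ e) van =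
      add s>0 (h∈ , λ x x∈ → ≉0∧*≈0⇒≈0 (pos⇒≉0 s>0) (proj₁ (both x x∈)))
        (cone-vanish H≥0 g′∈ λ x x∈ → proj₂ (both x x∈)) e
      where
      both : ∀ x → x ∈ X → s * h ⟪ x ⟫ ≈ 0# × g′ ⟪ x ⟫ ≈ 0#
      both x x∈ = nonneg+nonneg≈0 (nonneg*nonneg (inj₁ s>0) (H≥0 h∈ x x∈))
        (cone-nonneg (λ h∈ → H≥0 h∈ x x∈) g′∈) (trans (sym (e x)) (van x x∈))

    cone-positive : ∀ {g v} → Cone H g → 0# < g ⟪ v ⟫ → ∃[ h ] H h × 0# < h ⟪ v ⟫
    cone-positive (vertex z) p = ⊥-elim (pos⇒≉0 p (z _))
    cone-positive {v = v} (add {s} {h} {g′} s>0 h∈ g′∈ e) p with 0<? (h ⟪ v ⟫) | 0<? (g′ ⟪ v ⟫)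
    ... | yes q | _     = h , h∈ , q
    ... | no _  | yes q = cone-positive g′∈ q
    ... | no h≯ | no g≯ = ⊥-elim (nonneg⇒≮0 (nonneg-resp (solve 2 (λ a b → :- a :+ :- b := :- (a :+ b)) refl _ _)
        (nonneg+nonneg (flip (h≯ ∘ pos*-reflects-pos s>0)) (flip g≯))) (pos⇒-neg (pos-resp (e v) p)))
      where
      flip : ∀ {x} → ¬ 0# < x → 0# ≤ - x
      flip ¬p = ≮0⇒nonneg λ n → ¬p (pos-resp (-‿involutive _) (neg⇒-pos n))

    cone-negative : ∀ {g v} → Cone H g → g ⟪ v ⟫ < 0# → ∃[ h ] H h × h ⟪ v ⟫ < 0#
    cone-negative (vertex z) p = ⊥-elim (neg⇒≉0 p (z _))
    cone-negative {v = v} (add {s} {h} {g′} s>0 h∈ g′∈ e) p with <0? (h ⟪ v ⟫) | <0? (g′ ⟪ v ⟫)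
    ... | yes q | _     = h , h∈ , q
    ... | no _  | yes q = cone-negative g′∈ q
    ... | no h≮ | no g≮ = ⊥-elim (nonneg⇒≮0
        (nonneg+nonneg (nonneg*nonneg (inj₁ s>0) (≮0⇒nonneg h≮)) (≮0⇒nonneg g≮)) (neg-resp (e v) p))

  record Face (Q F : Subset) : Set ℓ where
    field
      support : AffineFunctional
      nonneg  : NonNeg Q support
      inside  : ∀ x → x ∈ F → x ∈ Zeros Q support
      outside : ∀ x → x ∈ Zeros Q support → x ∈ F

    vanish : Vanishes F support
    vanish x x∈ = proj₂ (inside x x∈)

    member : ∀ x → x ∈ F → x ∈ Q
    member x x∈ = proj₁ (inside x x∈)

  isFace⇒face : ∀ {Q F} → IsFace Q F → Face Q F
  isFace⇒face (h , h≥0 , i , j) = record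
    { support = h
    ; nonneg = λ x x∈ → nonneg-resp (sym (⟪⟫≈⟨⟩ h x)) (h≥0 x x∈)
    ; inside = λ x x∈ → let m , z = i x∈ in m , trans (⟪⟫≈⟨⟩ h x) z
    ; outside = λ x (x∈ , z) → j (x∈ , trans (sym (⟪⟫≈⟨⟩ h x)) z) }

  face⇒isFace : ∀ {Q F} → Face Q F → IsFace Q F
  face⇒isFace f = support , (λ x x∈ → nonneg-resp (⟪⟫≈⟨⟩ support x) (nonneg x x∈))
    , (λ {x} x∈ → let m , z = inside x x∈ in m , trans (sym (⟪⟫≈⟨⟩ support x)) z)
    , λ {x} (x∈ , z) → outside x (x∈ , trans (⟪⟫≈⟨⟩ support x) z)
    where open Face f

  module Extension {Q : Subset} (Qp : Poly Q) (v : Point) where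
    open Poly Qp

    Q∪v : Subset
    Q∪v = Q ∪ (_≋ v)

    old : ∀ x → x ∈ Q → x ∈ Q ⊞ v
    old x x∈ = ∈-conv Q∪v x (inj₁ x∈)

    new : v ∈ Q ⊞ v
    new = ∈-conv Q∪v v (inj₂ ≋-refl)

    ext-nonneg : ∀ {f} → NonNeg Q f → 0# ≤ f ⟪ v ⟫ → NonNeg (Q ⊞ v) f
    ext-nonneg {f} f≥0 fv = nonneg-conv Q∪v f λ
      { x (inj₁ x∈) → f≥0 x x∈ ; x (inj₂ e) → nonneg-resp (sym (eval-cong f e)) fv }

    ext-poly : Poly (Q ⊞ v)
    ext-poly = record
      { convex = conv-bind (Q ⊞ v) Q∪v λ x x∈ → x∈
      ; size = suc size
      ; corner = v ∷ᵛ corner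
      ; corner∈ = λ { zero → new ; (suc k) → old _ (corner∈ k) }
      ; determined = λ f h → ext-nonneg {f} (determined f (h ∘ suc)) (h zero)
      ; frame = frame
      ; frame∈ = λ i → old _ (frame∈ i)
      ; frame-ind = frame-ind }

    ext-facet : ∀ {h} → Facet Q h → 0# ≤ h ⟪ v ⟫ → Facet (Q ⊞ v) h
    ext-facet {h} F hv = record
      { nonneg = ext-nonneg nonneg hv ; zeros = zeros ; zeros∈ = λ i → old _ (zeros∈ i) ; zeros-null = zeros-null
      ; zeros-ind = zeros-ind ; witness = witness ; witness∈ = old _ witness∈ ; witness-pos = witness-pos }
      where open Facet F

    cone-⊆ : ∀ {F : Subset} → (∀ x → x ∈ F → x ∈ Q) → ∀ x → x ∈ F ⊞ v → x ∈ Q ⊞ v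
    cone-⊆ {F} i = conv-mono (F ∪ (_≋ v)) λ { x (inj₁ x∈) → inj₁ (i x x∈) ; x (inj₂ e) → inj₂ e }

    cone-cong : ∀ {F G : Subset} → F ≐ G → F ⊞ v ≐ G ⊞ v
    cone-cong {F} {G} (i , j) =
        (λ {x} → conv-mono (F ∪ (_≋ v)) (λ { y (inj₁ y∈) → inj₁ (i y∈) ; y (inj₂ e) → inj₂ e }) x)
      , (λ {x} → conv-mono (G ∪ (_≋ v)) (λ { y (inj₁ y∈) → inj₁ (j y∈) ; y (inj₂ e) → inj₂ e }) x)

    v∈cone : ∀ {F : Subset} → v ∈ F ⊞ v
    v∈cone {F} = ∈-conv (F ∪ (_≋ v)) v (inj₂ ≋-refl)

    ⊆-cone : ∀ {F : Subset} x → x ∈ F → x ∈ F ⊞ v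
    ⊆-cone {F} x x∈ = ∈-conv (F ∪ (_≋ v)) x (inj₁ x∈)

    cone-vanishes : ∀ {F : Subset} {f} → Vanishes F f → f ⟪ v ⟫ ≈ 0# → Vanishes (F ⊞ v) f
    cone-vanishes {F} {f} van fv = vanish-conv (F ∪ (_≋ v)) f λ
      { x (inj₁ x∈) → van x x∈ ; x (inj₂ e) → trans (eval-cong f e) fv }

    zeros-kept : ∀ {f} → NonNeg Q f → 0# < f ⟪ v ⟫ → ∀ x → x ∈ Zeros (Q ⊞ v) f → x ∈ Zeros Q f
    zeros-kept {f} f≥0 fv x (x∈ , z) = convex x (conv-mono (Zeros Q∪v f) {Y = Q}
        (λ { y (inj₁ y∈ , _) → y∈ ; y (inj₂ e , z′) → ⊥-elim (pos⇒≉0 fv (trans (sym (eval-cong f e)) z′)) }) x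
        (conv-zeros Q∪v f (λ { y (inj₁ y∈) → f≥0 y y∈ ; y (inj₂ e) → nonneg-resp (sym (eval-cong f e)) (inj₁ fv) }) x x∈ z))
      , z

    zeros-coned : ∀ {f} → NonNeg Q f → f ⟪ v ⟫ ≈ 0# → ∀ x → x ∈ Zeros (Q ⊞ v) f → x ∈ Zeros Q f ⊞ v
    zeros-coned {f} f≥0 fv x (x∈ , z) = conv-mono (Zeros Q∪v f) {Y = Zeros Q f ∪ (_≋ v)}
      (λ { y (inj₁ y∈ , z′) → inj₁ (y∈ , z′) ; y (inj₂ e , _) → inj₂ e }) x
      (conv-zeros Q∪v f (λ { y (inj₁ y∈) → f≥0 y y∈ ; y (inj₂ e) → inj₂ (sym (trans (eval-cong f e) fv)) }) x x∈ z)

    Pos Neg : Subset → Set ℓ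
    Pos F = ∃[ f ] NonNeg Q f × Vanishes F f × 0# < f ⟪ v ⟫
    Neg F = ∃[ f ] NonNeg Q f × Vanishes F f × f ⟪ v ⟫ < 0#

    pos-resp-≐ : ∀ {F G} → F ≐ G → Pos F → Pos G
    pos-resp-≐ (i , j) (f , n , van , p) = f , n , (λ x x∈ → van x (j x∈)) , p

    neg-resp-≐ : ∀ {F G} → F ≐ G → Neg F → Neg G
    neg-resp-≐ (i , j) (f , n , van , p) = f , n , (λ x x∈ → van x (j x∈)) , p

    pos⇒v∉ : ∀ {F} → Pos F → ¬ v ∈ F
    pos⇒v∉ (f , _ , van , p) v∈ = pos⇒≉0 p (van v v∈)

    module _ {F : Subset} (face : Face Q F) where
      open Face face

      lift : ∀ f → Vanishes F f → ∃[ m ] 0# < m × NonNeg Q (m ⊙ support ⊕ f) × Vanishes F (m ⊙ support ⊕ f)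
      lift f van with exceed nonneg f (λ k z → inj₂ (sym (van _ (outside _ (corner∈ k , z)))))
      ... | m , m>0 , n = m , m>0 , n , λ x x∈ → trans (⊙⊕-eval m support f x) (+-zero (*-zeroʳ m (vanish x x∈)) (van x x∈))

      private
        lift-at : ∀ {f m} → support ⟪ v ⟫ ≈ 0# → (m ⊙ support ⊕ f) ⟪ v ⟫ ≈ f ⟪ v ⟫
        lift-at {f} {m} z = trans (⊙⊕-eval m support f v) (trans (+-congʳ (*-zeroʳ m z)) (+-identityˡ _))

      -- When the support is zero at `v`, multiples of it can be added without changing the value
      -- there. So any functional vanishing on `F` yields a witness, even one that takes both signs
      -- on `Q`; for such faces `Pos` and `Neg` are equivalent.
      opposite : support ⟪ v ⟫ ≈ 0# → ∀ f → Vanishes F f → (0# < f ⟪ v ⟫ → Pos F) × (f ⟪ v ⟫ < 0# → Neg F)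
      opposite z f van with lift f van
      ... | m , _ , n , van′ = (λ p → _ , n , van′ , pos-resp (sym (lift-at z)) p) , λ p → _ , n , van′ , neg-resp (sym (lift-at z)) p

      neg⇒pos : support ⟪ v ⟫ ≈ 0# → Neg F → Pos F
      neg⇒pos z (f , _ , van , f<0) = proj₁ (opposite z (⊖ f) λ x x∈ → ⊖-zero {f} (van x x∈))
        (pos-resp (sym (⊖-eval f v)) (neg⇒-pos f<0))

      pos⇒neg : support ⟪ v ⟫ ≈ 0# → Pos F → Neg F
      pos⇒neg z (f , _ , van , f>0) = proj₂ (opposite z (⊖ f) λ x x∈ → ⊖-zero {f} (van x x∈))
        (neg-resp (sym (⊖-eval f v)) (pos⇒-neg f>0))

      neither⇒null : ¬ Pos F → ¬ Neg F → support ⟪ v ⟫ ≈ 0#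
      neither⇒null ¬p ¬n = ≮0∧≯0⇒0 (λ n → ¬n (_ , nonneg , vanish , n)) (λ p → ¬p (_ , nonneg , vanish , p))

      -- A functional that vanishes on `F` and not at `v` would by `opposite` make `F` positive or
      -- negative.
      neither⇒flat : ¬ Pos F → ¬ Neg F → ∀ {n} → HasSize F n → HasSize (F ⊞ v) n
      neither⇒flat ¬p ¬n (p , p∈ , ind , fl) = p , (λ i → ⊆-cone {F} _ (p∈ i)) , ind , flat
        where
        v-flat : Flat p v
        v-flat f z = ≮0∧≯0⇒0 (λ n → ¬n (proj₂ both n)) (λ q → ¬p (proj₁ both q))
          where both = opposite (neither⇒null ¬p ¬n) f λ x x∈ → fl x x∈ f z
        flat : ∀ x → x ∈ F ⊞ v → Flat p x
        flat x x∈ f z = cone-vanishes {F} (λ y y∈ → fl y y∈ f z) (v-flat f z) x x∈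

      -- The functional witnessing `Pos F` may vanish beyond `F`. Adding the support makes the zero
      -- set exactly `F`, after the witness has been scaled up enough to keep the sum positive at
      -- `v`.
      kept-support : Pos F → ∃[ f ] NonNeg Q f × Vanishes F f × 0# < f ⟪ v ⟫ × (∀ x → x ∈ Zeros Q f → x ∈ F)
      kept-support (f , f≥0 , van , f>0) with inverse-pos f>0
      ... | i , i>0 , ei with 0≤? (support ⟪ v ⟫)
      ...   | yes s≥0 = f ⊕ support , (λ x x∈ → ⊕-nonneg (f≥0 x x∈) (nonneg x x∈))
                , (λ x x∈ → trans (⊕-eval f support x) (+-zero (van x x∈) (vanish x x∈)))
                , pos-resp (sym (⊕-eval f support v)) (pos+nonneg f>0 s≥0)
                , λ x (x∈ , z) → outside x (x∈ , proj₂ (⊕-zeros (f≥0 x x∈) (nonneg x x∈) z))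
      ...   | no s≱0 = m ⊙ f ⊕ support , (λ x x∈ → ⊕-nonneg (scaled x x∈) (nonneg x x∈))
                , (λ x x∈ → trans (⊙⊕-eval m f support x) (+-zero (*-zeroʳ m (van x x∈)) (vanish x x∈)))
                , pos-resp (sym (trans (⊙⊕-eval m f support v) value)) f>0
                , λ x (x∈ , z) → outside x (x∈ , proj₂ (⊕-zeros (scaled x x∈) (nonneg x x∈) z))
        where
        s = support ⟪ v ⟫
        s<0 : s < 0#
        s<0 with <0? s
        ... | yes n = n
        ... | no ¬n = ⊥-elim (s≱0 (≮0⇒nonneg ¬n))
        -- Chosen so that m f + support has at `v` the same value as `f`: the excess over 1 cancels
        -- the negative value `s`.
        m = 1# + - s * i
        m>0 : 0# < m
        m>0 = pos+nonneg 0<1 (inj₁ (*-pos (neg⇒-pos s<0) i>0))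
        scaled : NonNeg Q (m ⊙ f)
        scaled x x∈ = nonneg-resp (sym (⊙-eval m f x)) (nonneg*nonneg (inj₁ m>0) (f≥0 x x∈))
        value : m * f ⟪ v ⟫ + s ≈ f ⟪ v ⟫
        value = begin
          (1# + - s * i) * f ⟪ v ⟫ + s             ≈⟨ solve 4 (λ o s i f → (o :+ :- s :* i) :* f :+ s := o :* f :+ (s :+ :- (s :* (f :* i)))) refl 1# s i (f ⟪ v ⟫) ⟩
          1# * f ⟪ v ⟫ + (s + - (s * (f ⟪ v ⟫ * i))) ≈⟨ +-cong (*-identityˡ _) (+-congˡ (-‿cong (trans (*-congˡ ei) (*-identityʳ s)))) ⟩
          f ⟪ v ⟫ + (s + - s)                      ≈⟨ trans (+-congˡ (-‿inverseʳ s)) (+-identityʳ _) ⟩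
          f ⟪ v ⟫                                  ∎

      keep-face : Pos F → Face (Q ⊞ v) F
      keep-face p with kept-support p
      ... | f , f≥0 , van , f>0 , out = record
        { support = f ; nonneg = ext-nonneg f≥0 (inj₁ f>0)
        ; inside = λ x x∈ → old x (member x x∈) , van x x∈
        ; outside = λ x x∈ → out x (zeros-kept f≥0 f>0 x x∈) }

    Flush : Subset → Set ℓ
    Flush F = Σ (Face Q F) λ f → Face.support f ⟪ v ⟫ ≈ 0#

    -- The pivot of a negative witness and of the positive functional from `kept-support` is zero at
    -- `v`. Its zeros in `Q` are zeros of the latter, hence points of `F`.
    both⇒flush : ∀ {F} → Face Q F → Pos F → Neg F → Flush F
    both⇒flush {F} face p (n , n≥0 , n-van , n<0) with kept-support face p
    ... | f , f≥0 , van , f>0 , out = record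
        { support = pivot n f v
        ; nonneg = λ x x∈ → nonneg-resp (sym (pivot-eval n f v x)) (nonneg+nonneg (part₁ x x∈) (part₂ x x∈))
        ; inside = λ x x∈ → Face.member face x x∈
            , trans (pivot-eval n f v x) (+-zero (*-zeroʳ _ (van x x∈)) (*-zeroʳ _ (n-van x x∈)))
        ; outside = λ x (x∈ , z) → out x (x∈ , ≉0∧*≈0⇒≈0 (pos⇒≉0 (neg⇒-pos n<0))
            (proj₁ (nonneg+nonneg≈0 (part₁ x x∈) (part₂ x x∈) (trans (sym (pivot-eval n f v x)) z)))) }
      , pivot-at n f v
      where
      part₁ : ∀ x → x ∈ Q → 0# ≤ - (n ⟪ v ⟫) * f ⟪ x ⟫
      part₁ x x∈ = nonneg*nonneg (inj₁ (neg⇒-pos n<0)) (f≥0 x x∈)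
      part₂ : ∀ x → x ∈ Q → 0# ≤ f ⟪ v ⟫ * n ⟪ x ⟫
      part₂ x x∈ = nonneg*nonneg (inj₁ f>0) (n≥0 x x∈)

    neither⇒flush : ∀ {F} → Face Q F → ¬ Pos F → ¬ Neg F → Flush F
    neither⇒flush f ¬p ¬n = f , neither⇒null f ¬p ¬n

    cone-face : ∀ {F} → Flush F → Face (Q ⊞ v) (F ⊞ v)
    cone-face {F} (f , fv) = record
      { support = support ; nonneg = ext-nonneg nonneg (inj₂ (sym fv))
      ; inside = λ x x∈ → cone-⊆ member x x∈ , cone-vanishes {F} vanish fv x x∈
      ; outside = λ x x∈ → proj₁ (cone-cong {Zeros Q support} {F} ((λ {y} → outside y) , λ {y} → inside y)) (zeros-coned nonneg fv x x∈) }
      where open Face f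

    -- The support vanishes on the whole cone and cuts out exactly `F` in `Q`. Thus `F` can be
    -- recovered from its cone, which is why distinct bases have distinct cones.
    cone-base : ∀ {F} → Flush F → ∀ x → x ∈ Q → x ∈ F ⊞ v → x ∈ F
    cone-base {F} (f , fv) x x∈ x∈′ = Face.outside f x (x∈ , cone-vanishes {F} (Face.vanish f) fv x x∈′)

    cone-injective : ∀ {F G} → Flush F → Flush G → F ⊞ v ≐ G ⊞ v → F ≐ G
    cone-injective {F} {G} f g (i , j) =
        (λ {x} x∈ → cone-base g x (Face.member (proj₁ f) x x∈) (i (⊆-cone {F} x x∈)))
      , (λ {x} x∈ → cone-base f x (Face.member (proj₁ g) x x∈) (j (⊆-cone {G} x x∈)))

    neg⇒cone-size : ∀ {F n} → Neg F → HasSize F n → HasSize (F ⊞ v) (suc n)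
    neg⇒cone-size {F} (f , _ , van , f<0) (p , p∈ , ind , fl) =
      v ∷ᵛ p , (λ { zero → v∈cone {F} ; (suc i) → ⊆-cone {F} _ (p∈ i) })
      , independent-∷ f ind (λ i → van _ (p∈ i)) (neg⇒≉0 f<0)
      , λ x x∈ g z → cone-vanishes {F} (λ y y∈ → fl y y∈ g (z ∘ suc)) (z zero) x x∈

    face-decomposition : ∀ {F′} → Face (Q ⊞ v) F′ → ∃[ F ] Face Q F × ((Pos F × F′ ≐ F) ⊎ (Flush F × F′ ≐ F ⊞ v))
    face-decomposition {F′} f′ = Zeros Q support , face , by-value (nonneg-split (nonneg v new))
      where
      open Face f′
      n : NonNeg Q support
      n x x∈ = nonneg x (old x x∈)
      face : Face Q (Zeros Q support)
      face = record { support = support ; nonneg = n ; inside = λ x x∈ → x∈ ; outside = λ x x∈ → x∈ }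
      by-value : support ⟪ v ⟫ ≈ 0# ⊎ 0# < support ⟪ v ⟫ →
        (Pos (Zeros Q support) × F′ ≐ Zeros Q support) ⊎ (Flush (Zeros Q support) × F′ ≐ Zeros Q support ⊞ v)
      by-value (inj₂ v>0) = inj₁
        ( (support , n , (λ x → proj₂) , v>0)
        , (λ {x} x∈ → zeros-kept n v>0 x (inside x x∈))
        , λ {x} (x∈ , z) → outside x (old x x∈ , z) )
      by-value (inj₁ v≈0) = inj₂
        ( (face , v≈0)
        , (λ {x} x∈ → zeros-coned n v≈0 x (inside x x∈))
        , λ {x} x∈ → outside x (cone-⊆ {Zeros Q support} (λ y → proj₁) x x∈ , cone-vanishes {Zeros Q support} (λ y → proj₂) v≈0 x x∈) )

    face-size : ∀ {F} → Face Q F → ∃[ n ] HasSize F n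
    face-size f = let n , s = zeros-size (Face.nonneg f) in n , size-resp (Face.outside f) (Face.inside f) s

    private
      generators = facet-generators Qp
      hs = proj₁ generators
      facet : ∀ {h} → h ∈ˡ hs → Facet Q h
      facet = proj₁ (proj₂ generators)

      supporting : ∀ {F : Subset} {f} → (∀ x → x ∈ F → x ∈ Q) → NonNeg Q f → Vanishes F f →
        Cone (λ h → h ∈ˡ hs × Vanishes F h) f
      supporting F⊆ f≥0 van = cone-vanish (λ h∈ x x∈ → Facet.nonneg (facet h∈) x (F⊆ x x∈)) (proj₂ (proj₂ generators) _ f≥0) van

    pos⇒facet : ∀ {F} → (∀ x → x ∈ F → x ∈ Q) → Pos F → ∃[ h ] h ∈ˡ hs × Facet Q h × Vanishes F h × 0# < h ⟪ v ⟫
    pos⇒facet F⊆ (f , f≥0 , van , p) with cone-positive (supporting F⊆ f≥0 van) p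
    ... | h , (h∈ , hvan) , q = h , h∈ , facet h∈ , hvan , q

    neg⇒facet : ∀ {F} → (∀ x → x ∈ F → x ∈ Q) → Neg F → ∃[ h ] h ∈ˡ hs × Facet Q h × Vanishes F h × h ⟪ v ⟫ < 0#
    neg⇒facet F⊆ (f , f≥0 , van , p) with cone-negative (supporting F⊆ f≥0 van) p
    ... | h , (h∈ , hvan) , q = h , h∈ , facet h∈ , hvan , q

    module _ {F : Subset} (f : Face Q F) where
      open Face f

      private
        vanishes? : ∀ h → Dec (∀ k → support ⟪ corner k ⟫ ≈ 0# → h ⟪ corner k ⟫ ≈ 0#)
        vanishes? h = Fin.all? λ k → ((support ⟪ corner k ⟫) ≈0?) →-dec ((h ⟪ corner k ⟫) ≈0?)

        corners : ∀ {h} → Vanishes F h → ∀ k → support ⟪ corner k ⟫ ≈ 0# → h ⟪ corner k ⟫ ≈ 0#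
        corners van k z = van _ (outside _ (corner∈ k , z))

        everywhere : ∀ {h} → (∀ k → support ⟪ corner k ⟫ ≈ 0# → h ⟪ corner k ⟫ ≈ 0#) → Vanishes F h
        everywhere {h} z x x∈ = zeros-vanish nonneg h z x (inside x x∈)

      opaque

        -- By `pos⇒facet` a witness can be sought among the finitely many generators, and by
        -- `zeros-vanish` its vanishing on `F` can be tested at the corners of `F`.
        pos? : Dec (Pos F)
        pos? with Any.any? (λ h → vanishes? h ×-dec 0<? (h ⟪ v ⟫)) hs
        ... | yes a = let h , h∈ , z , p = find a in yes (h , Facet.nonneg (facet h∈) , everywhere z , p)
        ... | no ¬a = no λ p → let h , h∈ , _ , van , q = pos⇒facet member p in ¬a (lose h∈ (corners van , q))

        neg? : Dec (Neg F)
        neg? with Any.any? (λ h → vanishes? h ×-dec <0? (h ⟪ v ⟫)) hs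
        ... | yes a = let h , h∈ , z , p = find a in yes (h , Facet.nonneg (facet h∈) , everywhere z , p)
        ... | no ¬a = no λ p → let h , h∈ , _ , van , q = neg⇒facet member p in ¬a (lose h∈ (corners van , q))

-- Bijections between the faces before and after adding a point.

module FaceExchange {c ℓ₁ ℓ₂} (K : OrderedField c ℓ₁ ℓ₂) where

  open OrderedFieldProperties K
  open AffineFunctionals K
  open ConvexHulls K
  open DualCones K
  open FacetFunctionals K
  open AddingAPoint K

  module _ {a ℓ′} (B : Setoid a ℓ′) {n k δ : ℕ} where
    private module B = Setoid B

    -- The k indices in the image of g are reused for the first k new elements.
    exchange :
      (g : Fin k → Fin n) → (∀ {i j} → g i ≡ g j → i ≡ j) →
      (s : ∀ i → (∀ j → g j ≢ i) → B.Carrier) (t : Fin (k ℕ.+ δ) → B.Carrier) →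
      (∀ {i j p q} → s i p B.≈ s j q → i ≡ j) → (∀ {i p q} → s i p B.≈ s i q) →
      (∀ {i j} → t i B.≈ t j → i ≡ j) → (∀ {i j p} → ¬ s i p B.≈ t j) →
      (∀ b → (∃[ i ] ∃[ p ] s i p B.≈ b) ⊎ (∃[ j ] t j B.≈ b)) →
      Bijection (≡.setoid (Fin (n ℕ.+ δ))) B
    exchange g g-inj s t s-inj s-irr t-inj apart cover = record
      { to = to ; cong = λ { ≡.refl → B.refl } ; bijective = injective , surjective }
      where
      reuse : (i : Fin n) → Dec (∃[ j ] g j ≡ i) → B.Carrier
      reuse i (yes (j , _)) = t (j ↑ˡ δ)
      reuse i (no ¬g)       = s i λ j e → ¬g (j , e)
      g? : ∀ i → Dec (∃[ j ] g j ≡ i)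
      g? i = Fin.any? λ j → g j Fin.≟ i
      to⊎ : Fin n ⊎ Fin δ → B.Carrier
      to⊎ (inj₁ i) = reuse i (g? i)
      to⊎ (inj₂ e) = t (k ↑ʳ e)
      to : Fin (n ℕ.+ δ) → B.Carrier
      to = to⊎ ∘ splitAt n
      reuse-inj : ∀ {i j} d d′ → reuse i d B.≈ reuse j d′ → i ≡ j
      reuse-inj (yes (x , e)) (yes (y , e′)) q with Fin.↑ˡ-injective δ x y (t-inj q)
      ... | ≡.refl = ≡.trans (≡.sym e) e′
      reuse-inj (yes _) (no _)  q = ⊥-elim (apart (B.sym q))
      reuse-inj (no _)  (yes _) q = ⊥-elim (apart q)
      reuse-inj (no _)  (no _)  q = s-inj q
      reuse-extra : ∀ {i e} d → ¬ reuse i d B.≈ t (k ↑ʳ e)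
      reuse-extra {e = e} (yes (x , _)) q with ≡.trans (≡.sym (Fin.splitAt-↑ˡ k x δ)) (≡.trans (≡.cong (splitAt k) (t-inj q)) (Fin.splitAt-↑ʳ k δ e))
      ... | ()
      reuse-extra (no _) q = apart q
      to⊎-inj : ∀ x y → to⊎ x B.≈ to⊎ y → x ≡ y
      to⊎-inj (inj₁ i) (inj₁ j) q = ≡.cong inj₁ (reuse-inj (g? i) (g? j) q)
      to⊎-inj (inj₁ i) (inj₂ e) q = ⊥-elim (reuse-extra (g? i) q)
      to⊎-inj (inj₂ e) (inj₁ i) q = ⊥-elim (reuse-extra (g? i) (B.sym q))
      to⊎-inj (inj₂ e) (inj₂ f) q = ≡.cong inj₂ (Fin.↑ʳ-injective k e f (t-inj q))
      injective : ∀ {x y} → to x B.≈ to y → x ≡ y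
      injective {x} {y} q = ≡.trans (≡.sym (Fin.join-splitAt n δ x))
        (≡.trans (≡.cong (Fin.join n δ) (to⊎-inj (splitAt n x) (splitAt n y) q)) (Fin.join-splitAt n δ y))
      reuse-s : ∀ {i p} d → reuse i d B.≈ s i p
      reuse-s {p = p} (yes (j , e)) = ⊥-elim (p j e)
      reuse-s (no _) = s-irr
      reuse-t : ∀ j d → reuse (g j) d B.≈ t (j ↑ˡ δ)
      reuse-t j (yes (j′ , e)) = B.reflexive (≡.cong (λ x → t (x ↑ˡ δ)) (g-inj e))
      reuse-t j (no ¬g) = ⊥-elim (¬g (j , ≡.refl))
      hit : ∀ b → ∃[ x ] to⊎ x B.≈ b
      hit b with cover b
      ... | inj₁ (i , p , e) = inj₁ i , B.trans (reuse-s {p = p} (g? i)) e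
      ... | inj₂ (j , e) with splitAt k j in eq
      ...   | inj₁ j′ = inj₁ (g j′) , B.trans (reuse-t j′ (g? (g j′))) (B.trans (B.reflexive (≡.cong t (Fin.splitAt⁻¹-↑ˡ eq))) e)
      ...   | inj₂ e′ = inj₂ e′ , B.trans (B.reflexive (≡.cong t (Fin.splitAt⁻¹-↑ʳ eq))) e
      surjective : ∀ b → ∃[ x ] (∀ {z} → z ≡ x → to z B.≈ b)
      surjective b with hit b
      ... | x , e = Fin.join n δ x , λ { ≡.refl → B.trans (B.reflexive (≡.cong to⊎ (Fin.splitAt-join n δ x))) e }

  module _ {Q : Subset} (Qp : Poly Q) (v : Point) where
    open Extension Qp v

    -- The d-faces of Q that are lost, and the (d - 1)-faces whose cones over v are new d-faces.
    record Exchange (d k δ : ℕ) : Set (Level.suc ℓ) where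
      field
        gone          : Fin k → Subset
        gone-face     : ∀ j → Face Q (gone j)
        gone-size     : ∀ j → HasSize (gone j) (suc d)
        gone-inj      : ∀ {i j} → gone i ≐ gone j → i ≡ j
        gone-neg      : ∀ j → Neg (gone j)
        gone-¬pos     : ∀ j → ¬ Pos (gone j)
        gone-complete : ∀ {F} → Face Q F → HasSize F (suc d) → Neg F → ¬ Pos F → ∃[ j ] F ≐ gone j
        base          : Fin (k ℕ.+ δ) → Subset
        base-face     : ∀ j → Face Q (base j)
        base-size     : ∀ j → HasSize (base j) d
        base-inj      : ∀ {i j} → base i ≐ base j → i ≡ j
        base-neg      : ∀ j → Neg (base j)
        base-pos      : ∀ j → Pos (base j)
        base-complete : ∀ {F} → Face Q F → HasSize F d → Neg F → Pos F → ∃[ j ] F ≐ base j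

    module ExchangeFaces {d n k δ} (E : Exchange d k δ) (bij : Bijection (≡.setoid (Fin n)) (Faces d Q)) where
      open Exchange E
      F : Fin n → Subset
      F i = proj₁ (Bijection.to bij i)
      fc : ∀ i → Face Q (F i)
      fc i = isFace⇒face (proj₁ (proj₂ (Bijection.to bij i)))
      sz : ∀ i → HasSize (F i) (suc d)
      sz i = dim⇒size (proj₂ (proj₂ (Bijection.to bij i)))
      index : ∀ {G} → Face Q G → HasSize G (suc d) → ∃[ i ] F i ≐ G
      index {G} f z with Bijection.surjective bij (G , face⇒isFace f , size⇒dim z)
      ... | i , e = i , e ≡.refl
      g : Fin k → Fin n
      g j = proj₁ (index (gone-face j) (gone-size j))
      g-spec : ∀ j → F (g j) ≐ gone j
      g-spec j = proj₂ (index (gone-face j) (gone-size j))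
      g-inj : ∀ {i j} → g i ≡ g j → i ≡ j
      g-inj {i} {j} e = gone-inj (≐-trans (≐-sym (g-spec i)) (≡.subst (λ x → F x ≐ gone j) (≡.sym e) (g-spec j)))

      Survives : Subset → Subset → Set ℓ
      Survives G G′ = (Pos G × G′ ≐ G) ⊎ (¬ Pos G × ¬ Neg G × G′ ≐ G ⊞ v)

      NewFace : Subset → Set (Level.suc ℓ)
      NewFace G = ∃[ G′ ] Survives G (proj₁ {B = IsFaceOfDim d (Q ⊞ v)} G′)

      survive : ∀ {G} → Face Q G → HasSize G (suc d) → Dec (Pos G) → Dec (Neg G) → ¬ (¬ Pos G × Neg G) → NewFace G
      survive {G} f z (yes p) _ _ = (G , face⇒isFace (keep-face f p) , size⇒dim z) , inj₁ (p , ≐-refl)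
      survive {G} f z (no ¬p) (no ¬n) _ =
        (G ⊞ v , face⇒isFace (cone-face (neither⇒flush f ¬p ¬n)) , size⇒dim (neither⇒flat f ¬p ¬n z)) , inj₂ (¬p , ¬n , ≐-refl)
      survive f z (no ¬p) (yes n) ¬gone = ⊥-elim (¬gone (¬p , n))

      survivor : ∀ i → (∀ j → g j ≢ i) → NewFace (F i)
      survivor i away = survive (fc i) (sz i) (pos? (fc i)) (neg? (fc i)) λ (¬p , n) →
        let j , e = gone-complete (fc i) (sz i) n ¬p
        in away j (Bijection.injective bij (≐-trans (g-spec j) (≐-sym e)))
      s : ∀ i → (∀ j → g j ≢ i) → Setoid.Carrier (Faces d (Q ⊞ v))
      s i away = proj₁ (survivor i away)
      survival : ∀ i p → Survives (F i) (proj₁ (s i p))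
      survival i p = proj₂ (survivor i p)

      flush : ∀ j → Flush (base j)
      flush j = both⇒flush (base-face j) (base-pos j) (base-neg j)
      t : Fin (k ℕ.+ δ) → Setoid.Carrier (Faces d (Q ⊞ v))
      t j = base j ⊞ v , face⇒isFace (cone-face (flush j)) , size⇒dim (neg⇒cone-size (base-neg j) (base-size j))

      pos≢cone : ∀ {G} H → Pos G → ¬ G ≐ H ⊞ v
      pos≢cone H p (_ , j) = pos⇒v∉ p (j (v∈cone {H}))

      survives-inj : ∀ {G H G′ H′} → Face Q G → Face Q H → Survives G G′ → Survives H H′ → G′ ≐ H′ → G ≐ H
      survives-inj _ _ (inj₁ (_ , e)) (inj₁ (_ , e′)) q = ≐-trans (≐-sym e) (≐-trans q e′)
      survives-inj {H = H} _ _ (inj₁ (p , e)) (inj₂ (_ , _ , e′)) q = ⊥-elim (pos≢cone H p (≐-trans (≐-sym e) (≐-trans q e′)))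
      survives-inj {G} _ _ (inj₂ (_ , _ , e)) (inj₁ (p , e′)) q = ⊥-elim (pos≢cone G p (≐-trans (≐-sym e′) (≐-trans (≐-sym q) e)))
      survives-inj f h (inj₂ (¬p , ¬n , e)) (inj₂ (¬p′ , ¬n′ , e′)) q =
        cone-injective (neither⇒flush f ¬p ¬n) (neither⇒flush h ¬p′ ¬n′) (≐-trans (≐-sym e) (≐-trans q e′))

      survives-unique : ∀ {G G′ G″} → Survives G G′ → Survives G G″ → G′ ≐ G″
      survives-unique (inj₁ (_ , e)) (inj₁ (_ , e′)) = ≐-trans e (≐-sym e′)
      survives-unique (inj₁ (p , _)) (inj₂ (¬p , _)) = ⊥-elim (¬p p)
      survives-unique (inj₂ (¬p , _)) (inj₁ (p , _)) = ⊥-elim (¬p p)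
      survives-unique (inj₂ (_ , _ , e)) (inj₂ (_ , _ , e′)) = ≐-trans e (≐-sym e′)

      survives-apart : ∀ {G G′ H} → Face Q G → Survives G G′ → Flush H → Neg H → ¬ G′ ≐ H ⊞ v
      survives-apart {H = H} _ (inj₁ (p , e)) _ _ q = pos≢cone H p (≐-trans (≐-sym e) q)
      survives-apart f (inj₂ (¬p , ¬n , e)) h n q =
        ¬n (neg-resp-≐ (≐-sym (cone-injective (neither⇒flush f ¬p ¬n) h (≐-trans (≐-sym e) q))) n)

      survives-resp : ∀ {G H G′} → G ≐ H → Survives G G′ → Survives H G′
      survives-resp e (inj₁ (p , q)) = inj₁ (pos-resp-≐ e p , ≐-trans q e)
      survives-resp e (inj₂ (¬p , ¬n , q)) =
        inj₂ (¬p ∘ pos-resp-≐ (≐-sym e) , ¬n ∘ neg-resp-≐ (≐-sym e) , ≐-trans q (cone-cong e))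

      found : ∀ {G G′} → Face Q G → HasSize G (suc d) → ¬ (¬ Pos G × Neg G) → Survives G G′ →
        ∃[ i ] ∃[ p ] proj₁ (s i p) ≐ G′
      found {G} f z ¬gone S = i , away , survives-unique (survives-resp e (survival i away)) S
        where
        i : Fin n
        i = proj₁ (index f z)
        e : F i ≐ G
        e = proj₂ (index f z)
        away : ∀ j → g j ≢ i
        away j gj≡i = ¬gone (gone-¬pos j ∘ pos-resp-≐ G≐ , neg-resp-≐ (≐-sym G≐) (gone-neg j))
          where
          G≐ : G ≐ gone j
          G≐ = ≐-trans (≐-sym e) (≡.subst (λ x → F x ≐ gone j) gj≡i (g-spec j))

      -- For a flush face `Pos` and `Neg` are equivalent, so deciding `Neg` settles both. If it
      -- holds, the cone gains a dimension and its base is one of `base`; if not, the cone has the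
      -- dimension of an old face that survives as this cone.
      cover : ∀ (b : Setoid.Carrier (Faces d (Q ⊞ v))) → (∃[ i ] ∃[ p ] proj₁ (s i p) ≐ proj₁ b) ⊎ (∃[ j ] base j ⊞ v ≐ proj₁ b)
      cover (F′ , isface , dim) = by-decomposition (face-decomposition (isFace⇒face isface))
        where
        Covered : Set _
        Covered = (∃[ i ] ∃[ p ] proj₁ (s i p) ≐ F′) ⊎ (∃[ j ] base j ⊞ v ≐ F′)
        transport : ∀ {G} → F′ ≐ G → HasSize G (suc d)
        transport e = size-resp (λ x → proj₁ e) (λ x → proj₂ e) (dim⇒size dim)
        new-face : ∀ {G m} → Face Q G → Flush G → F′ ≐ G ⊞ v → HasSize G m → Neg G → Covered
        new-face {G} f fl e z n =
          let j , e′ = base-complete f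
                (≡.subst (HasSize G) (ℕ.suc-injective (size-unique (neg⇒cone-size n z) (transport e))) z)
                n (neg⇒pos (proj₁ fl) (proj₂ fl) n)
          in inj₂ (j , ≐-trans (cone-cong (≐-sym e′)) (≐-sym e))
        old-face : ∀ {G m} → Face Q G → Flush G → F′ ≐ G ⊞ v → HasSize G m → ¬ Neg G → Covered
        old-face {G} f fl e z ¬n = inj₁ (found f
            (≡.subst (HasSize G) (size-unique (neither⇒flat f ¬p ¬n z) (transport e)) z)
            (λ (_ , n) → ¬n n) (inj₂ (¬p , ¬n , e)))
          where
          ¬p : ¬ Pos G
          ¬p p = ¬n (pos⇒neg (proj₁ fl) (proj₂ fl) p)
        by-status : ∀ {G} → Face Q G → Flush G → F′ ≐ G ⊞ v → Dec (Neg G) → Covered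
        by-status f fl e (yes n) = new-face f fl e (proj₂ (face-size f)) n
        by-status f fl e (no ¬n) = old-face f fl e (proj₂ (face-size f)) ¬n
        by-decomposition : (∃[ G ] Face Q G × ((Pos G × F′ ≐ G) ⊎ (Flush G × F′ ≐ G ⊞ v))) → Covered
        by-decomposition (G , f , inj₁ (p , e)) = inj₁ (found f (transport e) (λ (¬p , _) → ¬p p) (inj₁ (p , e)))
        by-decomposition (G , f , inj₂ (fl , e)) = by-status f fl e (neg? f)

      bijection : Bijection (≡.setoid (Fin (n ℕ.+ δ))) (Faces d (Q ⊞ v))
      bijection = exchange (Faces d (Q ⊞ v)) g g-inj s t
        (λ {i} {j} {p} {q} e → Bijection.injective bij (survives-inj (fc i) (fc j) (survival i p) (survival j q) e))
        (λ {i} {p} {q} → survives-unique (survival i p) (survival i q))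
        (λ e → base-inj (cone-injective (flush _) (flush _) e))
        (λ {i} {j} {p} e → survives-apart (fc i) (survival i p) (flush j) (base-neg j) e)
        cover

-- Faces of visible simplices as sets of vertices.

module VisibleFaces {c ℓ₁ ℓ₂} (K : OrderedField c ℓ₁ ℓ₂) where

  open OrderedFieldProperties K
  open AffineFunctionals K
  open ConvexHulls K
  open DualCones K
  open FacetFunctionals K
  open AddingAPoint K
  open FaceExchange K
  open import Relation.Binary.Reasoning.Setoid setoid

  does-true : ∀ {p} {P : Set p} (P? : Dec P) → does P? ≡ true → P
  does-true (yes p) _ = p

  module Selections {n} (u : Vector Point n) (ind : Independent u) where

    Selected : Vec Bool n → Pred Point ℓ₁
    Selected J x = ∃[ i ] J ∋ i × x ≋ u i

    span : Vec Bool n → Subset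
    span J = conv (Selected J)

    ∈-span : ∀ J i → J ∋ i → u i ∈ span J
    ∈-span J i i∈ = ∈-conv (Selected J) (u i) (i , i∈ , ≋-refl)

    span-nonneg : ∀ {J f} → (∀ i → J ∋ i → 0# ≤ f ⟪ u i ⟫) → NonNeg (span J) f
    span-nonneg {J} {f} h = nonneg-conv (Selected J) f λ x (i , i∈ , e) → nonneg-resp (sym (eval-cong f e)) (h i i∈)

    span-vanish : ∀ {J f} → (∀ i → J ∋ i → f ⟪ u i ⟫ ≈ 0#) → Vanishes (span J) f
    span-vanish {J} {f} h = vanish-conv (Selected J) f λ x (i , i∈ , e) → trans (eval-cong f e) (h i i∈)

    span-⊆ : ∀ {J} {Q : Subset} → (∀ x → x ∈ conv Q → x ∈ Q) → (∀ i → J ∋ i → u i ∈ Q) → ∀ x → x ∈ span J → x ∈ Q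
    span-⊆ {J} {Q} convex h x x∈ = convex x (conv-bind (Selected J) Q
      (λ y (i , i∈ , e) → conv-resp Q (≋-sym e) (∈-conv Q (u i) (h i i∈))) x x∈)

    span-zeros : ∀ {J L f} → (∀ i → L ∋ i → 0# ≤ f ⟪ u i ⟫) → (∀ i → L ∋ i → f ⟪ u i ⟫ ≈ 0# → J ∋ i) →
      ∀ x → x ∈ span L → f ⟪ x ⟫ ≈ 0# → x ∈ span J
    span-zeros {J} {L} {f} f≥0 h x x∈ z = conv-mono (λ y → y ∈ Selected L × f ⟪ y ⟫ ≈ 0#) {Y = Selected J}
      (λ y ((i , i∈ , e) , z′) → i , h i i∈ (trans (sym (eval-cong f e)) z′) , e) x
      (conv-zeros (Selected L) f (λ y (i , i∈ , e) → nonneg-resp (sym (eval-cong f e)) (f≥0 i i∈)) x x∈ z)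

    span-size : ∀ J → HasSize (span J) (card J)
    span-size J = u ∘ element J , (λ k → ∈-span J _ (element∈ J k)) , independent-∘ (element J) (element-injective J) ind
      , λ x x∈ f z → span-vanish {J} (λ i i∈ → let k , e = element-surjective J i i∈ in
          trans (reflexive (≡.cong (λ i → f ⟪ u i ⟫) (≡.sym e))) (z k)) x x∈

    span-injective : ∀ J L → span J ≐ span L → J ≡ L
    span-injective J L (i , j) = ⊑-antisym (half J L i) (half L J j)
      where
      half : ∀ J L → span J ⊆ span L → J ⊑ L
      half J L J⊆L i i∈ with L ∋? i
      ... | yes i∈L = i∈L
      ... | no i∉L = let φ , one , rest = ind i in ⊥-elim (0#≉1# (trans
        (sym (span-vanish {L} (λ k k∈ → rest k λ { ≡.refl → i∉L k∈ }) (u i) (J⊆L (∈-span J i i∈)))) one))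

    private
      weight : Vec Bool n → Vector Carrier n
      weight J i = if lookup J i then 0# else 1#

    -- The sum of the dual functionals of the vertices outside `J`: it is 0 at the vertices in `J`
    -- and 1 at the others.
    away : Vec Bool n → AffineFunctional
    away J = linear-combination (weight J) (proj₁ ∘ ind)

    private
      away-eval : ∀ J i → away J ⟪ u i ⟫ ≈ weight J i
      away-eval J i = begin
        away J ⟪ u i ⟫
          ≈⟨ linear-combination-eval (weight J) (proj₁ ∘ ind) (u i) ⟩
        sum (λ k → weight J k * proj₁ (ind k) ⟪ u i ⟫)
          ≈⟨ sum-single (λ k → weight J k * proj₁ (ind k) ⟪ u i ⟫) i
               (λ k k≢i → *-zeroʳ (weight J k) (proj₂ (proj₂ (ind k)) i (k≢i ∘ ≡.sym))) ⟩
        weight J i * proj₁ (ind i) ⟪ u i ⟫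
          ≈⟨ trans (*-congˡ (proj₁ (proj₂ (ind i)))) (*-identityʳ _) ⟩
        weight J i ∎

    away-nonneg : ∀ J i → 0# ≤ away J ⟪ u i ⟫
    away-nonneg J i = nonneg-resp (sym (away-eval J i)) (weight-nonneg (lookup J i))
      where
      weight-nonneg : ∀ b → 0# ≤ (if b then 0# else 1#)
      weight-nonneg true  = inj₂ refl
      weight-nonneg false = inj₁ 0<1

    away-zero : ∀ J i → J ∋ i → away J ⟪ u i ⟫ ≈ 0#
    away-zero J i i∈ = trans (away-eval J i) (reflexive (≡.cong (if_then 0# else 1#) i∈))

    away-zero⁻¹ : ∀ J i → away J ⟪ u i ⟫ ≈ 0# → J ∋ i
    away-zero⁻¹ J i z = weight-zero (lookup J i) (trans (sym (away-eval J i)) z)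
      where
      weight-zero : ∀ b → (if b then 0# else 1#) ≈ 0# → b ≡ true
      weight-zero true  _ = ≡.refl
      weight-zero false e = ⊥-elim (0#≉1# (sym e))

    module _ {Q : Subset} (Qp : Poly Q) (u∈ : ∀ i → u i ∈ Q) where
      open Poly Qp

      -- A face of a simplex facet is a face of `Q`. The functional `away J` cuts it out of the
      -- simplex, and a multiple of `t` makes it nonnegative on the rest of `Q`.
      span-face : ∀ {J L t} → NonNeg Q t → (∀ i → L ∋ i → t ⟪ u i ⟫ ≈ 0#) → (∀ x → x ∈ Zeros Q t → x ∈ span L) →
        J ⊑ L → Face Q (span J)
      span-face {J} {L} {t} t≥0 t-van t-zeros J⊑L = record
        -- The functional `s` may also vanish at points of `Q` off the facet; the extra summand `t`
        -- excludes them.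
        { support = t ⊕ s
        ; nonneg = λ x x∈ → ⊕-nonneg (t≥0 x x∈) (s≥0 x x∈)
        ; inside = λ x x∈ → span-⊆ {J} {Q} convex (λ i _ → u∈ i) x x∈
            , span-vanish {J} (λ i i∈ → trans (⊕-eval t s (u i)) (+-zero (t-van i (J⊑L i i∈))
                (trans (⊙⊕-eval m t φ (u i)) (+-zero (*-zeroʳ m (t-van i (J⊑L i i∈))) (away-zero J i i∈))))) x x∈
        ; outside = λ x (x∈ , z) → let tz , sz = ⊕-zeros (t≥0 x x∈) (s≥0 x x∈) z in
            span-zeros {J} {L} (λ i _ → away-nonneg J i) (λ i _ → away-zero⁻¹ J i) x (t-zeros x (x∈ , tz))
              (trans (sym (trans (⊙⊕-eval m t φ x) (trans (+-congʳ (*-zeroʳ m tz)) (+-identityˡ _)))) sz) }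
        where
        φ = away J
        exceeding = exceed t≥0 φ λ k z → span-nonneg {L} (λ i _ → away-nonneg J i) _ (t-zeros _ (corner∈ k , z))
        m = proj₁ exceeding
        s = m ⊙ t ⊕ φ
        s≥0 : NonNeg Q s
        s≥0 = proj₂ (proj₂ exceeding)

      -- Take the vertices in `L` at which the support is zero; by `conv-zeros` they span all of its
      -- zeros in the simplex.
      face-in-span : ∀ {F L} → Face Q F → (∀ x → x ∈ F → x ∈ span L) → ∃[ J ] J ⊑ L × F ≐ span J
      face-in-span {F} {L} f F⊆ = J , (λ i i∈ → proj₁ (J-sound i i∈))
        , (λ {x} x∈ → span-zeros {J} {L} (λ i _ → nonneg (u i) (u∈ i)) J-complete x (F⊆ x x∈) (vanish x x∈))
        , (λ {x} x∈ → outside x ( span-⊆ {J} {Q} convex (λ i _ → u∈ i) x x∈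
                                , span-vanish {J} (λ i i∈ → proj₂ (J-sound i i∈)) x x∈))
        where
        open Face f
        on? : ∀ i → Dec (L ∋ i × support ⟪ u i ⟫ ≈ 0#)
        on? i = (L ∋? i) ×-dec ((support ⟪ u i ⟫) ≈0?)
        J : Vec Bool n
        J = Vec.tabulate (does ∘ on?)
        J-sound : ∀ i → J ∋ i → L ∋ i × support ⟪ u i ⟫ ≈ 0#
        J-sound i i∈ = does-true (on? i) (≡.trans (≡.sym (Vec.lookup∘tabulate (does ∘ on?) i)) i∈)
        J-complete : ∀ i → L ∋ i → support ⟪ u i ⟫ ≈ 0# → J ∋ i
        J-complete i i∈ z = ≡.trans (Vec.lookup∘tabulate (does ∘ on?) i) (dec-true (on? i) (i∈ , z))

  record Adds (Q Q′ : Subset) (δ : Vec ℕ 4) : Set (Level.suc ℓ) where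
    constructor adds
    field
      apply : ∀ f → HasFVector Q f → HasFVector Q′ (zipWith ℕ._+_ f δ)

  infixl 4 _⨾_
  _⨾_ : ∀ {Q Q′ Q″ a b} → Adds Q Q′ a → Adds Q′ Q″ b → Adds Q Q″ (zipWith ℕ._+_ a b)
  _⨾_ {Q″ = Q″} {a} {b} (adds p) (adds q) = adds λ f H →
    ≡.subst (HasFVector Q″) (Vec.zipWith-assoc ℕ.+-assoc f a b) (q (zipWith ℕ._+_ f a) (p f H))

  Within Containing : ∀ {n} → Vec Bool n → List (Vec Bool n) → Set
  Within J Ls = Any (J ⊑_) Ls
  Containing J Ms = Any (_⊑ J) Ms

  module _ {n} (negs poss : List (Vec Bool n)) where

    gone? : ∀ s (J : Vec Bool n) → Dec (Within J negs × ¬ Within J poss × card J ≡ s)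
    gone? s J = Any.any? (J ⊑?_) negs ×-dec ¬? (Any.any? (J ⊑?_) poss) ×-dec (card J ℕ.≟ s)

    base? : ∀ s (J : Vec Bool n) → Dec (Within J negs × Within J poss × card J ≡ s)
    base? s J = Any.any? (J ⊑?_) negs ×-dec Any.any? (J ⊑?_) poss ×-dec (card J ℕ.≟ s)

    goneSets baseSets : ℕ → List (Vec Bool n)
    goneSets s = List.filter (gone? s) (subsets n)
    baseSets s = List.filter (base? s) (subsets n)

    -- Sets are counted by size, one more than dimension: bases of size i have cones of dimension i,
    -- and lost faces of dimension i have size i + 1. For i = 0 the base is the empty set and its
    -- cone is the new vertex.
    Balanced : Vec ℕ 4 → Set
    Balanced δ = ∀ (i : Fin 4) →
      List.length (baseSets (toℕ i)) ≡ List.length (goneSets (suc (toℕ i))) ℕ.+ lookup δ i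

  -- The faces of Q seen from v are the faces of the simplices spanned by the sets in negs.
  -- Those within a set in poss stay and are coned over; those containing a set in nons vanish.
  record Visibility (Q : Subset) (v : Point) {n} (u : Vector Point n) (ind : Independent u)
    (negs poss nons : List (Vec Bool n)) : Set ℓ where
    open Selections u ind
    field
      neg-facet    : ∀ {L} → L ∈ˡ negs → ∃[ t ] NonNeg Q t × (∀ i → L ∋ i → t ⟪ u i ⟫ ≈ 0#) ×
                     (∀ x → x ∈ Zeros Q t → x ∈ span L) × t ⟪ v ⟫ < 0#
      neg-complete : ∀ {h} → Facet Q h → h ⟪ v ⟫ < 0# → ∃[ L ] L ∈ˡ negs × (∀ x → x ∈ Zeros Q h → x ∈ span L)
      pos-facet    : ∀ {L} → L ∈ˡ poss → ∃[ f ] NonNeg Q f × (∀ i → L ∋ i → f ⟪ u i ⟫ ≈ 0#) × 0# < f ⟪ v ⟫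
      non-facet    : ∀ {M} → M ∈ˡ nons → ∀ {h} → Facet Q h → (∀ i → M ∋ i → h ⟪ u i ⟫ ≈ 0#) → ¬ 0# < h ⟪ v ⟫
      covered      : ∀ J → Within J negs → Within J poss ⊎ Containing J nons

  module _ {Q : Subset} (Qp : Poly Q) (v : Point) {n} (u : Vector Point n) (ind : Independent u)
    (u∈ : ∀ i → u i ∈ Q) {negs poss nons : List (Vec Bool n)} (V : Visibility Q v u ind negs poss nons) where
    open Poly Qp using (convex)
    open Extension Qp v
    open Selections u ind
    open Visibility V

    private
      in-Q : ∀ J x → x ∈ span J → x ∈ Q
      in-Q J = span-⊆ {J} {Q} convex λ i _ → u∈ i

      status-face : ∀ J → Within J negs → Face Q (span J)
      status-face J w = let L , L∈ , J⊑L = find w ; t , t≥0 , t-van , t-zeros , _ = neg-facet L∈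
                      in span-face Qp u∈ {J} {L} t≥0 t-van t-zeros J⊑L

      status-neg : ∀ J → Within J negs → Neg (span J)
      status-neg J w = let L , L∈ , J⊑L = find w ; t , t≥0 , t-van , _ , t<0 = neg-facet L∈
                         in t , t≥0 , span-vanish {J} (λ i i∈ → t-van i (J⊑L i i∈)) , t<0

      status-pos : ∀ J → Within J poss → Pos (span J)
      status-pos J w = let L , L∈ , J⊑L = find w ; f , f≥0 , f-van , f>0 = pos-facet L∈
                         in f , f≥0 , span-vanish {J} (λ i i∈ → f-van i (J⊑L i i∈)) , f>0

      status-¬pos : ∀ J → Containing J nons → ¬ Pos (span J)
      status-¬pos J w p = let M , M∈ , M⊑J = find w ; h , _ , hF , h-van , h>0 = pos⇒facet (in-Q J) p
                            in non-facet M∈ hF (λ i i∈ → h-van (u i) (∈-span J i (M⊑J i i∈))) h>0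

      -- A negative face lies in the zero set of a facet functional that is negative at `v`, hence
      -- in one of the listed simplices, and there it is spanned by vertices.
      shape : ∀ {F} → Face Q F → Neg F → ∃[ J ] Within J negs × F ≐ span J
      shape f n = let h , _ , hF , h-van , h<0 = neg⇒facet (Face.member f) n
                      L , L∈ , zeros⊆ = neg-complete hF h<0
                      J , J⊑L , e = face-in-span Qp u∈ {L = L} f λ x x∈ → zeros⊆ x (Face.member f x x∈ , h-van x x∈)
                  in J , lose L∈ J⊑L , e

      card-shape : ∀ {F : Subset} {s} J → HasSize F s → F ≐ span J → card J ≡ s
      card-shape J z (i , j) = size-unique (span-size J) (size-resp (λ _ → i) (λ _ → j) z)

      module _ (d : ℕ) where
        goneList = goneSets negs poss (suc d)
        baseList = baseSets negs poss d

        gone-spec : ∀ j → let J = List.lookup goneList j in Within J negs × ¬ Within J poss × card J ≡ suc d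
        gone-spec j = proj₂ (∈-filter⁻ (gone? negs poss (suc d)) {xs = subsets n} (∈-lookup {xs = goneList} j))

        base-spec : ∀ j → let J = List.lookup baseList j in Within J negs × Within J poss × card J ≡ d
        base-spec j = proj₂ (∈-filter⁻ (base? negs poss d) {xs = subsets n} (∈-lookup {xs = baseList} j))

        exchange-data : ∀ {δ} → List.length baseList ≡ List.length goneList ℕ.+ δ → Exchange Qp v d (List.length goneList) δ
        exchange-data {δ} eq = record
          { gone = λ j → span (G j)
          ; gone-face = λ j → status-face (G j) (proj₁ (gone-spec j))
          ; gone-size = λ j → ≡.subst (HasSize (span (G j))) (proj₂ (proj₂ (gone-spec j))) (span-size (G j))
          ; gone-inj = λ {i} {j} e → unique-lookup (Unique.filter⁺ (gone? negs poss (suc d)) (subsets-unique n)) (span-injective (G i) (G j) e)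
          ; gone-neg = λ j → status-neg (G j) (proj₁ (gone-spec j))
          ; gone-¬pos = λ j → gone-¬pos′ (G j) (proj₁ (gone-spec j)) (proj₁ (proj₂ (gone-spec j)))
          ; gone-complete = gone-complete′
          ; base = λ j → span (B j)
          ; base-face = λ j → status-face (B j) (proj₁ (base-spec (back j)))
          ; base-size = λ j → ≡.subst (HasSize (span (B j))) (proj₂ (proj₂ (base-spec (back j)))) (span-size (B j))
          ; base-inj = λ {i} {j} e → back-inj (unique-lookup (Unique.filter⁺ (base? negs poss d) (subsets-unique n)) (span-injective (B i) (B j) e))
          ; base-neg = λ j → status-neg (B j) (proj₁ (base-spec (back j)))
          ; base-pos = λ j → status-pos (B j) (proj₁ (proj₂ (base-spec (back j))))
          ; base-complete = base-complete′
          }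
          where
          back : Fin (List.length goneList ℕ.+ δ) → Fin (List.length baseList)
          back = Fin.cast (≡.sym eq)
          G : Fin (List.length goneList) → Vec Bool n
          G = List.lookup goneList
          B : Fin (List.length goneList ℕ.+ δ) → Vec Bool n
          B = List.lookup baseList ∘ back
          back-inj : ∀ {i j} → back i ≡ back j → i ≡ j
          back-inj {i} {j} e = ≡.trans (≡.sym (Fin.cast-involutive eq (≡.sym eq) i))
            (≡.trans (≡.cong (Fin.cast eq) e) (Fin.cast-involutive eq (≡.sym eq) j))
          gone-¬pos′ : ∀ J → Within J negs → ¬ Within J poss → ¬ Pos (span J)
          gone-¬pos′ J w ¬w with covered J w
          ... | inj₁ w′ = ⊥-elim (¬w w′)
          ... | inj₂ m  = status-¬pos J m
          gone-complete′ : ∀ {F} → Face Q F → HasSize F (suc d) → Neg F → ¬ Pos F →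
            ∃[ j ] F ≐ span (List.lookup goneList j)
          gone-complete′ {F} f z n ¬p =
            let J , w , e = shape f n
                J∈ = ∈-filter⁺ (gone? negs poss (suc d)) (∈-subsets J)
                       (w , (λ w′ → ¬p (pos-resp-≐ (≐-sym e) (status-pos J w′))) , card-shape J z e)
            in Any.index J∈ , ≡.subst (λ L → F ≐ span L) (Any.lookup-index J∈) e
          base-complete′ : ∀ {F} → Face Q F → HasSize F d → Neg F → Pos F →
            ∃[ j ] F ≐ span (List.lookup baseList (back j))
          base-complete′ {F} f z n p =
            let J , w , e = shape f n
                J∈ = ∈-filter⁺ (base? negs poss d) (∈-subsets J) (w , within J w e , card-shape J z e)
            in Fin.cast eq (Any.index J∈)
             , ≡.subst (λ i → F ≐ span (List.lookup baseList i)) (≡.sym (Fin.cast-involutive (≡.sym eq) eq (Any.index J∈)))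
                 (≡.subst (λ L → F ≐ span L) (Any.lookup-index J∈) e)
            where
            within : ∀ J → Within J negs → F ≐ span J → Within J poss
            within J w e with covered J w
            ... | inj₁ w′ = w′
            ... | inj₂ m  = ⊥-elim (status-¬pos J m (pos-resp-≐ e p))

    stack-f-vector : ∀ {δ} → Balanced negs poss δ → Adds Q (Q ⊞ v) δ
    stack-f-vector {δ} balanced = adds λ f H i →
      ≡.subst (λ m → Bijection (≡.setoid (Fin m)) (Faces (toℕ i) (Q ⊞ v)))
        (≡.sym (Vec.lookup-zipWith ℕ._+_ i f δ)) (ExchangeFaces.bijection Qp v (exchange-data (toℕ i) (balanced i)) (H i))

-- From membership in a region to signs of facet functionals.

module RegionSigns {c ℓ₁ ℓ₂} (K : OrderedField c ℓ₁ ℓ₂) where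

  open OrderedFieldProperties K
  open AffineFunctionals K
  open ConvexHulls K
  open DualCones K
  open FacetFunctionals K
  open AddingAPoint K
  open VisibleFaces K
  open import Relation.Binary.Reasoning.Setoid setoid

  simplex : ∀ {n} → Vector Point n → Subset
  simplex u = conv (Range u)

  hull-tabulate : ∀ {n} (u : Vector Point n) → hull (List.tabulate u) ≐ simplex u
  hull-tabulate u =
      (λ {x} → conv-mono _ {Y = Range u} (λ y y∈ → SetoidMembership.∈-tabulate⁻ pointSetoid y∈) x)
    , (λ {x} → conv-mono (Range u) (λ y (i , e) → SetoidMembership.∈-resp-≈ pointSetoid (≋-sym e)
        (SetoidMembership.∈-tabulate⁺ pointSetoid i)) x)

  simplex-size : ∀ {n} {u : Vector Point n} → Independent u → HasSize (simplex u) n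
  simplex-size {u = u} ind = u , (λ i → ∈-conv (Range u) (u i) (∈-Range u i)) , ind
    , λ x x∈ f z → vanish-conv (Range u) f (vanish-Range f z) x x∈

  record Simplex (Q : Subset) (t : AffineFunctional) (u : Vector Point 4) : Set ℓ where
    field
      nonneg      : NonNeg Q t
      u∈          : ∀ i → u i ∈ Q
      null-at     : ∀ i → t ⟪ u i ⟫ ≈ 0#
      independent : Independent u
      zeros⊆      : ∀ x → x ∈ Zeros Q t → x ∈ simplex u
      witness     : Point
      witness∈    : witness ∈ Q
      witness-pos : 0# < t ⟪ witness ⟫

    facet : Facet Q t
    facet = record
      { nonneg = nonneg ; zeros = u ; zeros∈ = u∈ ; zeros-null = null-at ; zeros-ind = independent
      ; witness = witness ; witness∈ = witness∈ ; witness-pos = witness-pos }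

  -- A zero of `h` off the hyperplane of `t` would be a fifth independent zero besides the vertices
  -- `u`, and `h` would vanish identically.
  facet-zeros : ∀ {Q t u h} → Simplex Q t u → Facet Q h → (∀ i → h ⟪ u i ⟫ ≈ 0#) → ∀ x → x ∈ Zeros Q h → x ∈ Zeros Q t
  facet-zeros {t = t} {h = h} S F z x (x∈ , hx) with (t ⟪ x ⟫) ≈0?
  ... | yes tx = x∈ , tx
  ... | no ¬tx = ⊥-elim (pos⇒≉0 (Facet.witness-pos F)
    (independent-zeros {h = h} {t} (Simplex.independent S) z (Simplex.null-at S) hx ¬tx _))

  module _ {Q : Subset} {h : AffineFunctional} (F : Facet Q h) where
    open Facet F

    facet-size : HasSize (Zeros Q h) 4
    facet-size = zeros , (λ i → zeros∈ i , zeros-null i) , zeros-ind , flat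
      where
      flat : ∀ x → x ∈ Zeros Q h → Flat zeros x
      flat x (_ , hx) with flat-or-separate zeros x
      ... | inj₁ fl = fl
      ... | inj₂ (f , fz , fx) = ⊥-elim (pos⇒≉0 witness-pos (independent-zeros {h = h} {f} zeros-ind zeros-null fz hx fx witness))

    isFacet : IsFacet Q (Zeros Q h)
    isFacet = face⇒isFace (record { support = h ; nonneg = nonneg ; inside = λ x x∈ → x∈ ; outside = λ x x∈ → x∈ })
      , size⇒dim facet-size

    vanish-on-aff : ∀ x → x ∈ aff (Zeros Q h) → h ⟪ x ⟫ ≈ 0#
    vanish-on-aff = vanish-aff {X = Zeros Q h} h λ _ → proj₂

    -- `H⁺` and `H⁻` supply a functional of their own choice, so it has to be compared with `h`.
    -- Both vanish on the affine hull of the facet, and the interior side is fixed by `witness`,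
    -- which determines the factor.
    orientation-scale : ∀ {h′} → Orients Q (Zeros Q h) h′ → ∃[ ρ ] 0# < ρ × (∀ x → h ⟪ x ⟫ ≈ ρ * h′ ⟪ x ⟫)
    orientation-scale {h′} (cut , h′≥0) with inverse-pos h′y>0
      where
      y = witness
      h′y>0 : 0# < h′ ⟪ y ⟫
      h′y>0 = nonneg∧≉0⇒pos (nonneg-resp (sym (⟪⟫≈⟨⟩ h′ y)) (h′≥0 y witness∈))
        λ z → pos⇒≉0 witness-pos (vanish-on-aff y (Equivalence.from (cut y) (trans (sym (⟪⟫≈⟨⟩ h′ y)) z)))
    ... | i , i>0 , ei = h ⟪ y ⟫ * i , *-pos witness-pos i>0 , scale
      where
      y = witness
      p = zeros zero
      scale : ∀ x → h ⟪ x ⟫ ≈ h ⟪ y ⟫ * i * h′ ⟪ x ⟫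
      scale x = begin
        h ⟪ x ⟫
          ≈⟨ solve 3 (λ x r y → x := (x :+ :- r :* y) :+ r :* y) refl (h ⟪ x ⟫) r (h ⟪ y ⟫) ⟩
        (h ⟪ x ⟫ + - r * h ⟪ y ⟫) + r * h ⟪ y ⟫
          ≈⟨ +-congʳ (trans (sym (trans (at h) (trans (+-congˡ (*-zeroʳ r (zeros-null zero))) (+-identityʳ _)))) hz) ⟩
        0# + r * h ⟪ y ⟫
          ≈⟨ trans (+-identityˡ _) (solve 3 (λ a i y → a :* i :* y := y :* i :* a) refl (h′ ⟪ x ⟫) i (h ⟪ y ⟫)) ⟩
        h ⟪ y ⟫ * i * h′ ⟪ x ⟫ ∎
        where
        r = h′ ⟪ x ⟫ * i
        weights : Vector Carrier 3
        -- The point z = x - r y + r p, with r the quotient of the values of `h′` at `x` and `y`,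
        -- moves `x` parallel to y - p into the hyperplane of `h′`. Hence z lies in the affine hull
        -- of the facet and `h` vanishes there too.
        weights = 1# ∷ᵛ - r ∷ᵛ r ∷ᵛ []ᵛ
        points : Vector Point 3
        points = x ∷ᵛ y ∷ᵛ p ∷ᵛ []ᵛ
        z : Point
        z = combination weights points
        at : ∀ f → f ⟪ z ⟫ ≈ (f ⟪ x ⟫ + - r * f ⟪ y ⟫) + r * f ⟪ p ⟫
        at f = begin
          f ⟪ z ⟫
            ≈⟨ eval-affine-combination f weights points {z} (trans (+-congˡ (trans (+-congˡ (+-identityʳ r)) (-‿inverseˡ r))) (+-identityʳ 1#)) ≋-refl ⟩
          1# * f ⟪ x ⟫ + (- r * f ⟪ y ⟫ + (r * f ⟪ p ⟫ + 0#))
            ≈⟨ +-cong (*-identityˡ _) (+-congˡ (+-identityʳ _)) ⟩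
          f ⟪ x ⟫ + (- r * f ⟪ y ⟫ + r * f ⟪ p ⟫)
            ≈⟨ sym (+-assoc _ _ _) ⟩
          (f ⟪ x ⟫ + - r * f ⟪ y ⟫) + r * f ⟪ p ⟫ ∎
        h′p : h′ ⟪ p ⟫ ≈ 0#
        h′p = trans (⟪⟫≈⟨⟩ h′ p) (Equivalence.to (cut p)
          (∈-aff p (zeros∈ zero , zeros-null zero)))
          where
          ∈-aff : ∀ x → x ∈ Zeros Q h → x ∈ aff (Zeros Q h)
          ∈-aff x x∈ = 1 , (λ _ → 1#) , (λ _ → x) , (λ _ → x∈) , +-identityʳ 1#
            , λ j → trans (+-identityʳ _) (*-identityˡ _)
        h′z : h′ ⟪ z ⟫ ≈ 0#
        h′z = begin
          h′ ⟪ z ⟫                                            ≈⟨ at h′ ⟩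
          (h′ ⟪ x ⟫ + - r * h′ ⟪ y ⟫) + r * h′ ⟪ p ⟫          ≈⟨ trans (+-congˡ (*-zeroʳ r h′p)) (+-identityʳ _) ⟩
          h′ ⟪ x ⟫ + - (h′ ⟪ x ⟫ * i) * h′ ⟪ y ⟫
            ≈⟨ solve 3 (λ a i y → a :+ :- (a :* i) :* y := a :+ :- (a :* (y :* i))) refl (h′ ⟪ x ⟫) i (h′ ⟪ y ⟫) ⟩
          h′ ⟪ x ⟫ + - (h′ ⟪ x ⟫ * (h′ ⟪ y ⟫ * i))            ≈⟨ +-congˡ (-‿cong (trans (*-congˡ ei) (*-identityʳ _))) ⟩
          h′ ⟪ x ⟫ + - (h′ ⟪ x ⟫)                             ≈⟨ -‿inverseʳ _ ⟩
          0#                                                  ∎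
        hz : h ⟪ z ⟫ ≈ 0#
        hz = vanish-on-aff z (Equivalence.from (cut z) (trans (sym (⟪⟫≈⟨⟩ h′ z)) h′z))

    H⁻⇒neg : ∀ {x} → x ∈ H⁻ Q (Zeros Q h) → h ⟪ x ⟫ < 0#
    H⁻⇒neg {x} (h′ , o , n) = let ρ , ρ>0 , e = orientation-scale o in
      neg-resp (sym (e x)) (pos*neg ρ>0 (neg-resp (sym (⟪⟫≈⟨⟩ h′ x)) n))

    H⁺⇒pos : ∀ {x} → x ∈ H⁺ Q (Zeros Q h) → 0# < h ⟪ x ⟫
    H⁺⇒pos {x} (h′ , o , p) = let ρ , ρ>0 , e = orientation-scale o in
      pos-resp (sym (e x)) (*-pos ρ>0 (pos-resp (sym (⟪⟫≈⟨⟩ h′ x)) p))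

  without : ∀ {n} → Fin n → Vec Bool n
  without zero    = false ∷ Vec.replicate _ true
  without (suc i) = true ∷ without i

  without-complete : ∀ {n} (i j : Fin n) → j ≢ i → without i ∋ j
  without-complete zero    zero    ne = ⊥-elim (ne ≡.refl)
  without-complete {suc n} zero (suc j) _ = full j
    where
    full : ∀ {n} (j : Fin n) → Vec.replicate n true ∋ j
    full zero    = ≡.refl
    full (suc j) = full j
  without-complete (suc i) zero    _  = ≡.refl
  without-complete (suc i) (suc j) ne = without-complete i j (ne ∘ ≡.cong suc)

  -- Neighbours of a simplex facet are indexed by the vertex opposite to the shared triangle. For an
  -- explicit `u` the list reduces to the ones written in the constructions, so their hypotheses
  -- apply as they stand.
  triangle : Vector Point 4 → Fin 4 → List Point
  triangle u i = List.tabulate (removeAt u i)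

  module _ {Q : Subset} (Qp : Poly Q) {T : Subset} {t u} (S : Simplex Q t u) (T≐ : T ≐ simplex u) where
    open Simplex S
    open Poly Qp using (convex)

    simplex⊆zeros : ∀ {h} → (∀ i → h ⟪ u i ⟫ ≈ 0#) → ∀ x → x ∈ simplex u → x ∈ Zeros Q h
    simplex⊆zeros {h} z x x∈ =
        convex x (conv-bind (Range u) Q (λ y (i , e) → conv-resp Q (≋-sym e) (∈-conv Q (u i) (u∈ i))) x x∈)
      , vanish-conv (Range u) h (vanish-Range h z) x x∈

    facet≐T : ∀ {h} → Facet Q h → (∀ i → h ⟪ u i ⟫ ≈ 0#) → Zeros Q h ≐ T
    facet≐T F z = (λ {x} x∈ → proj₂ T≐ (zeros⊆ x (facet-zeros S F z x x∈))) , (λ {x} x∈ → simplex⊆zeros z x (proj₁ T≐ x∈))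

    -- For a facet functional this is the pattern, read off at the four vertices, of the neighbour
    -- across the triangle opposite to `i`.
    Exactly : AffineFunctional → Fin 4 → Set (ℓ₁ ⊔ ℓ₂)
    Exactly h i = (∀ j → j ≢ i → h ⟪ u j ⟫ ≈ 0#) × 0# < h ⟪ u i ⟫

    exactly-nonneg : ∀ {h i} → Exactly h i → ∀ j → 0# ≤ h ⟪ u j ⟫
    exactly-nonneg {i = i} (z , p) j with j Fin.≟ i
    ... | yes ≡.refl = inj₁ p
    ... | no ne      = inj₂ (sym (z j ne))

    exactly-zeros : ∀ {h i} → Exactly h i → ∀ x → x ∈ simplex u → h ⟪ x ⟫ ≈ 0# → x ∈ simplex (removeAt u i)
    exactly-zeros {h} {i} ex x x∈ z = conv-mono (λ y → y ∈ Range u × h ⟪ y ⟫ ≈ 0#) {Y = Range (removeAt u i)} pick x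
      (conv-zeros (Range u) h (λ y (j , e) → nonneg-resp (sym (eval-cong h e)) (exactly-nonneg ex j)) x x∈ z)
      where
      pick : ∀ y → y ∈ Range u × h ⟪ y ⟫ ≈ 0# → y ∈ Range (removeAt u i)
      pick y ((j , e) , z′) with i Fin.≟ j
      ... | yes ≡.refl = ⊥-elim (pos⇒≉0 (proj₂ ex) (trans (sym (eval-cong h e)) z′))
      ... | no ne      = punchOut ne , ≡.subst (λ k → y ≋ u k) (≡.sym (Fin.punchIn-punchOut ne)) e

    facet∩T : ∀ {h i} → Facet Q h → Exactly h i → Zeros Q h ∩ T ≐ hull (triangle u i)
    facet∩T {h} {i} F ex =
        (λ {x} ((x∈ , z) , x∈T) → proj₂ (hull-tabulate (removeAt u i)) (exactly-zeros ex x (proj₁ T≐ x∈T) z))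
      , λ {x} x∈ → let x∈′ = proj₁ (hull-tabulate (removeAt u i)) x∈
                       x∈u = conv-mono (Range (removeAt u i)) {Y = Range u} (λ y (j , e) → punchIn i j , e) x x∈′
                   in (proj₁ (simplex⊆zeros null-at x x∈u)
                      , vanish-conv (Range (removeAt u i)) h (vanish-Range h λ j → proj₁ ex _ (Fin.punchInᵢ≢i i j)) x x∈′)
                     , proj₂ T≐ x∈u

    adjacent-T : ∀ {h i} → Facet Q h → Exactly h i → Adjacent Q (Zeros Q h) T
    adjacent-T {h} {i} F ex = face⇒isFace face , size⇒dim
        (size-resp (λ x x∈ → proj₂ (facet∩T F ex) (proj₂ (hull-tabulate (removeAt u i)) x∈))
                   (λ x x∈ → proj₁ (hull-tabulate (removeAt u i)) (proj₁ (facet∩T F ex) x∈))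
                   (simplex-size (independent-∘ (punchIn i) (Fin.punchIn-injective i _ _) independent)))
      where
      face : Face Q (Zeros Q h ∩ T)
      face = record
        { support = h ⊕ t
        ; nonneg = λ x x∈ → ⊕-nonneg (Facet.nonneg F x x∈) (nonneg x x∈)
        ; inside = λ x ((x∈ , z) , x∈T) → x∈
            , trans (⊕-eval h t x) (+-zero z (proj₂ (simplex⊆zeros null-at x (proj₁ T≐ x∈T))))
        ; outside = λ x (x∈ , z) → let hz , tz = ⊕-zeros (Facet.nonneg F x x∈) (nonneg x x∈) z
                                   in (x∈ , hz) , proj₂ T≐ (zeros⊆ x (x∈ , tz)) }

    exactly⇒across : ∀ {h i} is → Facet Q h → Exactly h i → i ∈ˡ is → Zeros Q h ∈ across Q T (List.map (triangle u) is)
    exactly⇒across is F ex i∈ = isFacet F , adjacent-T F ex , lose (∈-map⁺ (triangle u) i∈) (facet∩T F ex)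

    Separated : AffineFunctional → Fin 4 → Set ℓ₂
    Separated h i = ∃[ j ] j ≢ i × 0# < h ⟪ u j ⟫

    separated⇒not-across : ∀ {h} is → (∀ {i} → i ∈ˡ is → Separated h i) → ¬ Zeros Q h ∈ across Q T (List.map (triangle u) is)
    separated⇒not-across {h} is sep (_ , _ , a) =
      let _ , tri∈ , e = find a
          i , i∈ , tri≡ = ∈-map⁻ (triangle u) tri∈
      in refute i∈ (≡.subst (λ tri → Zeros Q h ∩ T ≐ hull tri) tri≡ e)
      where
      refute : ∀ {i} → i ∈ˡ is → ¬ Zeros Q h ∩ T ≐ hull (triangle u i)
      refute {i} i∈ (_ , e) = let j , ne , p = sep i∈ ; v = removeAt u i in pos⇒≉0 p (proj₂ (proj₁ (e (proj₂ (hull-tabulate v)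
        (≡.subst (λ k → u k ∈ simplex v) (Fin.punchIn-punchOut (ne ∘ ≡.sym)) (∈-conv (Range v) _ (∈-Range v (punchOut (ne ∘ ≡.sym)))))))))

    -- The clauses of `V` distinguish facets as subsets. Here the distinction is replaced by the
    -- pattern of zero and positive values at the vertices of `T`, which is decidable.
    module RegionRule (is js : List (Fin 4)) {v : Point}
      (v∈ : v ∈ Region Q T (List.map (triangle u) is) (List.map (triangle u) js)) where

      all-null⇒neg : ∀ {h} → Facet Q h → (∀ i → h ⟪ u i ⟫ ≈ 0#) → h ⟪ v ⟫ < 0#
      all-null⇒neg F z = H⁻⇒neg F (proj₁ (v∈ _ (isFacet F)) (facet≐T F z))

      simplex-neg : t ⟪ v ⟫ < 0#
      simplex-neg = all-null⇒neg facet null-at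

      exactly⇒null : ∀ {h i} → i ∈ˡ is → Facet Q h → Exactly h i → h ⟪ v ⟫ ≈ 0#
      exactly⇒null i∈ F ex = vanish-on-aff F v (proj₁ (proj₂ (proj₂ (v∈ _ (isFacet F)))) (exactly⇒across is F ex i∈))

      exactly⇒neg : ∀ {h i} → i ∈ˡ js → Facet Q h → Exactly h i → h ⟪ v ⟫ < 0#
      exactly⇒neg i∈ F ex = H⁻⇒neg F (proj₁ (proj₂ (v∈ _ (isFacet F))) (exactly⇒across js F ex i∈))

      separated⇒pos : ∀ {h} → Facet Q h → ∃[ j ] 0# < h ⟪ u j ⟫ → (∀ {i} → i ∈ˡ is List.++ js → Separated h i) → 0# < h ⟪ v ⟫
      separated⇒pos F (j , p) sep = H⁺⇒pos F (proj₂ (proj₂ (proj₂ (v∈ _ (isFacet F))))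
        (λ (_ , T⊆F) → pos⇒≉0 p (proj₂ (T⊆F (proj₂ T≐ (∈-conv (Range u) (u j) (∈-Range u j))))))
        (separated⇒not-across js (sep ∘ ∈-++⁺ʳ is)) (separated⇒not-across is (sep ∘ ∈-++⁺ˡ)))

      -- The vertex `u j` belongs to every listed triangle, because `j` is opposite to none of them.
      -- A facet missing it contains no listed triangle.
      pos-off : ∀ {h} → Facet Q h → ∀ j {_ : True (All.all? (λ i → ¬? (j Fin.≟ i)) (is List.++ js))} → 0# < h ⟪ u j ⟫ → 0# < h ⟪ v ⟫
      pos-off F j {off} p = separated⇒pos F (j , p) λ i∈ → j , All.lookup (toWitness off) i∈ , p

      -- Every triangle of `T` contains one of any two vertices, so a facet missing two of them
      -- contains no triangle at all, whichever are listed.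
      pos-two : ∀ {h} → Facet Q h → ∀ j k {_ : True (¬? (k Fin.≟ j))} → 0# < h ⟪ u j ⟫ → 0# < h ⟪ u k ⟫ → 0# < h ⟪ v ⟫
      pos-two {h} F j k {ne} p q = separated⇒pos F (j , p) λ {i} _ → choose i
        where
        choose : ∀ i → Separated h i
        choose i with j Fin.≟ i
        ... | no j≢i     = j , j≢i , p
        ... | yes ≡.refl = k , toWitness ne , q

      data Cases (h : AffineFunctional) : Set ℓ where
        all-null   : (∀ i → h ⟪ u i ⟫ ≈ 0#) → Cases h
        one-of-is  : ∀ i → i ∈ˡ is → Exactly h i → Cases h
        one-of-js  : ∀ i → i ∈ˡ js → Exactly h i → Cases h
        positive   : 0# < h ⟪ v ⟫ → Cases h

      -- If `h` is not zero at all vertices and no listed `i` is the only vertex with a positive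
      -- value, then for each listed `i` another vertex is positive, and the facet contains no
      -- listed triangle.
      region-cases : ∀ {h} → Facet Q h → Cases h
      region-cases {h} F with Fin.all? (λ i → (h ⟪ u i ⟫) ≈0?)
      ... | yes z = all-null z
      ... | no ¬z with Any.any? exactly? is | Any.any? exactly? js
        where
        exactly? : ∀ i → Dec (Exactly h i)
        exactly? i = Fin.all? (λ j → ¬? (j Fin.≟ i) →-dec ((h ⟪ u j ⟫) ≈0?)) ×-dec 0<? (h ⟪ u i ⟫)
      ...   | yes a | _     = let i , i∈ , ex = find a in one-of-is i i∈ ex
      ...   | no _  | yes a = let i , i∈ , ex = find a in one-of-js i i∈ ex
      ...   | no ¬a | no ¬b = positive (separated⇒pos F some λ {i} i∈ → separate i (away i∈))
        where
        h≥0 : ∀ j → 0# ≤ h ⟪ u j ⟫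
        h≥0 j = Facet.nonneg F (u j) (u∈ j)
        some : ∃[ j ] 0# < h ⟪ u j ⟫
        some with Fin.¬∀⟶∃¬ 4 _ (λ i → (h ⟪ u i ⟫) ≈0?) ¬z
        ... | j , nz = j , nonneg∧≉0⇒pos (h≥0 j) nz
        away : ∀ {i} → i ∈ˡ is List.++ js → ¬ Exactly h i
        away i∈ ex with Any.++⁻ is i∈
        ... | inj₁ i∈is = ¬a (lose i∈is ex)
        ... | inj₂ i∈js = ¬b (lose i∈js ex)
        separate : ∀ i → ¬ Exactly h i → Separated h i
        separate i ¬ex with Fin.any? (λ j → ¬? (j Fin.≟ i) ×-dec 0<? (h ⟪ u j ⟫))
        ... | yes s = s
        ... | no none = ⊥-elim (¬ex ((λ j ne → nonneg∧≯0⇒0 (h≥0 j) λ p → none (j , ne , p)) , only))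
          where
          only : 0# < h ⟪ u i ⟫
          only = let j , p = some in ≡.subst (λ j → 0# < h ⟪ u j ⟫) (same j p) p
            where
            same : ∀ j → 0# < h ⟪ u j ⟫ → j ≡ i
            same j p with j Fin.≟ i
            ... | yes e = e
            ... | no ne = ⊥-elim (none (j , ne , p))

-- New facets and face counts when a point sees one simplex facet.

module Stacking {c ℓ₁ ℓ₂} (K : OrderedField c ℓ₁ ℓ₂) where

  open OrderedFieldProperties K
  open AffineFunctionals K
  open ConvexHulls K
  open DualCones K
  open FacetFunctionals K
  open AddingAPoint K
  open VisibleFaces K
  open RegionSigns K
  open import Relation.Binary.Reasoning.Setoid setoid

  module _ {t g v} (tv : t ⟪ v ⟫ < 0#) (gv : 0# < g ⟪ v ⟫) where

    pivot-null : ∀ {x} → t ⟪ x ⟫ ≈ 0# → g ⟪ x ⟫ ≈ 0# → pivot t g v ⟪ x ⟫ ≈ 0#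
    pivot-null tx gx = trans (pivot-eval t g v _) (+-zero (*-zeroʳ _ gx) (*-zeroʳ _ tx))

    pivot-posˡ : ∀ {x} → 0# < t ⟪ x ⟫ → 0# ≤ g ⟪ x ⟫ → 0# < pivot t g v ⟪ x ⟫
    pivot-posˡ tx gx = pos-resp (sym (pivot-eval t g v _))
      (nonneg+pos (nonneg*nonneg (inj₁ (neg⇒-pos tv)) gx) (*-pos gv tx))

    pivot-posʳ : ∀ {x} → 0# ≤ t ⟪ x ⟫ → 0# < g ⟪ x ⟫ → 0# < pivot t g v ⟪ x ⟫
    pivot-posʳ tx gx = pos-resp (sym (pivot-eval t g v _))
      (pos+nonneg (*-pos (neg⇒-pos tv) gx) (nonneg*nonneg (inj₁ gv) tx))

    pivot-nonneg : ∀ {x} → 0# ≤ t ⟪ x ⟫ → 0# ≤ g ⟪ x ⟫ → 0# ≤ pivot t g v ⟪ x ⟫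
    pivot-nonneg tx gx = nonneg-resp (sym (pivot-eval t g v _))
      (nonneg+nonneg (nonneg*nonneg (inj₁ (neg⇒-pos tv)) gx) (nonneg*nonneg (inj₁ gv) tx))

    pivot-null⁻¹ : ∀ {x} → 0# ≤ t ⟪ x ⟫ → 0# ≤ g ⟪ x ⟫ → pivot t g v ⟪ x ⟫ ≈ 0# → t ⟪ x ⟫ ≈ 0# × g ⟪ x ⟫ ≈ 0#
    pivot-null⁻¹ tx gx z =
        nonneg∧≯0⇒0 tx (λ p → pos⇒≉0 (pivot-posˡ p gx) z)
      , nonneg∧≯0⇒0 gx (λ p → pos⇒≉0 (pivot-posʳ tx p) z)

  infixl 5 _∷ʳ_
  -- The new vertex comes last, as in the vertex lists of the constructions, and the clauses reduce
  -- on each index. Thus `hull-tabulate` identifies the later simplices with those lists.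
  _∷ʳ_ : Vector Point 3 → Point → Vector Point 4
  (p ∷ʳ v) 0F = p 0F
  (p ∷ʳ v) 1F = p 1F
  (p ∷ʳ v) 2F = p 2F
  (p ∷ʳ v) 3F = v

  ∷ʳ-elim : ∀ {a} {P : Pred Point a} {p v} → (∀ i → P (p i)) → P v → ∀ k → P ((p ∷ʳ v) k)
  ∷ʳ-elim h hv 0F = h 0F
  ∷ʳ-elim h hv 1F = h 1F
  ∷ʳ-elim h hv 2F = h 2F
  ∷ʳ-elim h hv 3F = hv

  independent-∷ʳ : ∀ {p : Vector Point 3} {v} f → Independent p → (∀ i → f ⟪ p i ⟫ ≈ 0#) → f ⟪ v ⟫ ≉ 0# → Independent (p ∷ʳ v)
  independent-∷ʳ {p} {v} f ind z nz k =
    let φ , one , rest = independent-∷ {x = v} f ind z nz (ρ k)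
    in φ , trans (reflexive (≡.cong (φ ⟪_⟫) (same k))) one
     , λ j ne → trans (reflexive (≡.cong (φ ⟪_⟫) (same j))) (rest (ρ j) (ne ∘ ρ-injective j k))
    where
    ρ : Fin 4 → Fin 4
    ρ 0F = 1F
    ρ 1F = 2F
    ρ 2F = 3F
    ρ 3F = 0F
    same : ∀ k → (p ∷ʳ v) k ≡ (v ∷ᵛ p) (ρ k)
    same 0F = ≡.refl
    same 1F = ≡.refl
    same 2F = ≡.refl
    same 3F = ≡.refl
    ρ⁻¹ : Fin 4 → Fin 4
    ρ⁻¹ 0F = 3F
    ρ⁻¹ 1F = 0F
    ρ⁻¹ 2F = 1F
    ρ⁻¹ 3F = 2F
    ρ⁻¹∘ρ : ∀ k → ρ⁻¹ (ρ k) ≡ k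
    ρ⁻¹∘ρ 0F = ≡.refl
    ρ⁻¹∘ρ 1F = ≡.refl
    ρ⁻¹∘ρ 2F = ≡.refl
    ρ⁻¹∘ρ 3F = ≡.refl
    ρ-injective : ∀ j k → ρ j ≡ ρ k → j ≡ k
    ρ-injective j k e = ≡.trans (≡.sym (ρ⁻¹∘ρ j)) (≡.trans (≡.cong ρ⁻¹ e) (ρ⁻¹∘ρ k))

  module _ {Q : Subset} (Qp : Poly Q) {t u} (S : Simplex Q t u) where
    open Simplex S

    keep-simplex : ∀ {v} → 0# < t ⟪ v ⟫ → Simplex (Q ⊞ v) t u
    keep-simplex {v} tv = record
      { nonneg = ext-nonneg nonneg (inj₁ tv) ; u∈ = λ i → old _ (u∈ i) ; null-at = null-at ; independent = independent
      ; zeros⊆ = λ x x∈ → zeros⊆ x (zeros-kept nonneg tv x x∈)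
      ; witness = witness ; witness∈ = old _ witness∈ ; witness-pos = witness-pos }
      where open Extension Qp v

    -- The triangle shared with the neighbour `g` is both negative and positive, so its cone is a
    -- new facet. The pivot cuts it out: in `Q` it vanishes only where both `t` and `g` do, that is
    -- on the triangle.
    new-simplex : ∀ {v g} i → t ⟪ v ⟫ < 0# → Facet Q g → Exactly Qp S ≐-refl g i → 0# < g ⟪ v ⟫ →
      Simplex (Q ⊞ v) (pivot t g v) (removeAt u i ∷ʳ v)
    new-simplex {v} {g} i tv G ex@(gz , gp) gv = record
      { nonneg = ext-nonneg piv≥0 (inj₂ (sym (pivot-at t g v)))
      ; u∈ = ∷ʳ-elim {P = _∈ Q ⊞ v} {removeAt u i} (λ k → old _ (u∈ _)) new
      ; null-at = ∷ʳ-elim {P = λ x → pivot t g v ⟪ x ⟫ ≈ 0#} {removeAt u i}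
          (λ k → pivot-null tv gv (null-at _) (gz _ (Fin.punchInᵢ≢i i k))) (pivot-at t g v)
      ; independent = independent-∷ʳ t (independent-∘ (punchIn i) (Fin.punchIn-injective i _ _) independent)
          (λ k → null-at _) (neg⇒≉0 tv)
      ; zeros⊆ = λ x x∈ → conv-bind (Zeros Q (pivot t g v) ∪ (_≋ v)) (Range u′)
          (λ { y (inj₁ y∈) → conv-mono (Range (removeAt u i)) {Y = Range u′} (λ z (k , e) → embed k z e) y (base y y∈)
             ; y (inj₂ e) → ∈-conv (Range u′) y (3F , e) }) x (zeros-coned piv≥0 (pivot-at t g v) x x∈)
      ; witness = u i ; witness∈ = old _ (u∈ i) ; witness-pos = pivot-posʳ tv gv (inj₂ (sym (null-at i))) gp }
      where
      open Extension Qp v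
      u′ = removeAt u i ∷ʳ v
      piv≥0 : NonNeg Q (pivot t g v)
      piv≥0 x x∈ = pivot-nonneg tv gv (nonneg x x∈) (Facet.nonneg G x x∈)
      base : ∀ x → x ∈ Zeros Q (pivot t g v) → x ∈ simplex (removeAt u i)
      base x (x∈ , z) = let tz , gz = pivot-null⁻¹ tv gv (nonneg x x∈) (Facet.nonneg G x x∈) z
                        in exactly-zeros Qp S ≐-refl ex x (zeros⊆ x (x∈ , tz)) gz
      embed : ∀ k z → z ≋ removeAt u i k → z ∈ Range u′
      embed 0F z e = 0F , e
      embed 1F z e = 1F , e
      embed 2F z e = 2F , e

    -- The functional dual to `u i` is nonnegative on the simplex, and a multiple of `t` makes it so
    -- on `Q`. It is a positive combination of facet functionals that vanish, like it, at the other
    -- three vertices; one of these must be positive at `u i`.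
    adjacent-facet : ∀ i → ∃[ g ] Facet Q g × Exactly Qp S ≐-refl g i
    adjacent-facet i = h , proj₁ (proj₂ generators) (proj₁ h∈) , (λ j ne → proj₂ h∈ (u j) (j , ne , ≋-refl)) , h>0
      where
      open Poly Qp using (exceed; corner∈)
      φ = proj₁ (independent i)
      φ-one = proj₁ (proj₂ (independent i))
      φ-rest = proj₂ (proj₂ (independent i))
      φ≥0 : NonNeg (simplex u) φ
      φ≥0 = nonneg-conv (Range u) φ λ x (j , e) → nonneg-resp (sym (eval-cong φ e)) (at j (j Fin.≟ i))
        where
        at : ∀ j → Dec (j ≡ i) → 0# ≤ φ ⟪ u j ⟫
        at j (yes ≡.refl) = nonneg-resp (sym φ-one) (inj₁ 0<1)
        at j (no ne)      = inj₂ (sym (φ-rest j ne))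
      exceeding = exceed nonneg φ λ k z → φ≥0 _ (zeros⊆ _ (corner∈ k , z))
      m = proj₁ exceeding
      f = m ⊙ t ⊕ φ
      f-at : ∀ j → f ⟪ u j ⟫ ≈ φ ⟪ u j ⟫
      f-at j = trans (⊙⊕-eval m t φ (u j)) (trans (+-congʳ (*-zeroʳ m (null-at j))) (+-identityˡ _))
      generators = facet-generators Qp
      Others : Pred Point ℓ₁
      Others x = ∃[ j ] j ≢ i × x ≋ u j
      found = cone-positive {v = u i}
        (cone-vanish {X = Others}
          (λ {h} h∈ x (j , _ , e) → nonneg-resp (sym (eval-cong h e)) (Facet.nonneg (proj₁ (proj₂ generators) h∈) (u j) (u∈ j)))
          (proj₂ (proj₂ generators) f (proj₂ (proj₂ exceeding)))
          (λ x (j , ne , e) → trans (eval-cong f e) (trans (f-at j) (φ-rest j ne))))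
        (pos-resp (sym (trans (f-at i) φ-one)) 0<1)
      h = proj₁ found
      h∈ = proj₁ (proj₂ found)
      h>0 = proj₂ (proj₂ found)

  -- Unfolds to one equation for each member of the set, so that evidence for an explicit set is a
  -- tuple ending in `tt`.
  NullOn : ∀ {n} → Vec Bool n → Vector Point n → AffineFunctional → Set ℓ₁
  NullOn [] u f = ⊤
  NullOn (true ∷ J) u f = f ⟪ u zero ⟫ ≈ 0# × NullOn J (tail u) f
  NullOn (false ∷ J) u f = NullOn J (tail u) f

  null-on : ∀ {n} (J : Vec Bool n) {u f} → NullOn J u f → ∀ i → J ∋ i → f ⟪ u i ⟫ ≈ 0#
  null-on (true ∷ J)  (z , _)  zero    _ = z
  null-on (true ∷ J)  (_ , zs) (suc i) p = null-on J zs i p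
  null-on (false ∷ J) zs       (suc i) p = null-on J zs i p

  -- Runs through all subsets, at most 32 in the applications below, so the condition is settled by
  -- evaluation.
  covered? : ∀ {n} (negs poss nons : List (Vec Bool n)) →
    Dec (All (λ J → Within J negs → Within J poss ⊎ Containing J nons) (subsets n))
  covered? negs poss nons = All.all?
    (λ J → Any.any? (J ⊑?_) negs →-dec (Any.any? (J ⊑?_) poss ⊎-dec Any.any? (_⊑? J) nons)) (subsets _)

  balanced? : ∀ {n} (negs poss : List (Vec Bool n)) δ → Dec (Balanced negs poss δ)
  balanced? negs poss δ = Fin.all? λ i → _ ℕ.≟ _

  Tops : ∀ {n} → Subset → Point → Vector Point n → List (Vec Bool n) → Set ℓ
  Tops Q v u poss = All (λ L → ∃[ f ] Facet Q f × NullOn L u f × 0# < f ⟪ v ⟫) poss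

  tops⇒pos-facet : ∀ {n Q v} {u : Vector Point n} {poss} → Tops Q v u poss →
    ∀ {L} → L ∈ˡ poss → ∃[ f ] NonNeg Q f × (∀ i → L ∋ i → f ⟪ u i ⟫ ≈ 0#) × 0# < f ⟪ v ⟫
  tops⇒pos-facet tops {L} L∈ = let f , F , z , p = All.lookup tops L∈ in f , Facet.nonneg F , null-on L z , p

  module _ {Q : Subset} (Qp : Poly Q) {T : Subset} {t u} (S : Simplex Q t u) (T≐ : T ≐ simplex u) {v} (is : List (Fin 4))
    (v∈ : v ∈ Region Q T (List.map (triangle u) is) []) where
    open Simplex S
    open RegionRule Qp S T≐ is [] v∈
    open Selections u independent

    private
      whole : Vec Bool 4
      whole = Vec.replicate 4 true

      in-whole : ∀ i → whole ∋ i
      in-whole 0F = ≡.refl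
      in-whole 1F = ≡.refl
      in-whole 2F = ≡.refl
      in-whole 3F = ≡.refl

      ⊆-span : ∀ x → x ∈ Zeros Q t → x ∈ span whole
      ⊆-span x x∈ = conv-mono (Range u) {Y = Selected whole} (λ y (i , e) → i , in-whole i , e) x (zeros⊆ x x∈)

    -- A facet that contains a triangle listed in `is` is `T` itself or the neighbour across it. The
    -- first is negative at `v` and the second zero, so no facet through that triangle is positive;
    -- this is why the complements of the members of `is` form `nons`.
    simplex-visibility : ∀ {poss} → Tops Q v u poss → {_ : True (covered? (whole ∷ []) poss (List.map without is))} →
      Visibility Q v u independent (whole ∷ []) poss (List.map without is)
    simplex-visibility {poss} tops {cov} = record
      { neg-facet = λ { (here ≡.refl) → t , nonneg , (λ i _ → null-at i) , ⊆-span , simplex-neg }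
      ; neg-complete = λ F h<0 → whole , here ≡.refl , neg-zeros F h<0
      ; pos-facet = tops⇒pos-facet tops
      ; non-facet = λ M∈ F z → let i , i∈ , M≡ = ∈-map⁻ without M∈ in
          not-pos F i∈ λ j ne → z j (≡.subst (_∋ j) (≡.sym M≡) (without-complete i j ne))
      ; covered = λ J → All.lookup (toWitness cov) (∈-subsets J)
      }
      where
      neg-zeros : ∀ {h} → Facet Q h → h ⟪ v ⟫ < 0# → ∀ x → x ∈ Zeros Q h → x ∈ span whole
      neg-zeros F h<0 x x∈ with region-cases F
      ... | all-null z        = ⊆-span x (facet-zeros S F z x x∈)
      ... | one-of-is i i∈ ex = ⊥-elim (neg⇒≉0 h<0 (exactly⇒null i∈ F ex))
      ... | positive p        = ⊥-elim (pos⇒≮0 p h<0)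
      not-pos : ∀ {h i} → Facet Q h → i ∈ˡ is → (∀ j → j ≢ i → h ⟪ u j ⟫ ≈ 0#) → ¬ 0# < h ⟪ v ⟫
      not-pos {h} {i} F i∈ z p with nonneg-split (Facet.nonneg F (u i) (u∈ i))
      ... | inj₂ hi = pos⇒≉0 p (exactly⇒null i∈ F (z , hi))
      ... | inj₁ hi = pos⇒≮0 p (all-null⇒neg F all)
        where
        all : ∀ j → h ⟪ u j ⟫ ≈ 0#
        all j with j Fin.≟ i
        ... | yes ≡.refl = hi
        ... | no ne      = z j ne

    -- In the runs below `v` lies in the hyperplanes of k neighbours, with k = 1, 2 or 3. Then `T`
    -- and k triangles are lost, while the empty face, four vertices, six edges and 4 - k triangles
    -- are coned, so `δ` is (1, 4, 6 - k, 3 - k).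
    stack-simplex : ∀ {poss} → Tops Q v u poss → ∀ δ →
      {_ : True (covered? (whole ∷ []) poss (List.map without is))} {_ : True (balanced? (whole ∷ []) poss δ)} →
      Adds Q (Q ⊞ v) δ
    stack-simplex tops δ {cov} {bal} = stack-f-vector Qp v u independent u∈ (simplex-visibility tops {cov}) (toWitness bal)

-- Polytopes with a simplex facet and the runs of the two constructions.

module Runs {c ℓ₁ ℓ₂} (K : OrderedField c ℓ₁ ℓ₂) where

  open OrderedFieldProperties K
  open AffineFunctionals K
  open ConvexHulls K
  open DualCones K
  open FacetFunctionals K
  open AddingAPoint K
  open VisibleFaces K
  open RegionSigns K
  open Stacking K

  polytope⇒poly : ∀ {P} → IsPolytope 4 P → Poly P
  polytope⇒poly {P} ((xs , i , j) , dim) = record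
    { convex = λ x x∈ → j (conv-bind P In (λ y → i) x x∈)
    ; corner = List.lookup xs
    ; corner∈ = λ k → j (∈-conv In (List.lookup xs k) (SetoidMembership.∈-lookup pointSetoid xs k))
    ; determined = λ f h x x∈ → nonneg-conv In f
        (λ y y∈ → nonneg-resp (eval-cong f (≋-sym (Any.lookup-index y∈))) (h (Any.index y∈))) x (i x∈)
    ; frame = proj₁ size ; frame∈ = proj₁ (proj₂ size) ; frame-ind = proj₁ (proj₂ (proj₂ size)) }
    where
    In : Pred Point _
    In y = Any (y ≋_) xs
    size : HasSize P 5
    size = dim⇒size dim

  simplex-facet : ∀ {P S} {u : Vector Point 4} → Poly P → IsFacet P S → AffinelyIndependent u → S ≐ simplex u →
    ∃[ t ] Simplex P t u
  simplex-facet {P} {S} {u} Pp (isface , _) affind (S⊆ , ⊆S) = t , record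
    { nonneg = Face.nonneg f
    ; u∈ = λ i → proj₁ (at i)
    ; null-at = λ i → proj₂ (at i)
    ; independent = ind
    ; zeros⊆ = λ x x∈ → S⊆ (Face.outside f x x∈)
    ; witness = frame (proj₁ positive) ; witness∈ = frame∈ (proj₁ positive) ; witness-pos = proj₂ positive }
    where
    open Poly Pp
    f : Face P S
    f = isFace⇒face isface
    t = Face.support f
    ind : Independent u
    ind = affinelyIndependent⇒independent affind
    at : ∀ i → u i ∈ Zeros P t
    at i = Face.inside f (u i) (⊆S (∈-conv (Range u) (u i) (∈-Range u i)))
    positive : ∃[ i ] 0# < t ⟪ frame i ⟫
    positive with all-or-some (λ i → nonneg-split (Face.nonneg f (frame i) (frame∈ i)))
    ... | inj₂ p = p
    -- If `t` vanished on the frame, five independent points would lie in the simplex, which is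
    -- spanned by four.
    ... | inj₁ z = ⊥-elim (ℕ.<⇒≱ (ℕ.n<1+n 4) (independent-≤ {q = u} frame-ind λ i g gz →
      vanish-conv (Range u) g (vanish-Range g gz) _ (S⊆ (Face.outside f _ (frame∈ i , z i)))))

  exactly : ∀ {u : Vector Point 4} {g} i → NullOn (without i) u g → 0# < g ⟪ u i ⟫ →
    (∀ j → j ≢ i → g ⟪ u j ⟫ ≈ 0#) × 0# < g ⟪ u i ⟫
  exactly i z p = (λ j ne → null-on (without i) z j (without-complete i j ne)) , p

  module Constructions {P S : Subset} (Pp : Poly P) {v₀ v₁ v₂ v₃ : Point} {t : AffineFunctional}
    (S₀ : Simplex P t (List.lookup (v₀ ∷ v₁ ∷ v₂ ∷ v₃ ∷ [])))
    (S≐ : S ≐ simplex (List.lookup (v₀ ∷ v₁ ∷ v₂ ∷ v₃ ∷ []))) where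

    private
      module Neighbour (i : Fin 4) where
        adjacent = adjacent-facet Pp S₀ i
        g = proj₁ adjacent
        facet : Facet P g
        facet = proj₁ (proj₂ adjacent)
        null-at : ∀ j → j ≢ i → g ⟪ List.lookup (v₀ ∷ v₁ ∷ v₂ ∷ v₃ ∷ []) j ⟫ ≈ 0#
        null-at = proj₁ (proj₂ (proj₂ adjacent))
        positive : 0# < g ⟪ List.lookup (v₀ ∷ v₁ ∷ v₂ ∷ v₃ ∷ []) i ⟫
        positive = proj₂ (proj₂ (proj₂ adjacent))

      module G₀₁₂ = Neighbour 3F
      module G₀₁₃ = Neighbour 2F
      module G₀₂₃ = Neighbour 1F
      module G₁₂₃ = Neighbour 0F

      -- A subscript lists the indices of the vertices of the facet that matter later.
      g₀₁₂ = G₀₁₂.g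
      g₀₁₃ = G₀₁₃.g
      g₀₂₃ = G₀₂₃.g
      g₁₂₃ = G₁₂₃.g

      0≤null : ∀ {x} → x ≈ 0# → 0# ≤ x
      0≤null z = inj₂ (sym z)

    -- Signs and increments along a run of the first construction.

    module _ (I : 𝓘¹ P S v₀ v₁ v₂ v₃) where
      open 𝓘¹ I

      private
        module R₁ = RegionRule Pp S₀ S≐ (3F ∷ []) [] v₄∈
        module E₁ = Extension Pp v₄

        t-v₄ : t ⟪ v₄ ⟫ < 0#
        t-v₄ = R₁.simplex-neg
        g₀₁₂-v₄ : g₀₁₂ ⟪ v₄ ⟫ ≈ 0#
        g₀₁₂-v₄ = R₁.exactly⇒null (here ≡.refl) G₀₁₂.facet (G₀₁₂.null-at , G₀₁₂.positive)
        g₀₁₃-v₄ : 0# < g₀₁₃ ⟪ v₄ ⟫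
        g₀₁₃-v₄ = R₁.pos-off G₀₁₃.facet 2F G₀₁₃.positive
        g₀₂₃-v₄ : 0# < g₀₂₃ ⟪ v₄ ⟫
        g₀₂₃-v₄ = R₁.pos-off G₀₂₃.facet 1F G₀₂₃.positive
        g₁₂₃-v₄ : 0# < g₁₂₃ ⟪ v₄ ⟫
        g₁₂₃-v₄ = R₁.pos-off G₁₂₃.facet 0F G₁₂₃.positive

        step₁ : Adds P P₁ (1 ∷ 4 ∷ 5 ∷ 2 ∷ [])
        step₁ = stack-simplex Pp S₀ S≐ (3F ∷ []) v₄∈
          {without 2F ∷ without 1F ∷ without 0F ∷ []}
          ( (g₀₁₃ , G₀₁₃.facet , (G₀₁₃.null-at 0F (λ ()) , G₀₁₃.null-at 1F (λ ()) , G₀₁₃.null-at 3F (λ ()) , tt) , g₀₁₃-v₄)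
          ∷ (g₀₂₃ , G₀₂₃.facet , (G₀₂₃.null-at 0F (λ ()) , G₀₂₃.null-at 2F (λ ()) , G₀₂₃.null-at 3F (λ ()) , tt) , g₀₂₃-v₄)
          ∷ (g₁₂₃ , G₁₂₃.facet , (G₁₂₃.null-at 1F (λ ()) , G₁₂₃.null-at 2F (λ ()) , G₁₂₃.null-at 3F (λ ()) , tt) , g₁₂₃-v₄)
          ∷ []) (1 ∷ 4 ∷ 5 ∷ 2 ∷ [])

        P₁p = E₁.ext-poly
        -- The letter of a functional records its age: `g` for facets of `P`, and `s`, `r`, `q`, `w`
        -- for facets created with v₄, v₅, v₆, v₇.
        s₀₁₃ = pivot t g₀₁₃ v₄
        s₀₂₃ = pivot t g₀₂₃ v₄
        s₁₂₃ = pivot t g₁₂₃ v₄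

        s₀₁₃-simplex : Simplex P₁ s₀₁₃ _
        s₀₁₃-simplex = new-simplex Pp S₀ 2F t-v₄ G₀₁₃.facet (G₀₁₃.null-at , G₀₁₃.positive) g₀₁₃-v₄
        s₀₂₃-simplex : Simplex P₁ s₀₂₃ _
        s₀₂₃-simplex = new-simplex Pp S₀ 1F t-v₄ G₀₂₃.facet (G₀₂₃.null-at , G₀₂₃.positive) g₀₂₃-v₄
        s₁₂₃-simplex : Simplex P₁ s₁₂₃ _
        s₁₂₃-simplex = new-simplex Pp S₀ 0F t-v₄ G₁₂₃.facet (G₁₂₃.null-at , G₁₂₃.positive) g₁₂₃-v₄

        g₀₁₂¹ : Facet P₁ g₀₁₂
        g₀₁₂¹ = E₁.ext-facet G₀₁₂.facet (0≤null g₀₁₂-v₄)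
        g₀₁₃¹ : Facet P₁ g₀₁₃
        g₀₁₃¹ = E₁.ext-facet G₀₁₃.facet (inj₁ g₀₁₃-v₄)
        g₀₂₃¹ : Facet P₁ g₀₂₃
        g₀₂₃¹ = E₁.ext-facet G₀₂₃.facet (inj₁ g₀₂₃-v₄)
        g₁₂₃¹ : Facet P₁ g₁₂₃
        g₁₂₃¹ = E₁.ext-facet G₁₂₃.facet (inj₁ g₁₂₃-v₄)

        module S₀₁₃ = Simplex s₀₁₃-simplex
        module S₀₂₃ = Simplex s₀₂₃-simplex
        module S₁₂₃ = Simplex s₁₂₃-simplex

        s₀₁₃-v₂ : 0# < s₀₁₃ ⟪ v₂ ⟫
        s₀₁₃-v₂ = S₀₁₃.witness-pos
        s₀₂₃-v₁ : 0# < s₀₂₃ ⟪ v₁ ⟫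
        s₀₂₃-v₁ = S₀₂₃.witness-pos
        s₁₂₃-v₀ : 0# < s₁₂₃ ⟪ v₀ ⟫
        s₁₂₃-v₀ = S₁₂₃.witness-pos

        module R₂ = RegionRule P₁p s₀₁₃-simplex (hull-tabulate _) (0F ∷ 3F ∷ []) [] v₅∈
        module E₂ = Extension P₁p v₅

        s₀₁₃-v₅ : s₀₁₃ ⟪ v₅ ⟫ < 0#
        s₀₁₃-v₅ = R₂.simplex-neg
        s₁₂₃-v₅ : s₁₂₃ ⟪ v₅ ⟫ ≈ 0#
        s₁₂₃-v₅ = R₂.exactly⇒null (here ≡.refl) S₁₂₃.facet
          (exactly 0F (S₁₂₃.null-at 0F , S₁₂₃.null-at 2F , S₁₂₃.null-at 3F , tt) s₁₂₃-v₀)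
        g₀₁₃-v₅ : g₀₁₃ ⟪ v₅ ⟫ ≈ 0#
        g₀₁₃-v₅ = R₂.exactly⇒null (there (here ≡.refl)) g₀₁₃¹
          (exactly 3F (G₀₁₃.null-at 0F (λ ()) , G₀₁₃.null-at 1F (λ ()) , G₀₁₃.null-at 3F (λ ()) , tt) g₀₁₃-v₄)
        s₀₂₃-v₅ : 0# < s₀₂₃ ⟪ v₅ ⟫
        s₀₂₃-v₅ = R₂.pos-off S₀₂₃.facet 1F s₀₂₃-v₁
        g₀₁₂-v₅ : 0# < g₀₁₂ ⟪ v₅ ⟫
        g₀₁₂-v₅ = R₂.pos-off g₀₁₂¹ 2F G₀₁₂.positive
        -- The value at v₀ alone would not do: it is also positive for the facet across v₁v₃v₄,
        -- whose hyperplane contains v₅. The value at v₄ excludes that case.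
        g₁₂₃-v₅ : 0# < g₁₂₃ ⟪ v₅ ⟫
        g₁₂₃-v₅ = R₂.pos-two g₁₂₃¹ 0F 3F G₁₂₃.positive g₁₂₃-v₄
        g₀₂₃-v₅ : 0# < g₀₂₃ ⟪ v₅ ⟫
        g₀₂₃-v₅ = R₂.pos-off g₀₂₃¹ 1F G₀₂₃.positive

        step₂ : Adds P₁ P₂ (1 ∷ 4 ∷ 4 ∷ 1 ∷ [])
        step₂ = stack-simplex P₁p s₀₁₃-simplex (hull-tabulate _) (0F ∷ 3F ∷ []) v₅∈
          {without 1F ∷ without 2F ∷ (false ∷ true ∷ true ∷ false ∷ []) ∷ []}
          ( (s₀₂₃ , S₀₂₃.facet , (S₀₂₃.null-at 0F , S₀₂₃.null-at 2F , S₀₂₃.null-at 3F , tt) , s₀₂₃-v₅)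
          ∷ (g₀₁₂ , g₀₁₂¹ , (G₀₁₂.null-at 0F (λ ()) , G₀₁₂.null-at 1F (λ ()) , g₀₁₂-v₄ , tt) , g₀₁₂-v₅)
          -- The edge v₁v₃ is common to the two lost triangles and lies in neither of the other two.
          -- It remains a face because `g₁₂₃` vanishes on it and is positive at v₅; each later step
          -- needs such a facet for every edge of this kind.
          ∷ (g₁₂₃ , g₁₂₃¹ , (G₁₂₃.null-at 1F (λ ()) , G₁₂₃.null-at 3F (λ ()) , tt) , g₁₂₃-v₅)
          ∷ []) (1 ∷ 4 ∷ 4 ∷ 1 ∷ [])

        P₂p = E₂.ext-poly
        r₀₃₄ = pivot s₀₁₃ s₀₂₃ v₅
        -- As v₄ was placed in the hyperplane of `g₀₁₂`, that old facet has become the neighbour of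
        -- `S₂` across v₀v₁v₄.
        r₀₁₄ = pivot s₀₁₃ g₀₁₂ v₅

        r₀₃₄-simplex : Simplex P₂ r₀₃₄ _
        r₀₃₄-simplex = new-simplex P₁p s₀₁₃-simplex 1F s₀₁₃-v₅ S₀₂₃.facet
          (exactly 1F (S₀₂₃.null-at 0F , S₀₂₃.null-at 2F , S₀₂₃.null-at 3F , tt) s₀₂₃-v₁) s₀₂₃-v₅
        r₀₁₄-simplex : Simplex P₂ r₀₁₄ _
        r₀₁₄-simplex = new-simplex P₁p s₀₁₃-simplex 2F s₀₁₃-v₅ g₀₁₂¹
          (exactly 2F (G₀₁₂.null-at 0F (λ ()) , G₀₁₂.null-at 1F (λ ()) , g₀₁₂-v₄ , tt) G₀₁₂.positive) g₀₁₂-v₅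
        s₀₂₃-simplex² : Simplex P₂ s₀₂₃ _
        s₀₂₃-simplex² = keep-simplex P₁p s₀₂₃-simplex s₀₂₃-v₅
        s₁₂₃² : Facet P₂ s₁₂₃
        s₁₂₃² = E₂.ext-facet S₁₂₃.facet (0≤null s₁₂₃-v₅)
        g₀₁₂² : Facet P₂ g₀₁₂
        g₀₁₂² = E₂.ext-facet g₀₁₂¹ (inj₁ g₀₁₂-v₅)
        g₀₁₃² : Facet P₂ g₀₁₃
        g₀₁₃² = E₂.ext-facet g₀₁₃¹ (0≤null g₀₁₃-v₅)
        g₀₂₃² : Facet P₂ g₀₂₃
        g₀₂₃² = E₂.ext-facet g₀₂₃¹ (inj₁ g₀₂₃-v₅)
        g₁₂₃² : Facet P₂ g₁₂₃
        g₁₂₃² = E₂.ext-facet g₁₂₃¹ (inj₁ g₁₂₃-v₅)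

        module R₀₃₄ = Simplex r₀₃₄-simplex
        module R₀₁₄ = Simplex r₀₁₄-simplex

        r₀₃₄-v₂ : 0# < r₀₃₄ ⟪ v₂ ⟫
        r₀₃₄-v₂ = pivot-posˡ s₀₁₃-v₅ s₀₂₃-v₅ s₀₁₃-v₂ (0≤null (S₀₂₃.null-at 1F))
        r₀₁₄-v₂ : 0# < r₀₁₄ ⟪ v₂ ⟫
        r₀₁₄-v₂ = pivot-posˡ s₀₁₃-v₅ g₀₁₂-v₅ s₀₁₃-v₂ (0≤null (G₀₁₂.null-at 2F (λ ())))
        r₀₁₄-v₃ : 0# < r₀₁₄ ⟪ v₃ ⟫
        r₀₁₄-v₃ = R₀₁₄.witness-pos

        module R₃ = RegionRule P₂p s₀₂₃-simplex² (hull-tabulate _) (1F ∷ 3F ∷ []) [] v₆∈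
        module E₃ = Extension P₂p v₆

        s₀₂₃-v₆ : s₀₂₃ ⟪ v₆ ⟫ < 0#
        s₀₂₃-v₆ = R₃.simplex-neg
        r₀₃₄-v₆ : r₀₃₄ ⟪ v₆ ⟫ ≈ 0#
        r₀₃₄-v₆ = R₃.exactly⇒null (here ≡.refl) R₀₃₄.facet
          (exactly 1F (R₀₃₄.null-at 0F , R₀₃₄.null-at 1F , R₀₃₄.null-at 2F , tt) r₀₃₄-v₂)
        g₀₂₃-v₆ : g₀₂₃ ⟪ v₆ ⟫ ≈ 0#
        g₀₂₃-v₆ = R₃.exactly⇒null (there (here ≡.refl)) g₀₂₃²
          (exactly 3F (G₀₂₃.null-at 0F (λ ()) , G₀₂₃.null-at 2F (λ ()) , G₀₂₃.null-at 3F (λ ()) , tt) g₀₂₃-v₄)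
        g₀₁₂-v₆ : 0# < g₀₁₂ ⟪ v₆ ⟫
        g₀₁₂-v₆ = R₃.pos-off g₀₁₂² 2F G₀₁₂.positive
        s₁₂₃-v₆ : 0# < s₁₂₃ ⟪ v₆ ⟫
        s₁₂₃-v₆ = R₃.pos-off s₁₂₃² 0F s₁₂₃-v₀
        g₀₁₃-v₆ : 0# < g₀₁₃ ⟪ v₆ ⟫
        g₀₁₃-v₆ = R₃.pos-two g₀₁₃² 1F 3F G₀₁₃.positive g₀₁₃-v₄
        r₀₁₄-v₆ : 0# < r₀₁₄ ⟪ v₆ ⟫
        r₀₁₄-v₆ = R₃.pos-off R₀₁₄.facet 2F r₀₁₄-v₃
        g₁₂₃-v₆ : 0# < g₁₂₃ ⟪ v₆ ⟫
        g₁₂₃-v₆ = R₃.pos-off g₁₂₃² 0F G₁₂₃.positive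

        step₃ : Adds P₂ P₃ (1 ∷ 4 ∷ 4 ∷ 1 ∷ [])
        step₃ = stack-simplex P₂p s₀₂₃-simplex² (hull-tabulate _) (1F ∷ 3F ∷ []) v₆∈
          {without 2F ∷ without 0F ∷ (true ∷ false ∷ true ∷ false ∷ []) ∷ []}
          ( (g₀₁₂ , g₀₁₂² , (G₀₁₂.null-at 0F (λ ()) , G₀₁₂.null-at 2F (λ ()) , g₀₁₂-v₄ , tt) , g₀₁₂-v₆)
          ∷ (s₁₂₃ , s₁₂₃² , (S₁₂₃.null-at 1F , S₁₂₃.null-at 2F , S₁₂₃.null-at 3F , tt) , s₁₂₃-v₆)
          ∷ (g₀₁₃ , g₀₁₃² , (G₀₁₃.null-at 0F (λ ()) , G₀₁₃.null-at 3F (λ ()) , tt) , g₀₁₃-v₆)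
          ∷ []) (1 ∷ 4 ∷ 4 ∷ 1 ∷ [])

        P₃p = E₃.ext-poly
        -- This cuts out `S₅` and the next one `S₄`. Since `S₅` is used only after v₇ has been
        -- added, it has to be shown to survive that step.
        q₀₂₄ = pivot s₀₂₃ g₀₁₂ v₆
        q₂₃₄ = pivot s₀₂₃ s₁₂₃ v₆

        q₀₂₄-simplex : Simplex P₃ q₀₂₄ _
        q₀₂₄-simplex = new-simplex P₂p s₀₂₃-simplex² 2F s₀₂₃-v₆ g₀₁₂²
          (exactly 2F (G₀₁₂.null-at 0F (λ ()) , G₀₁₂.null-at 2F (λ ()) , g₀₁₂-v₄ , tt) G₀₁₂.positive) g₀₁₂-v₆
        q₂₃₄-simplex : Simplex P₃ q₂₃₄ _
        q₂₃₄-simplex = new-simplex P₂p s₀₂₃-simplex² 0F s₀₂₃-v₆ s₁₂₃²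
          (exactly 0F (S₁₂₃.null-at 1F , S₁₂₃.null-at 2F , S₁₂₃.null-at 3F , tt) s₁₂₃-v₀) s₁₂₃-v₆
        r₀₃₄³ : Facet P₃ r₀₃₄
        r₀₃₄³ = E₃.ext-facet R₀₃₄.facet (0≤null r₀₃₄-v₆)
        r₀₁₄³ : Facet P₃ r₀₁₄
        r₀₁₄³ = E₃.ext-facet R₀₁₄.facet (inj₁ r₀₁₄-v₆)
        s₁₂₃³ : Facet P₃ s₁₂₃
        s₁₂₃³ = E₃.ext-facet s₁₂₃² (inj₁ s₁₂₃-v₆)
        g₀₂₃³ : Facet P₃ g₀₂₃
        g₀₂₃³ = E₃.ext-facet g₀₂₃² (0≤null g₀₂₃-v₆)
        g₁₂₃³ : Facet P₃ g₁₂₃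
        g₁₂₃³ = E₃.ext-facet g₁₂₃² (inj₁ g₁₂₃-v₆)

        module Q₀₂₄ = Simplex q₀₂₄-simplex
        module Q₂₃₄ = Simplex q₂₃₄-simplex

        q₀₂₄-v₃ : 0# < q₀₂₄ ⟪ v₃ ⟫
        q₀₂₄-v₃ = Q₀₂₄.witness-pos
        q₂₃₄-v₀ : 0# < q₂₃₄ ⟪ v₀ ⟫
        q₂₃₄-v₀ = Q₂₃₄.witness-pos

        module R₄ = RegionRule P₃p q₂₃₄-simplex (hull-tabulate _) (3F ∷ 2F ∷ []) [] v₇∈
        module E₄ = Extension P₃p v₇

        q₂₃₄-v₇ : q₂₃₄ ⟪ v₇ ⟫ < 0#
        q₂₃₄-v₇ = R₄.simplex-neg
        s₁₂₃-v₇ : s₁₂₃ ⟪ v₇ ⟫ ≈ 0#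
        s₁₂₃-v₇ = R₄.exactly⇒null (here ≡.refl) s₁₂₃³
          (exactly 3F (S₁₂₃.null-at 1F , S₁₂₃.null-at 2F , S₁₂₃.null-at 3F , tt) s₁₂₃-v₆)
        g₀₂₃-v₇ : g₀₂₃ ⟪ v₇ ⟫ ≈ 0#
        g₀₂₃-v₇ = R₄.exactly⇒null (there (here ≡.refl)) g₀₂₃³
          (exactly 2F (G₀₂₃.null-at 2F (λ ()) , G₀₂₃.null-at 3F (λ ()) , g₀₂₃-v₆ , tt) g₀₂₃-v₄)
        q₀₂₄-v₇ : 0# < q₀₂₄ ⟪ v₇ ⟫
        q₀₂₄-v₇ = R₄.pos-off Q₀₂₄.facet 1F q₀₂₄-v₃
        r₀₃₄-v₇ : 0# < r₀₃₄ ⟪ v₇ ⟫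
        r₀₃₄-v₇ = R₄.pos-off r₀₃₄³ 0F r₀₃₄-v₂
        g₁₂₃-v₇ : 0# < g₁₂₃ ⟪ v₇ ⟫
        g₁₂₃-v₇ = R₄.pos-two g₁₂₃³ 2F 3F g₁₂₃-v₄ g₁₂₃-v₆
        r₀₁₄-v₇ : 0# < r₀₁₄ ⟪ v₇ ⟫
        r₀₁₄-v₇ = R₄.pos-off r₀₁₄³ 0F r₀₁₄-v₂

        step₄ : Adds P₃ P₄ (1 ∷ 4 ∷ 4 ∷ 1 ∷ [])
        step₄ = stack-simplex P₃p q₂₃₄-simplex (hull-tabulate _) (3F ∷ 2F ∷ []) v₇∈
          {without 1F ∷ without 0F ∷ (true ∷ true ∷ false ∷ false ∷ []) ∷ []}
          ( (q₀₂₄ , Q₀₂₄.facet , (Q₀₂₄.null-at 1F , Q₀₂₄.null-at 2F , Q₀₂₄.null-at 3F , tt) , q₀₂₄-v₇)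
          -- Since v₆ lies in the hyperplane of `r₀₃₄`, this facet is the neighbour of `S₄` across
          -- v₃v₄v₆.
          ∷ (r₀₃₄ , r₀₃₄³ , (R₀₃₄.null-at 1F , R₀₃₄.null-at 2F , r₀₃₄-v₆ , tt) , r₀₃₄-v₇)
          ∷ (g₁₂₃ , g₁₂₃³ , (G₁₂₃.null-at 2F (λ ()) , G₁₂₃.null-at 3F (λ ()) , tt) , g₁₂₃-v₇)
          ∷ []) (1 ∷ 4 ∷ 4 ∷ 1 ∷ [])

        P₄p = E₄.ext-poly
        w₃₄₆ = pivot q₂₃₄ r₀₃₄ v₇

        w₃₄₆-simplex : Simplex P₄ w₃₄₆ _
        w₃₄₆-simplex = new-simplex P₃p q₂₃₄-simplex 0F q₂₃₄-v₇ r₀₃₄³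
          (exactly 0F (R₀₃₄.null-at 1F , R₀₃₄.null-at 2F , r₀₃₄-v₆ , tt) r₀₃₄-v₂) r₀₃₄-v₇
        q₀₂₄-simplex⁴ : Simplex P₄ q₀₂₄ _
        q₀₂₄-simplex⁴ = keep-simplex P₃p q₀₂₄-simplex q₀₂₄-v₇
        g₀₂₃⁴ : Facet P₄ g₀₂₃
        g₀₂₃⁴ = E₄.ext-facet g₀₂₃³ (0≤null g₀₂₃-v₇)
        r₀₁₄⁴ : Facet P₄ r₀₁₄
        r₀₁₄⁴ = E₄.ext-facet r₀₁₄³ (inj₁ r₀₁₄-v₇)
        s₁₂₃⁴ : Facet P₄ s₁₂₃
        s₁₂₃⁴ = E₄.ext-facet s₁₂₃³ (0≤null s₁₂₃-v₇)

        module W₃₄₆ = Simplex w₃₄₆-simplex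

        w₃₄₆-v₀ : 0# < w₃₄₆ ⟪ v₀ ⟫
        w₃₄₆-v₀ = pivot-posˡ q₂₃₄-v₇ r₀₃₄-v₇ q₂₃₄-v₀ (0≤null (R₀₃₄.null-at 0F))
        w₃₄₆-v₂ : 0# < w₃₄₆ ⟪ v₂ ⟫
        w₃₄₆-v₂ = W₃₄₆.witness-pos

        module R₅ = RegionRule P₄p q₀₂₄-simplex⁴ (hull-tabulate _) (1F ∷ 0F ∷ 3F ∷ []) [] v₈∈

        step₅ : Adds P₄ result (1 ∷ 4 ∷ 3 ∷ 0 ∷ [])
        -- The three lost triangles all contain v₄, so only v₀v₂v₆ stays. The edges v₄v₆, v₀v₄ and
        -- v₂v₄ each lie in two lost triangles and are kept by `w₃₄₆`, `r₀₁₄` and `s₁₂₃`.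
        step₅ = stack-simplex P₄p q₀₂₄-simplex⁴ (hull-tabulate _) (1F ∷ 0F ∷ 3F ∷ []) v₈∈
          {without 2F ∷ (false ∷ false ∷ true ∷ true ∷ []) ∷ (true ∷ false ∷ true ∷ false ∷ [])
            ∷ (false ∷ true ∷ true ∷ false ∷ []) ∷ []}
          ( (g₀₂₃ , g₀₂₃⁴ , (G₀₂₃.null-at 0F (λ ()) , G₀₂₃.null-at 2F (λ ()) , g₀₂₃-v₆ , tt) , R₅.pos-off g₀₂₃⁴ 2F g₀₂₃-v₄)
          ∷ (w₃₄₆ , W₃₄₆.facet , (W₃₄₆.null-at 1F , W₃₄₆.null-at 2F , tt) , R₅.pos-two W₃₄₆.facet 0F 1F w₃₄₆-v₀ w₃₄₆-v₂)
          ∷ (r₀₁₄ , r₀₁₄⁴ , (R₀₁₄.null-at 0F , R₀₁₄.null-at 2F , tt) , R₅.pos-two r₀₁₄⁴ 1F 3F r₀₁₄-v₂ r₀₁₄-v₆)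
          ∷ (s₁₂₃ , s₁₂₃⁴ , (S₁₂₃.null-at 1F , S₁₂₃.null-at 3F , tt) , R₅.pos-two s₁₂₃⁴ 0F 3F s₁₂₃-v₀ s₁₂₃-v₆)
          ∷ []) (1 ∷ 4 ∷ 3 ∷ 0 ∷ [])

      -- One step with k = 1, three with k = 2 and one with k = 3: (1, 4, 5, 2) + 3 (1, 4, 4, 1) +
      -- (1, 4, 3, 0).
      𝓘¹-adds : Adds P result (5 ∷ 20 ∷ 20 ∷ 5 ∷ [])
      𝓘¹-adds = step₁ ⨾ step₂ ⨾ step₃ ⨾ step₄ ⨾ step₅

    -- Signs and increments along a run of the second construction.

    module _ (I : 𝓘² P S v₀ v₁ v₂ v₃) where
      open 𝓘² I

      private
        module R₁ = RegionRule Pp S₀ S≐ (2F ∷ []) [] v₄∈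
        module E₁ = Extension Pp v₄

        t-v₄ : t ⟪ v₄ ⟫ < 0#
        t-v₄ = R₁.simplex-neg
        g₀₁₂-v₄ : 0# < g₀₁₂ ⟪ v₄ ⟫
        g₀₁₂-v₄ = R₁.pos-off G₀₁₂.facet 3F G₀₁₂.positive
        g₀₁₃-v₄ : g₀₁₃ ⟪ v₄ ⟫ ≈ 0#
        g₀₁₃-v₄ = R₁.exactly⇒null (here ≡.refl) G₀₁₃.facet (G₀₁₃.null-at , G₀₁₃.positive)
        g₀₂₃-v₄ : 0# < g₀₂₃ ⟪ v₄ ⟫
        g₀₂₃-v₄ = R₁.pos-off G₀₂₃.facet 1F G₀₂₃.positive
        g₁₂₃-v₄ : 0# < g₁₂₃ ⟪ v₄ ⟫
        g₁₂₃-v₄ = R₁.pos-off G₁₂₃.facet 0F G₁₂₃.positive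

        step₁ : Adds P Q₁ (1 ∷ 4 ∷ 5 ∷ 2 ∷ [])
        step₁ = stack-simplex Pp S₀ S≐ (2F ∷ []) v₄∈
          {without 3F ∷ without 1F ∷ without 0F ∷ []}
          ( (g₀₁₂ , G₀₁₂.facet , (G₀₁₂.null-at 0F (λ ()) , G₀₁₂.null-at 1F (λ ()) , G₀₁₂.null-at 2F (λ ()) , tt) , g₀₁₂-v₄)
          ∷ (g₀₂₃ , G₀₂₃.facet , (G₀₂₃.null-at 0F (λ ()) , G₀₂₃.null-at 2F (λ ()) , G₀₂₃.null-at 3F (λ ()) , tt) , g₀₂₃-v₄)
          ∷ (g₁₂₃ , G₁₂₃.facet , (G₁₂₃.null-at 1F (λ ()) , G₁₂₃.null-at 2F (λ ()) , G₁₂₃.null-at 3F (λ ()) , tt) , g₁₂₃-v₄)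
          ∷ []) (1 ∷ 4 ∷ 5 ∷ 2 ∷ [])

        Q₁p = E₁.ext-poly
        s₀₁₂ = pivot t g₀₁₂ v₄
        s₀₂₃ = pivot t g₀₂₃ v₄
        s₁₂₃ = pivot t g₁₂₃ v₄

        s₀₁₂-simplex : Simplex Q₁ s₀₁₂ _
        s₀₁₂-simplex = new-simplex Pp S₀ 3F t-v₄ G₀₁₂.facet (G₀₁₂.null-at , G₀₁₂.positive) g₀₁₂-v₄
        s₀₂₃-simplex : Simplex Q₁ s₀₂₃ _
        s₀₂₃-simplex = new-simplex Pp S₀ 1F t-v₄ G₀₂₃.facet (G₀₂₃.null-at , G₀₂₃.positive) g₀₂₃-v₄
        s₁₂₃-simplex : Simplex Q₁ s₁₂₃ _
        s₁₂₃-simplex = new-simplex Pp S₀ 0F t-v₄ G₁₂₃.facet (G₁₂₃.null-at , G₁₂₃.positive) g₁₂₃-v₄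
        g₀₁₂¹ : Facet Q₁ g₀₁₂
        g₀₁₂¹ = E₁.ext-facet G₀₁₂.facet (inj₁ g₀₁₂-v₄)
        g₀₁₃¹ : Facet Q₁ g₀₁₃
        g₀₁₃¹ = E₁.ext-facet G₀₁₃.facet (0≤null g₀₁₃-v₄)
        g₀₂₃¹ : Facet Q₁ g₀₂₃
        g₀₂₃¹ = E₁.ext-facet G₀₂₃.facet (inj₁ g₀₂₃-v₄)
        g₁₂₃¹ : Facet Q₁ g₁₂₃
        g₁₂₃¹ = E₁.ext-facet G₁₂₃.facet (inj₁ g₁₂₃-v₄)

        module S₀₁₂ = Simplex s₀₁₂-simplex
        module S₀₂₃ = Simplex s₀₂₃-simplex
        module S₁₂₃ = Simplex s₁₂₃-simplex

        s₀₁₂-v₃ : 0# < s₀₁₂ ⟪ v₃ ⟫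
        s₀₁₂-v₃ = S₀₁₂.witness-pos
        s₀₂₃-v₁ : 0# < s₀₂₃ ⟪ v₁ ⟫
        s₀₂₃-v₁ = S₀₂₃.witness-pos
        s₁₂₃-v₀ : 0# < s₁₂₃ ⟪ v₀ ⟫
        s₁₂₃-v₀ = S₁₂₃.witness-pos

        module R₂ = RegionRule Q₁p s₁₂₃-simplex (hull-tabulate _) (2F ∷ 3F ∷ []) [] v₅∈
        module E₂ = Extension Q₁p v₅

        s₁₂₃-v₅ : s₁₂₃ ⟪ v₅ ⟫ < 0#
        s₁₂₃-v₅ = R₂.simplex-neg
        s₀₁₂-v₅ : s₀₁₂ ⟪ v₅ ⟫ ≈ 0#
        s₀₁₂-v₅ = R₂.exactly⇒null (here ≡.refl) S₀₁₂.facet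
          (exactly 2F (S₀₁₂.null-at 1F , S₀₁₂.null-at 2F , S₀₁₂.null-at 3F , tt) s₀₁₂-v₃)
        g₁₂₃-v₅ : g₁₂₃ ⟪ v₅ ⟫ ≈ 0#
        g₁₂₃-v₅ = R₂.exactly⇒null (there (here ≡.refl)) g₁₂₃¹
          (exactly 3F (G₁₂₃.null-at 1F (λ ()) , G₁₂₃.null-at 2F (λ ()) , G₁₂₃.null-at 3F (λ ()) , tt) g₁₂₃-v₄)
        s₀₂₃-v₅ : 0# < s₀₂₃ ⟪ v₅ ⟫
        s₀₂₃-v₅ = R₂.pos-off S₀₂₃.facet 0F s₀₂₃-v₁
        g₀₁₃-v₅ : 0# < g₀₁₃ ⟪ v₅ ⟫
        g₀₁₃-v₅ = R₂.pos-off g₀₁₃¹ 1F G₀₁₃.positive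
        g₀₁₂-v₅ : 0# < g₀₁₂ ⟪ v₅ ⟫
        g₀₁₂-v₅ = R₂.pos-two g₀₁₂¹ 2F 3F G₀₁₂.positive g₀₁₂-v₄
        g₀₂₃-v₅ : 0# < g₀₂₃ ⟪ v₅ ⟫
        g₀₂₃-v₅ = R₂.pos-off g₀₂₃¹ 0F G₀₂₃.positive

        step₂ : Adds Q₁ Q₂ (1 ∷ 4 ∷ 4 ∷ 1 ∷ [])
        step₂ = stack-simplex Q₁p s₁₂₃-simplex (hull-tabulate _) (2F ∷ 3F ∷ []) v₅∈
          {without 0F ∷ without 1F ∷ (true ∷ true ∷ false ∷ false ∷ []) ∷ []}
          ( (s₀₂₃ , S₀₂₃.facet , (S₀₂₃.null-at 1F , S₀₂₃.null-at 2F , S₀₂₃.null-at 3F , tt) , s₀₂₃-v₅)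
          ∷ (g₀₁₃ , g₀₁₃¹ , (G₀₁₃.null-at 1F (λ ()) , G₀₁₃.null-at 3F (λ ()) , g₀₁₃-v₄ , tt) , g₀₁₃-v₅)
          ∷ (g₀₁₂ , g₀₁₂¹ , (G₀₁₂.null-at 1F (λ ()) , G₀₁₂.null-at 2F (λ ()) , tt) , g₀₁₂-v₅)
          ∷ []) (1 ∷ 4 ∷ 4 ∷ 1 ∷ [])

        Q₂p = E₂.ext-poly
        r₂₃₄ = pivot s₁₂₃ s₀₂₃ v₅
        r₁₃₄ = pivot s₁₂₃ g₀₁₃ v₅

        r₂₃₄-simplex : Simplex Q₂ r₂₃₄ _
        r₂₃₄-simplex = new-simplex Q₁p s₁₂₃-simplex 0F s₁₂₃-v₅ S₀₂₃.facet
          (exactly 0F (S₀₂₃.null-at 1F , S₀₂₃.null-at 2F , S₀₂₃.null-at 3F , tt) s₀₂₃-v₁) s₀₂₃-v₅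
        r₁₃₄-simplex : Simplex Q₂ r₁₃₄ _
        r₁₃₄-simplex = new-simplex Q₁p s₁₂₃-simplex 1F s₁₂₃-v₅ g₀₁₃¹
          (exactly 1F (G₀₁₃.null-at 1F (λ ()) , G₀₁₃.null-at 3F (λ ()) , g₀₁₃-v₄ , tt) G₀₁₃.positive) g₀₁₃-v₅
        s₀₂₃-simplex² : Simplex Q₂ s₀₂₃ _
        s₀₂₃-simplex² = keep-simplex Q₁p s₀₂₃-simplex s₀₂₃-v₅
        s₀₁₂² : Facet Q₂ s₀₁₂
        s₀₁₂² = E₂.ext-facet S₀₁₂.facet (0≤null s₀₁₂-v₅)
        g₀₁₂² : Facet Q₂ g₀₁₂
        g₀₁₂² = E₂.ext-facet g₀₁₂¹ (inj₁ g₀₁₂-v₅)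
        g₀₁₃² : Facet Q₂ g₀₁₃
        g₀₁₃² = E₂.ext-facet g₀₁₃¹ (inj₁ g₀₁₃-v₅)
        g₀₂₃² : Facet Q₂ g₀₂₃
        g₀₂₃² = E₂.ext-facet g₀₂₃¹ (inj₁ g₀₂₃-v₅)
        g₁₂₃² : Facet Q₂ g₁₂₃
        g₁₂₃² = E₂.ext-facet g₁₂₃¹ (0≤null g₁₂₃-v₅)

        module R₂₃₄ = Simplex r₂₃₄-simplex
        module R₁₃₄ = Simplex r₁₃₄-simplex
        module S₀₂₃² = Simplex s₀₂₃-simplex²

        r₂₃₄-v₀ : 0# < r₂₃₄ ⟪ v₀ ⟫
        r₂₃₄-v₀ = pivot-posˡ s₁₂₃-v₅ s₀₂₃-v₅ s₁₂₃-v₀ (0≤null (S₀₂₃.null-at 0F))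
        r₁₃₄-v₀ : 0# < r₁₃₄ ⟪ v₀ ⟫
        r₁₃₄-v₀ = pivot-posˡ s₁₂₃-v₅ g₀₁₃-v₅ s₁₂₃-v₀ (0≤null (G₀₁₃.null-at 0F (λ ())))
        r₁₃₄-v₂ : 0# < r₁₃₄ ⟪ v₂ ⟫
        r₁₃₄-v₂ = R₁₃₄.witness-pos

        module R₃ = RegionRule Q₂p s₀₂₃-simplex² (hull-tabulate _) (2F ∷ 3F ∷ []) (0F ∷ []) v₆∈
        module E₃ = Extension Q₂p v₆

        s₀₂₃-v₆ : s₀₂₃ ⟪ v₆ ⟫ < 0#
        s₀₂₃-v₆ = R₃.simplex-neg
        r₂₃₄-v₆ : r₂₃₄ ⟪ v₆ ⟫ < 0#
        r₂₃₄-v₆ = R₃.exactly⇒neg (here ≡.refl) R₂₃₄.facet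
          (exactly 0F (R₂₃₄.null-at 0F , R₂₃₄.null-at 1F , R₂₃₄.null-at 2F , tt) r₂₃₄-v₀)
        s₀₁₂-v₆ : s₀₁₂ ⟪ v₆ ⟫ ≈ 0#
        s₀₁₂-v₆ = R₃.exactly⇒null (here ≡.refl) s₀₁₂²
          (exactly 2F (S₀₁₂.null-at 0F , S₀₁₂.null-at 2F , S₀₁₂.null-at 3F , tt) s₀₁₂-v₃)
        g₀₂₃-v₆ : g₀₂₃ ⟪ v₆ ⟫ ≈ 0#
        g₀₂₃-v₆ = R₃.exactly⇒null (there (here ≡.refl)) g₀₂₃²
          (exactly 3F (G₀₂₃.null-at 0F (λ ()) , G₀₂₃.null-at 2F (λ ()) , G₀₂₃.null-at 3F (λ ()) , tt) g₀₂₃-v₄)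
        g₀₁₃-v₆ : 0# < g₀₁₃ ⟪ v₆ ⟫
        g₀₁₃-v₆ = R₃.pos-off g₀₁₃² 1F G₀₁₃.positive
        g₁₂₃-v₆ : 0# < g₁₂₃ ⟪ v₆ ⟫
        g₁₂₃-v₆ = R₃.pos-two g₁₂₃² 0F 3F G₁₂₃.positive g₁₂₃-v₄
        r₁₃₄-v₆ : 0# < r₁₃₄ ⟪ v₆ ⟫
        r₁₃₄-v₆ = R₃.pos-two R₁₃₄.facet 0F 1F r₁₃₄-v₀ r₁₃₄-v₂
        g₀₁₂-v₆ : 0# < g₀₁₂ ⟪ v₆ ⟫
        g₀₁₂-v₆ = R₃.pos-two g₀₁₂² 2F 3F G₀₁₂.positive g₀₁₂-v₄

        -- Both S₃ and conv{v₂,v₃,v₄,v₅} are visible from v₆; together they have the vertices u₅.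
        u₅ : Vector Point 5
        u₅ = v₅ ∷ᵛ List.lookup (v₀ ∷ v₂ ∷ v₃ ∷ v₄ ∷ [])

        u₅-ind : Independent u₅
        u₅-ind = independent-resp u₅≡ (independent-∷ {x = v₅} s₀₂₃ S₀₂₃.independent S₀₂₃.null-at (pos⇒≉0 s₀₂₃-v₅))
          where
          u₅≡ : ∀ i → (v₅ ∷ᵛ (removeAt (List.lookup (v₀ ∷ v₁ ∷ v₂ ∷ v₃ ∷ [])) 1F ∷ʳ v₄)) i ≡ u₅ i
          u₅≡ 0F = ≡.refl
          u₅≡ 1F = ≡.refl
          u₅≡ 2F = ≡.refl
          u₅≡ 3F = ≡.refl
          u₅≡ 4F = ≡.refl

        u₅∈ : ∀ i → u₅ i ∈ Q₂
        u₅∈ 0F = E₂.new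
        u₅∈ 1F = S₀₂₃².u∈ 0F
        u₅∈ 2F = S₀₂₃².u∈ 1F
        u₅∈ 3F = S₀₂₃².u∈ 2F
        u₅∈ 4F = S₀₂₃².u∈ 3F

        -- The edge v₂v₄ lies in exactly the three facets cut out by r₂₃₄, s₀₁₂ and s₀₂₃.
        edge₂₄ : ∀ {h} → NonNeg Q₂ h → h ⟪ v₂ ⟫ ≈ 0# → h ⟪ v₄ ⟫ ≈ 0# → ∃[ α ] ∃[ β ] ∃[ γ ]
          (0# ≤ α × 0# ≤ β × 0# ≤ γ) × (0# < h ⟪ v₀ ⟫ → 0# < α) ×
          (∀ x → h ⟪ x ⟫ ≈ α * r₂₃₄ ⟪ x ⟫ + (β * s₀₁₂ ⟪ x ⟫ + γ * s₀₂₃ ⟪ x ⟫))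
        edge₂₄ {h} h≥0 h₂ h₄ = α , β , γ
          , ( nonneg*nonneg (h≥0 v₀ (u₅∈ 1F)) (inj₁ (proj₁ (proj₂ a)))
            , nonneg*nonneg (h≥0 v₃ (u₅∈ 3F)) (inj₁ (proj₁ (proj₂ b)))
            , nonneg*nonneg (h≥0 v₅ (u₅∈ 0F)) (inj₁ (proj₁ (proj₂ d))) )
          , (λ p → *-pos p (proj₁ (proj₂ a)))
          , λ x → trans (independent₅-ext u₅-ind {h} {w} agree x) (w-eval x)
          where
          a = inverse-pos r₂₃₄-v₀
          b = inverse-pos s₀₁₂-v₃
          d = inverse-pos s₀₂₃-v₅
          -- All three functionals vanish at v₂ and v₄, and at each of v₀, v₃, v₅ exactly one of
          -- them does not. So the coefficients are quotients of values there, and agreement at the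
          -- five independent points `u₅` is enough.
          α = h ⟪ v₀ ⟫ * proj₁ a
          β = h ⟪ v₃ ⟫ * proj₁ b
          γ = h ⟪ v₅ ⟫ * proj₁ d
          w = α ⊙ r₂₃₄ ⊕ (β ⊙ s₀₁₂ ⊕ γ ⊙ s₀₂₃)
          w-eval : ∀ x → w ⟪ x ⟫ ≈ α * r₂₃₄ ⟪ x ⟫ + (β * s₀₁₂ ⟪ x ⟫ + γ * s₀₂₃ ⟪ x ⟫)
          w-eval x = trans (⊙⊕-eval α r₂₃₄ _ x) (+-congˡ (trans (⊙⊕-eval β s₀₁₂ _ x) (+-congˡ (⊙-eval γ s₀₂₃ x))))
          cancel : ∀ {y z i} → z * i ≈ 1# → y ≈ y * i * z
          cancel {y} {z} {i} e = trans (sym (*-identityʳ y)) (trans (*-congˡ (trans (sym e) (*-comm z i))) (sym (*-assoc y i z)))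
          agree : ∀ k → h ⟪ u₅ k ⟫ ≈ w ⟪ u₅ k ⟫
          agree 0F = trans (cancel (proj₂ (proj₂ d))) (sym (trans (w-eval v₅) (trans (+-cong (*-zeroʳ α (R₂₃₄.null-at 3F))
            (trans (+-congʳ (*-zeroʳ β s₀₁₂-v₅)) (+-identityˡ _))) (+-identityˡ _))))
          agree 1F = trans (cancel (proj₂ (proj₂ a))) (sym (trans (w-eval v₀) (trans (+-congˡ
            (+-zero (*-zeroʳ β (S₀₁₂.null-at 0F)) (*-zeroʳ γ (S₀₂₃.null-at 0F)))) (+-identityʳ _))))
          agree 2F = trans h₂ (sym (trans (w-eval v₂) (+-zero (*-zeroʳ α (R₂₃₄.null-at 0F))
            (+-zero (*-zeroʳ β (S₀₁₂.null-at 2F)) (*-zeroʳ γ (S₀₂₃.null-at 1F))))))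
          agree 3F = trans (cancel (proj₂ (proj₂ b))) (sym (trans (w-eval v₃) (trans (+-cong (*-zeroʳ α (R₂₃₄.null-at 1F))
            (trans (+-congˡ (*-zeroʳ γ (S₀₂₃.null-at 2F))) (+-identityʳ _))) (+-identityˡ _))))
          agree 4F = trans h₄ (sym (trans (w-eval v₄) (+-zero (*-zeroʳ α (R₂₃₄.null-at 2F))
            (+-zero (*-zeroʳ β (S₀₁₂.null-at 3F)) (*-zeroʳ γ (S₀₂₃.null-at 3F))))))

        open Selections u₅ u₅-ind using (span; Selected)

        S₃-set N-set : Vec Bool 5
        S₃-set = false ∷ true ∷ true ∷ true ∷ true ∷ []
        N-set  = true ∷ false ∷ true ∷ true ∷ true ∷ []

        S₃-span : ∀ x → x ∈ Zeros Q₂ s₀₂₃ → x ∈ span S₃-set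
        S₃-span x x∈ = conv-mono (Range w) {Y = Selected S₃-set} (λ y (i , e) → pick y i e) x (S₀₂₃².zeros⊆ x x∈)
          where
          w = removeAt (List.lookup (v₀ ∷ v₁ ∷ v₂ ∷ v₃ ∷ [])) 1F ∷ʳ v₄
          pick : ∀ y i → y ≋ w i → y ∈ Selected S₃-set
          pick y 0F e = 1F , ≡.refl , e
          pick y 1F e = 2F , ≡.refl , e
          pick y 2F e = 3F , ≡.refl , e
          pick y 3F e = 4F , ≡.refl , e

        N-span : ∀ x → x ∈ Zeros Q₂ r₂₃₄ → x ∈ span N-set
        N-span x x∈ = conv-mono (Range w) {Y = Selected N-set} (λ y (i , e) → pick y i e) x (R₂₃₄.zeros⊆ x x∈)
          where
          w = removeAt (removeAt (List.lookup (v₀ ∷ v₁ ∷ v₂ ∷ v₃ ∷ [])) 0F ∷ʳ v₄) 0F ∷ʳ v₅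
          pick : ∀ y i → y ≋ w i → y ∈ Selected N-set
          pick y 0F e = 2F , ≡.refl , e
          pick y 1F e = 3F , ≡.refl , e
          pick y 2F e = 4F , ≡.refl , e
          pick y 3F e = 0F , ≡.refl , e

        negs₃ poss₃ nons₃ : List (Vec Bool 5)
        negs₃ = S₃-set ∷ N-set ∷ []
        poss₃ = (false ∷ true ∷ false ∷ true ∷ true ∷ []) ∷ (true ∷ false ∷ true ∷ true ∷ false ∷ [])
          ∷ (true ∷ false ∷ false ∷ true ∷ true ∷ []) ∷ (false ∷ true ∷ true ∷ false ∷ false ∷ []) ∷ []
        nons₃ = (false ∷ false ∷ true ∷ false ∷ true ∷ []) ∷ (false ∷ true ∷ true ∷ true ∷ false ∷ []) ∷ []

        tops₃ : Tops Q₂ v₆ u₅ poss₃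
        tops₃ =
            (g₀₁₃ , g₀₁₃² , (G₀₁₃.null-at 0F (λ ()) , G₀₁₃.null-at 3F (λ ()) , g₀₁₃-v₄ , tt) , g₀₁₃-v₆)
          ∷ (g₁₂₃ , g₁₂₃² , (g₁₂₃-v₅ , G₁₂₃.null-at 2F (λ ()) , G₁₂₃.null-at 3F (λ ()) , tt) , g₁₂₃-v₆)
          ∷ (r₁₃₄ , R₁₃₄.facet , (R₁₃₄.null-at 3F , R₁₃₄.null-at 1F , R₁₃₄.null-at 2F , tt) , r₁₃₄-v₆)
          ∷ (g₀₁₂ , g₀₁₂² , (G₀₁₂.null-at 0F (λ ()) , G₀₁₂.null-at 2F (λ ()) , tt) , g₀₁₂-v₆)
          ∷ []

        -- The region only says that a facet across v₂v₃v₄ is negative. Such a facet vanishes on the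
        -- edge v₂v₄ and is positive at v₀, so in `edge₂₄` it has a positive share of `r₂₃₄` and its
        -- zeros are zeros of `r₂₃₄`.
        neg-complete₃ : ∀ {h} → Facet Q₂ h → h ⟪ v₆ ⟫ < 0# → R₃.Cases h →
          ∃[ L ] L ∈ˡ negs₃ × (∀ x → x ∈ Zeros Q₂ h → x ∈ span L)
        neg-complete₃ F h<0 (R₃.all-null z) = S₃-set , here ≡.refl , λ x x∈ → S₃-span x (facet-zeros s₀₂₃-simplex² F z x x∈)
        neg-complete₃ F h<0 (R₃.one-of-is i i∈ ex) = ⊥-elim (neg⇒≉0 h<0 (R₃.exactly⇒null i∈ F ex))
        neg-complete₃ F h<0 (R₃.positive p) = ⊥-elim (pos⇒≮0 p h<0)
        neg-complete₃ {h} F h<0 (R₃.one-of-js .0F (here ≡.refl) (z , p)) = N-set , there (here ≡.refl) , λ x (x∈ , hx) →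
          let α , β , γ , (_ , β≥0 , γ≥0) , α>0 , e = edge₂₄ (Facet.nonneg F) (z 1F (λ ())) (z 3F (λ ()))
          in N-span x (x∈ , ≉0∧*≈0⇒≈0 (pos⇒≉0 (α>0 p)) (proj₁ (nonneg+nonneg≈0
               (nonneg*nonneg (inj₁ (α>0 p)) (R₂₃₄.nonneg x x∈))
               (nonneg+nonneg (nonneg*nonneg β≥0 (Facet.nonneg s₀₁₂² x x∈)) (nonneg*nonneg γ≥0 (S₀₂₃².nonneg x x∈)))
               (trans (sym (e x)) hx))))

        -- At v₆ the three facets around the edge v₂v₄ have the signs negative, zero, negative, and
        -- `h` is a nonnegative combination of them.
        not-pos₂₄ : ∀ {h} → Facet Q₂ h → h ⟪ v₂ ⟫ ≈ 0# → h ⟪ v₄ ⟫ ≈ 0# → ¬ 0# < h ⟪ v₆ ⟫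
        not-pos₂₄ {h} F h₂ h₄ p =
          let α , β , γ , (α≥0 , _ , γ≥0) , _ , e = edge₂₄ (Facet.nonneg F) h₂ h₄
          in pos⇒≉0 (pos+nonneg p (nonneg+nonneg (nonneg*nonneg α≥0 (inj₁ (neg⇒-pos r₂₃₄-v₆)))
                                                 (nonneg*nonneg γ≥0 (inj₁ (neg⇒-pos s₀₂₃-v₆)))))
               (trans (+-congʳ (trans (e v₆) (+-congˡ (trans (+-congʳ (*-zeroʳ β s₀₁₂-v₆)) (+-identityˡ _)))))
                 (trans (solve 4 (λ α r γ s → (α :* r :+ γ :* s) :+ (α :* :- r :+ γ :* :- s) := (α :* r :+ γ :* s) :+ :- (α :* r :+ γ :* s))
                          refl α (r₂₃₄ ⟪ v₆ ⟫) γ (s₀₂₃ ⟪ v₆ ⟫))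
                   (-‿inverseʳ _)))

        -- If `h` is positive at v₄, it belongs to the facet across v₀v₂v₃, whose hyperplane
        -- contains v₆; if it is zero there, the edge v₂v₄ decides.
        not-pos₀₂₃ : ∀ {h} → Facet Q₂ h → h ⟪ v₀ ⟫ ≈ 0# → h ⟪ v₂ ⟫ ≈ 0# → h ⟪ v₃ ⟫ ≈ 0# → ¬ 0# < h ⟪ v₆ ⟫
        not-pos₀₂₃ {h} F h₀ h₂ h₃ p with nonneg-split (Facet.nonneg F v₄ (u₅∈ 4F))
        ... | inj₂ h₄ = pos⇒≉0 p (R₃.exactly⇒null (there (here ≡.refl)) F (exactly 3F (h₀ , h₂ , h₃ , tt) h₄))
        ... | inj₁ h₄ = not-pos₂₄ F h₂ h₄ p

        visibility₃ : Visibility Q₂ v₆ u₅ u₅-ind negs₃ poss₃ nons₃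
        visibility₃ = record
          { neg-facet = λ
              { (here ≡.refl) → s₀₂₃ , S₀₂₃².nonneg
                  , null-on S₃-set (S₀₂₃.null-at 0F , S₀₂₃.null-at 1F , S₀₂₃.null-at 2F , S₀₂₃.null-at 3F , tt) , S₃-span , s₀₂₃-v₆
              ; (there (here ≡.refl)) → r₂₃₄ , R₂₃₄.nonneg
                  , null-on N-set (R₂₃₄.null-at 3F , R₂₃₄.null-at 0F , R₂₃₄.null-at 1F , R₂₃₄.null-at 2F , tt) , N-span , r₂₃₄-v₆ }
          ; neg-complete = λ F h<0 → neg-complete₃ F h<0 (R₃.region-cases F)
          ; pos-facet = tops⇒pos-facet tops₃
          ; non-facet = λ
              { (here ≡.refl) F z → not-pos₂₄ F (z 2F ≡.refl) (z 4F ≡.refl)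
              ; (there (here ≡.refl)) F z → not-pos₀₂₃ F (z 1F ≡.refl) (z 2F ≡.refl) (z 3F ≡.refl) }
          ; covered = λ J → All.lookup (from-yes (covered? negs₃ poss₃ nons₃)) (∈-subsets J)
          }

        -- Lost are the edge v₂v₄, the three triangles on it, the triangle v₀v₂v₃ and two
        -- tetrahedra. Coned are the empty face, five vertices, eight edges and three triangles. So
        -- the increment is (1, 5 - 1, 8 - 4, 3 - 2), the same as for one simplex with two lost
        -- triangles.
        step₃ : Adds Q₂ Q₃ (1 ∷ 4 ∷ 4 ∷ 1 ∷ [])
        step₃ = stack-f-vector Q₂p v₆ u₅ u₅-ind u₅∈ visibility₃ (from-yes (balanced? negs₃ poss₃ (1 ∷ 4 ∷ 4 ∷ 1 ∷ [])))

        Q₃p = E₃.ext-poly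
        -- `S₄` is the pyramid over v₃v₄v₅, a triangle of the second visible facet, so it arises
        -- from `r₂₃₄` and not from `s₀₂₃`.
        q₃₄₅ = pivot r₂₃₄ r₁₃₄ v₆

        q₃₄₅-simplex : Simplex Q₃ q₃₄₅ _
        q₃₄₅-simplex = new-simplex Q₂p r₂₃₄-simplex 0F r₂₃₄-v₆ R₁₃₄.facet
          (exactly 0F (R₁₃₄.null-at 1F , R₁₃₄.null-at 2F , R₁₃₄.null-at 3F , tt) r₁₃₄-v₂) r₁₃₄-v₆
        s₀₁₂³ : Facet Q₃ s₀₁₂
        s₀₁₂³ = E₃.ext-facet s₀₁₂² (0≤null s₀₁₂-v₆)
        g₀₁₃³ : Facet Q₃ g₀₁₃
        g₀₁₃³ = E₃.ext-facet g₀₁₃² (inj₁ g₀₁₃-v₆)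
        g₀₂₃³ : Facet Q₃ g₀₂₃
        g₀₂₃³ = E₃.ext-facet g₀₂₃² (0≤null g₀₂₃-v₆)
        g₁₂₃³ : Facet Q₃ g₁₂₃
        g₁₂₃³ = E₃.ext-facet g₁₂₃² (inj₁ g₁₂₃-v₆)

        module R₄ = RegionRule Q₃p q₃₄₅-simplex (hull-tabulate _) (2F ∷ 3F ∷ 1F ∷ []) [] v₇∈

        step₄ : Adds Q₃ result (1 ∷ 4 ∷ 3 ∷ 0 ∷ [])
        -- The three lost triangles share v₃. The triangle v₄v₅v₆ is kept by `s₀₁₂`, whose
        -- hyperplane contains all three of its vertices, and the edges v₃v₄, v₃v₆, v₃v₅ by old
        -- facets of `P` that received v₄, v₆, v₅ respectively.
        step₄ = stack-simplex Q₃p q₃₄₅-simplex (hull-tabulate _) (2F ∷ 3F ∷ 1F ∷ []) v₇∈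
          {without 0F ∷ (true ∷ true ∷ false ∷ false ∷ []) ∷ (true ∷ false ∷ false ∷ true ∷ [])
            ∷ (true ∷ false ∷ true ∷ false ∷ []) ∷ []}
          ( (s₀₁₂ , s₀₁₂³ , (S₀₁₂.null-at 3F , s₀₁₂-v₅ , s₀₁₂-v₆ , tt) , R₄.pos-off s₀₁₂³ 0F s₀₁₂-v₃)
          ∷ (g₀₁₃ , g₀₁₃³ , (G₀₁₃.null-at 3F (λ ()) , g₀₁₃-v₄ , tt) , R₄.pos-two g₀₁₃³ 2F 3F g₀₁₃-v₅ g₀₁₃-v₆)
          ∷ (g₀₂₃ , g₀₂₃³ , (G₀₂₃.null-at 3F (λ ()) , g₀₂₃-v₆ , tt) , R₄.pos-two g₀₂₃³ 1F 2F g₀₂₃-v₄ g₀₂₃-v₅)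
          ∷ (g₁₂₃ , g₁₂₃³ , (G₁₂₃.null-at 3F (λ ()) , g₁₂₃-v₅ , tt) , R₄.pos-two g₁₂₃³ 1F 3F g₁₂₃-v₄ g₁₂₃-v₆)
          ∷ []) (1 ∷ 4 ∷ 3 ∷ 0 ∷ [])

      -- The total is (1, 4, 5, 2) + 2 (1, 4, 4, 1) + (1, 4, 3, 0).
      𝓘²-adds : Adds P result (4 ∷ 16 ∷ 16 ∷ 4 ∷ [])
      𝓘²-adds = step₁ ⨾ step₂ ⨾ step₃ ⨾ step₄

open import Data.Nat.Base using (_+_)

theorem3p7 : ∀ {c ℓ₁ ℓ₂} (K : OrderedField c ℓ₁ ℓ₂) → let open Polytopes K in
    (P S : Subset) (v₀ v₁ v₂ v₃ : Point) →
    IsPolytope 4 P →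
    IsFacet P S →
    IsSimplexWithVertices (v₀ ∷ v₁ ∷ v₂ ∷ v₃ ∷ []) S →
    BoundedPosition P S →
    (f : Vec ℕ 4) → HasFVector P f →
    ((I : 𝓘¹ P S v₀ v₁ v₂ v₃) → HasFVector (𝓘¹.result I) (zipWith _+_ f (5 ∷ 20 ∷ 20 ∷ 5 ∷ [])))
    × ((I : 𝓘² P S v₀ v₁ v₂ v₃) → HasFVector (𝓘².result I) (zipWith _+_ f (4 ∷ 16 ∷ 16 ∷ 4 ∷ [])))
theorem3p7 K P S v₀ v₁ v₂ v₃ polytope facet (independent , S≐) _ f H =
    (λ I → Adds.apply (𝓘¹-adds Pp simplex S≐simplex I) f H)
  , (λ I → Adds.apply (𝓘²-adds Pp simplex S≐simplex I) f H)
  where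
  open VisibleFaces K using (module Adds)
  open RegionSigns K using (hull-tabulate)
  open Runs K using (polytope⇒poly; simplex-facet; module Constructions)
  open Constructions using (𝓘¹-adds; 𝓘²-adds)
  u = List.lookup (v₀ ∷ v₁ ∷ v₂ ∷ v₃ ∷ [])
  Pp = polytope⇒poly polytope
  S≐simplex = ≐-trans S≐ (hull-tabulate u)
  simplex = proj₂ (simplex-facet Pp facet independent S≐simplex)
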